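{- The oriented graph $D_{1,1,2}$ is tileable.
   Context: An oriented graph is a loopless directed graph with at most one of $uv$, $vu$ for each pair of distinct vertices; a tournament has exactly one. $\delta^0(G)$ is the minimum semi-degree (minimum of all in- and out-degrees). An oriented graph $G$ on $n$ vertices with $\delta^0(G) = \lfloor (n-1)/2 \rfloor$ is called a semi-regular tournament. An $H$-tiling is a collection of vertex-disjoint copies of $H$; it is perfect if it covers all vertices. An oriented graph $H$ on $h$ vertices is tileable if there exists $n_0$ such that every semi-regular tournament on $n\ge n_0$ vertices with $h\mid n$ contains a perfect $H$-tiling. $D_{1,1,2}$ is the tournament on vertices $a, b, c_1, c_2$ with edges $ab$, $bc_1$, $bc_2$, $c_1a$, $c_2a$, $c_1c_2$ (the blow-up of the consistently oriented triangle where the third vertex is replaced by a transitive tournament on two vertices). -}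

module Defs where

open import Data.Nat using (ℕ; zero; suc; _≤_; _∸_)
open import Data.Nat.DivMod using (_/_)
open import Data.Nat.Divisibility using (_∣_)
open import Data.Fin using (Fin; zero; suc)
open import Data.Bool using (Bool; true; false; if_then_else_)
open import Data.List using (map; allFin)
open import Data.Nat.ListAction using (sum)
open import Data.Product using (Σ; ∃; _×_; _,_)
open import Data.Sum using (_⊎_)
open import Relation.Binary.PropositionalEquality using (_≡_)

record OrientedGraph (n : ℕ) : Set where
  field
    adj       : Fin n → Fin n → Bool
    loopless  : ∀ v → adj v v ≡ false
    oriented  : ∀ u v → adj u v ≡ true → adj v u ≡ false
open OrientedGraph public

outdeg : ∀ {n} → OrientedGraph n → Fin n → ℕ
outdeg {n} G v = sum (map (λ u → if adj G v u then 1 else 0) (allFin n))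

indeg : ∀ {n} → OrientedGraph n → Fin n → ℕ
indeg {n} G v = sum (map (λ u → if adj G u v then 1 else 0) (allFin n))

MinSemiDegreeIs : ∀ {n} → OrientedGraph n → ℕ → Set
MinSemiDegreeIs {n} G k =
  (∀ v → k ≤ outdeg G v × k ≤ indeg G v) ×
  (∃ λ v → outdeg G v ≡ k ⊎ indeg G v ≡ k)

SemiRegularTournament : ∀ {n} → OrientedGraph n → Set
SemiRegularTournament {n} G = MinSemiDegreeIs G ((n ∸ 1) / 2)

IsCopy : ∀ {h n} → OrientedGraph h → OrientedGraph n → (Fin h → Fin n) → Set
IsCopy {h} H G f =
  (∀ x y → f x ≡ f y → x ≡ y) ×
  (∀ x y → adj H x y ≡ true → adj G (f x) (f y) ≡ true)

PerfectTiling : ∀ {h n} → OrientedGraph h → OrientedGraph n → Set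
PerfectTiling {h} {n} H G =
  Σ ℕ λ k → Σ (Fin k → Fin h → Fin n) λ f →
    (∀ i → IsCopy H G (f i)) ×
    (∀ i j x y → f i x ≡ f j y → i ≡ j) ×
    (∀ v → ∃ λ i → ∃ λ x → f i x ≡ v)

Tileable : ∀ {h} → OrientedGraph h → Set
Tileable {h} H =
  ∃ λ n₀ → ∀ n → n₀ ≤ n → h ∣ n → (G : OrientedGraph n) →
    SemiRegularTournament G → PerfectTiling H G

-- D_{1,1,2} on vertices a = 0, b = 1, c₁ = 2, c₂ = 3 with arcs
-- ab, bc₁, bc₂, c₁a, c₂a, c₁c₂
d112-adj : Fin 4 → Fin 4 → Bool
d112-adj zero (suc zero) = true
d112-adj (suc zero) (suc (suc zero)) = true
d112-adj (suc zero) (suc (suc (suc zero))) = true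
d112-adj (suc (suc zero)) zero = true
d112-adj (suc (suc (suc zero))) zero = true
d112-adj (suc (suc zero)) (suc (suc (suc zero))) = true
d112-adj _ _ = false

private
  d112-loopless : ∀ v → d112-adj v v ≡ false
  d112-loopless zero = _≡_.refl
  d112-loopless (suc zero) = _≡_.refl
  d112-loopless (suc (suc zero)) = _≡_.refl
  d112-loopless (suc (suc (suc zero))) = _≡_.refl

  d112-oriented : ∀ u v → d112-adj u v ≡ true → d112-adj v u ≡ false
  d112-oriented zero (suc zero) _ = _≡_.refl
  d112-oriented (suc zero) (suc (suc zero)) _ = _≡_.refl
  d112-oriented (suc zero) (suc (suc (suc zero))) _ = _≡_.refl
  d112-oriented (suc (suc zero)) zero _ = _≡_.refl
  d112-oriented (suc (suc (suc zero))) zero _ = _≡_.refl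
  d112-oriented (suc (suc zero)) (suc (suc (suc zero))) _ = _≡_.refl
  d112-oriented zero zero ()
  d112-oriented zero (suc (suc zero)) ()
  d112-oriented zero (suc (suc (suc zero))) ()
  d112-oriented (suc zero) zero ()
  d112-oriented (suc zero) (suc zero) ()
  d112-oriented (suc (suc zero)) (suc zero) ()
  d112-oriented (suc (suc zero)) (suc (suc zero)) ()
  d112-oriented (suc (suc (suc zero))) (suc zero) ()
  d112-oriented (suc (suc (suc zero))) (suc (suc zero)) ()
  d112-oriented (suc (suc (suc zero))) (suc (suc (suc zero))) ()

D112 : OrientedGraph 4
D112 = record { adj = d112-adj ; loopless = d112-loopless ; oriented = d112-oriented }

{-# OPTIONS --safe #-}

-- D₁₁₂ is the only strong tournament on four vertices, so a cyclic triangle together with a vertex having both an in- and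
-- an out-neighbour in it ("mixed" to it) spans a copy.  In a nearly regular tournament on N vertices there are about N³/24
-- cyclic triangles, every vertex lies in about N²/8 of them and is mixed to at least about 3/4 of them.
--
-- Almost perfect tiling.  The 3/4 gives, for every weighting of the vertices of total ≥ 0, a copy of weight ≥ 0: let x have
-- maximal weight and average over the triangles mixed to x.  Weight q by the effect of its removal on Φ = Σ (d⁺ - d⁻)²;
-- then copies can be removed one by one so that Φ stays O(n²) up to the contribution of the initial imbalance, which
-- decreases like N².  Vertices whose degrees become unbalanced are discarded, and Φ pays for them.
--
-- Absorption.  Any two vertices are mixed to at least about half of all cyclic triangles in common, so O(log n) copies
-- suffice to let an arbitrary vertex x take over the role of a fixed vertex y.  Doing this for the vertices of t disjoint
-- copies yields a set of O(t log n) vertices that absorbs any leftover of at most 4t vertices.  With t of order √n this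
-- set is small enough for the first part to leave at most 4t vertices when it is applied to the rest.
module Submission where

open import Defs
import Data.Bool as Bool
open import Data.Bool using (Bool; true; false; if_then_else_; not; _∧_)
open import Data.Empty using (⊥; ⊥-elim)
open import Data.Fin using (Fin; zero; suc)
open import Data.Integer as ℤ hiding (suc; _/_; _%_)
open import Data.Integer.Properties
open import Data.Integer.Tactic.RingSolver using (solve-∀)
open import Data.List using (List; []; _∷_; length; _++_; filterᵇ; map; allFin)
open import Data.List.Membership.Propositional using (_∈_; find; lose)
open import Data.List.Membership.Propositional.Properties using (∈-∃++; ∈-allFin; ∈-++⁺ˡ; ∈-++⁺ʳ)
open import Data.List.Properties using (++-assoc; length-++; length-tabulate)
open import Data.List.Relation.Binary.Permutation.Propositional
  using (_↭_; ↭-refl; ↭-sym; ↭-trans; ↭-prep; ↭-swap; ↭-reflexive)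
import Data.List.Relation.Binary.Permutation.Propositional as Perm
open import Data.List.Relation.Binary.Permutation.Propositional.Properties
  using (↭-empty-inv; ↭-length; ∈-resp-↭; All-resp-↭; shift; shifts; ∷↭∷ʳ; ++⁺ˡ; ++⁺ʳ; ++-comm)
open import Data.List.Relation.Unary.All as All using (All; []; _∷_; all?)
open import Data.List.Relation.Unary.All.Properties using (¬All⇒Any¬)
open import Data.List.Relation.Unary.AllPairs using ([]; _∷_)
open import Data.List.Relation.Unary.Any using (here; there; any?)
open import Data.List.Relation.Unary.Unique.Propositional using (Unique)
open import Data.List.Relation.Unary.Unique.Propositional.Properties using (allFin⁺)
open import Data.Nat as ℕ using (ℕ; zero; suc)
open import Data.Nat.Divisibility using (_∣_; divides; ∣m∣n⇒∣m+n; ∣m+n∣m⇒∣n)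
open import Data.Nat.DivMod using (_/_; _%_; m≡m%n+[m/n]*n; m%n<n)
open import Data.Nat.ListAction using (sum)
import Data.Nat.Properties as ℕ
open import Data.Nat.Tactic.RingSolver using () renaming (solve-∀ to ℕ-solve)
open import Data.Product using (∃; _×_; _,_; proj₁; proj₂)
open import Data.Sum using (_⊎_; inj₁; inj₂)
open import Function using (_∘_)
open import Relation.Binary.PropositionalEquality hiding ([_]; J)
open import Relation.Nullary using (yes; no; ¬_; Dec)
open import Relation.Nullary.Decidable using (_×-dec_)

-- Finite sums of integers

addˡ : ∀ a {b c} → b ≡ c → a + b ≡ a + c
addˡ a = cong (λ r → a + r)

infixl 6 _⊹_
infixl 7 _⊠_

_⊹_ : ∀ {a b} → 0ℤ ≤ a → 0ℤ ≤ b → 0ℤ ≤ a + b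
_⊹_ = +-mono-≤

_⊠_ : ∀ {a b} → 0ℤ ≤ a → 0ℤ ≤ b → 0ℤ ≤ a * b
_⊠_ {+ m} {+ n} _ _ = subst (0ℤ ≤_) (pos-* m n) (+≤+ ℕ.z≤n)

gap : ∀ {a b} → a ≤ b → 0ℤ ≤ b - a
gap = i≤j⇒0≤j-i

gap⁻¹ : ∀ a b {e} → 0ℤ ≤ e → b - a ≡ e → a ≤ b
gap⁻¹ a b p eq = 0≤i-j⇒j≤i (subst (0ℤ ≤_) (sym eq) p)

nat≥0 : ∀ n → 0ℤ ≤ + n
nat≥0 n = +≤+ ℕ.z≤n

sq≥0 : ∀ i → 0ℤ ≤ i * i
sq≥0 (+ n) = nat≥0 n ⊠ nat≥0 n
sq≥0 -[1+ n ] = nat≥0 _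

χ : Bool → ℤ
χ true = 1ℤ
χ false = 0ℤ

χ≥0 : ∀ b → 0ℤ ≤ χ b
χ≥0 true = nat≥0 1
χ≥0 false = nat≥0 0

∑ : ∀ {A : Set} → List A → (A → ℤ) → ℤ
∑ [] f = 0ℤ
∑ (x ∷ xs) f = f x + ∑ xs f

∑-cong : ∀ {A : Set} (xs : List A) {f g : A → ℤ} → (∀ x → f x ≡ g x) → ∑ xs f ≡ ∑ xs g
∑-cong [] h = refl
∑-cong (x ∷ xs) h = cong₂ _+_ (h x) (∑-cong xs h)

∑-mono : ∀ {A : Set} (xs : List A) {f g : A → ℤ} → (∀ x → x ∈ xs → f x ≤ g x) → ∑ xs f ≤ ∑ xs g
∑-mono [] h = ≤-refl
∑-mono (x ∷ xs) h = +-mono-≤ (h x (here refl)) (∑-mono xs (λ y → h y ∘ there))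

∑-nonneg : ∀ {A : Set} (xs : List A) {f : A → ℤ} → (∀ x → x ∈ xs → 0ℤ ≤ f x) → 0ℤ ≤ ∑ xs f
∑-nonneg [] h = ≤-refl
∑-nonneg (x ∷ xs) h = h x (here refl) ⊹ ∑-nonneg xs (λ y → h y ∘ there)

∑-zero : ∀ {A : Set} (xs : List A) → ∑ xs (λ _ → 0ℤ) ≡ 0ℤ
∑-zero [] = refl
∑-zero (x ∷ xs) = trans (+-identityˡ _) (∑-zero xs)

∑-+ : ∀ {A : Set} (xs : List A) (f g : A → ℤ) → ∑ xs (λ x → f x + g x) ≡ ∑ xs f + ∑ xs g
∑-+ [] f g = refl
∑-+ (x ∷ xs) f g = trans (addˡ (f x + g x) (∑-+ xs f g)) (lem (f x) (g x) _ _)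
  where
  lem : ∀ p q r s → p + q + (r + s) ≡ p + r + (q + s)
  lem = solve-∀

∑-*ˡ : ∀ {A : Set} (xs : List A) c (f : A → ℤ) → ∑ xs (λ x → c * f x) ≡ c * ∑ xs f
∑-*ˡ [] c f = sym (*-zeroʳ c)
∑-*ˡ (x ∷ xs) c f = trans (addˡ (c * f x) (∑-*ˡ xs c f)) (sym (*-distribˡ-+ c (f x) _))

∑-*ʳ : ∀ {A : Set} (xs : List A) (f : A → ℤ) c → ∑ xs (λ x → f x * c) ≡ ∑ xs f * c
∑-*ʳ xs f c = trans (∑-cong xs (λ x → *-comm (f x) c)) (trans (∑-*ˡ xs c f) (*-comm c _))

∑-neg : ∀ {A : Set} (xs : List A) (f : A → ℤ) → ∑ xs (λ x → - f x) ≡ - ∑ xs f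
∑-neg [] f = refl
∑-neg (x ∷ xs) f = trans (addˡ (- f x) (∑-neg xs f)) (sym (neg-distrib-+ (f x) _))

∑-- : ∀ {A : Set} (xs : List A) (f g : A → ℤ) → ∑ xs (λ x → f x - g x) ≡ ∑ xs f - ∑ xs g
∑-- xs f g = trans (∑-+ xs f (λ x → - g x)) (addˡ (∑ xs f) (∑-neg xs g))

# : ∀ {A : Set} → List A → ℤ
# xs = + length xs

∑-const : ∀ {A : Set} (xs : List A) c → ∑ xs (λ _ → c) ≡ # xs * c
∑-const [] c = sym (*-zeroˡ c)
∑-const (x ∷ xs) c = trans (addˡ c (∑-const xs c)) (lem c (# xs))
  where
  lem : ∀ p q → p + q * p ≡ (1ℤ + q) * p
  lem = solve-∀

∑-swap : ∀ {A B : Set} (xs : List A) (ys : List B) (f : A → B → ℤ) →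
  ∑ xs (λ x → ∑ ys (f x)) ≡ ∑ ys (λ y → ∑ xs (λ x → f x y))
∑-swap [] ys f = sym (∑-zero ys)
∑-swap (x ∷ xs) ys f =
  trans (addˡ (∑ ys (f x)) (∑-swap xs ys f)) (sym (∑-+ ys (f x) _))

∑-++ : ∀ {A : Set} (xs ys : List A) (f : A → ℤ) → ∑ (xs ++ ys) f ≡ ∑ xs f + ∑ ys f
∑-++ [] ys f = sym (+-identityˡ _)
∑-++ (x ∷ xs) ys f = trans (addˡ (f x) (∑-++ xs ys f)) (sym (+-assoc (f x) _ _))

∑-↭ : ∀ {A : Set} {xs ys : List A} → xs ↭ ys → (f : A → ℤ) → ∑ xs f ≡ ∑ ys f
∑-↭ Perm.refl f = refl
∑-↭ (Perm.prep x p) f = addˡ (f x) (∑-↭ p f)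
∑-↭ (Perm.swap x y p) f = trans (cong (λ r → f x + (f y + r)) (∑-↭ p f)) (lem (f x) (f y) _)
  where
  lem : ∀ p q r → p + (q + r) ≡ q + (p + r)
  lem = solve-∀
∑-↭ (Perm.trans p q) f = trans (∑-↭ p f) (∑-↭ q f)

∑-filter : ∀ {A : Set} (p : A → Bool) xs (f : A → ℤ) → ∑ (filterᵇ p xs) f ≡ ∑ xs (λ x → χ (p x) * f x)
∑-filter p [] f = refl
∑-filter p (x ∷ xs) f with p x
... | true = cong₂ _+_ (sym (*-identityˡ (f x))) (∑-filter p xs f)
... | false = trans (∑-filter p xs f) (sym (trans (cong (λ r → r + ∑ xs (λ y → χ (p y) * f y)) (*-zeroˡ (f x))) (+-identityˡ _)))

#≡∑ : ∀ {A : Set} (xs : List A) → # xs ≡ ∑ xs (λ _ → 1ℤ)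
#≡∑ xs = sym (trans (∑-const xs 1ℤ) (*-identityʳ _))

#-filter : ∀ {A : Set} (p : A → Bool) xs → # (filterᵇ p xs) ≡ ∑ xs (χ ∘ p)
#-filter p xs = trans (#≡∑ (filterᵇ p xs))
  (trans (∑-filter p xs _) (∑-cong xs (λ x → *-identityʳ (χ (p x)))))

∑-pos : ∀ {A : Set} (xs : List A) (f : A → ℤ) → 0ℤ < ∑ xs f → ∃ λ x → x ∈ xs × 0ℤ < f x
∑-pos [] f (+<+ ())
∑-pos (x ∷ xs) f h with 0ℤ <? f x
... | yes p = x , here refl , p
... | no ¬p with ∑-pos xs f (<-≤-trans h (≤-trans (+-monoˡ-≤ (∑ xs f) (≮⇒≥ ¬p)) (≤-reflexive (+-identityˡ _))))
... | y , m , q = y , there m , q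

∑-skew : ∀ {A : Set} (xs : List A) (f : A → A → ℤ) → (∀ x y → f y x ≡ - f x y) →
  ∑ xs (λ x → ∑ xs (f x)) ≡ 0ℤ
∑-skew xs f h = self-neg (trans (∑-swap xs xs f)
  (trans (∑-cong xs (λ y → trans (∑-cong xs (λ x → h y x)) (∑-neg xs (f y)))) (∑-neg xs _)))
  where
  self-neg : ∀ {i} → i ≡ - i → i ≡ 0ℤ
  self-neg {+ 0} _ = refl
  self-neg {+[1+ n ]} ()
  self-neg { -[1+ n ]} ()

∑-prod : ∀ {A B : Set} (xs : List A) (ys : List B) (f : A → ℤ) (g : B → ℤ) →
  ∑ xs (λ x → ∑ ys (λ y → f x * g y)) ≡ ∑ xs f * ∑ ys g
∑-prod xs ys f g = trans (∑-cong xs (λ x → ∑-*ˡ ys (f x) g)) (∑-*ʳ xs f _)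

-- Cyclic triangles

data Arc : Set where
  out inn non : Arc

flip : Arc → Arc
flip out = inn
flip inn = out
flip non = non

val : Arc → ℤ
val out = 1ℤ
val inn = -1ℤ
val non = 0ℤ

isOut isInn isNon : Arc → Bool
isOut out = true
isOut _ = false
isInn inn = true
isInn _ = false
isNon non = true
isNon _ = false

allOut mix : Arc → Arc → Arc → Bool
allOut out out out = true
allOut _ _ _ = false
mix out out inn = true
mix out inn out = true
mix inn out out = true
mix out inn inn = true
mix inn out inn = true
mix inn inn out = true
mix _ _ _ = false

val-flip : ∀ e → val (flip e) ≡ - val e
val-flip out = refl
val-flip inn = refl
val-flip non = refl

∀Arc : (Arc → Bool) → Bool
∀Arc P = P out ∧ (P inn ∧ P non)

∀Bool : (Bool → Bool) → Bool
∀Bool P = P true ∧ P false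

∧-split : ∀ p {q} → p ∧ q ≡ true → p ≡ true × q ≡ true
∧-split true h = refl , h

∀Arc-elim : ∀ P → ∀Arc P ≡ true → ∀ e → P e ≡ true
∀Arc-elim P h out = proj₁ (∧-split (P out) h)
∀Arc-elim P h inn = proj₁ (∧-split (P inn) (proj₂ (∧-split (P out) h)))
∀Arc-elim P h non = proj₂ (∧-split (P inn) (proj₂ (∧-split (P out) h)))

∀Bool-elim : ∀ P → ∀Bool P ≡ true → ∀ e → P e ≡ true
∀Bool-elim P h true = proj₁ (∧-split (P true) h)
∀Bool-elim P h false = proj₂ (∧-split (P true) h)

classify-arcs : ∀ p q r i j k α β γ →
  let m = allOut p q r ∧ mix i j k ; C = (1ℤ + val p) * (1ℤ + val q) * (1ℤ + val r) in
  C ≤ χ m * C + χ (not m ∧ not (α ∧ (β ∧ γ))) * C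
  + χ (isOut i ∧ α) * (χ (isOut j ∧ β) * (χ (isOut k ∧ γ) * C))
  + χ (isInn i ∧ α) * (χ (isInn j ∧ β) * (χ (isInn k ∧ γ) * C))
  + (+ 8) * ((χ (isNon p) + χ (isNon q) + χ (isNon r)) + (χ (isNon i) + χ (isNon j) + χ (isNon k)))
classify-arcs p q r i j k α β γ = ≤ᵇ⇒≤ (subst Bool.T (sym checked) _)
  where
  f₀ : Arc → Arc → Arc → Arc → Arc → Arc → Bool → Bool → Bool → Bool
  f₀ p q r i j k α β γ =
    let m = allOut p q r ∧ mix i j k ; C = (1ℤ + val p) * (1ℤ + val q) * (1ℤ + val r) in
    C ≤ᵇ χ m * C + χ (not m ∧ not (α ∧ (β ∧ γ))) * C
    + χ (isOut i ∧ α) * (χ (isOut j ∧ β) * (χ (isOut k ∧ γ) * C))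
    + χ (isInn i ∧ α) * (χ (isInn j ∧ β) * (χ (isInn k ∧ γ) * C))
    + (+ 8) * ((χ (isNon p) + χ (isNon q) + χ (isNon r)) + (χ (isNon i) + χ (isNon j) + χ (isNon k)))
  f₃ : Arc → Arc → Arc → Arc → Arc → Arc → Bool
  f₃ p q r i j k = ∀Bool λ α → ∀Bool λ β → ∀Bool λ γ → f₀ p q r i j k α β γ
  f₆ : Arc → Arc → Arc → Bool
  f₆ p q r = ∀Arc λ i → ∀Arc λ j → ∀Arc λ k → f₃ p q r i j k
  checked₆ : f₆ p q r ≡ true
  checked₆ = ∀Arc-elim (f₆ p q) (∀Arc-elim (λ q → ∀Arc λ r → f₆ p q r) (∀Arc-elim (λ p → ∀Arc λ q → ∀Arc λ r → f₆ p q r) refl p) q) r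
  checked₃ : f₃ p q r i j k ≡ true
  checked₃ = ∀Arc-elim (f₃ p q r i j) (∀Arc-elim (λ j → ∀Arc λ k → f₃ p q r i j k) (∀Arc-elim (λ i → ∀Arc λ j → ∀Arc λ k → f₃ p q r i j k) checked₆ i) j) k
  checked : f₀ p q r i j k α β γ ≡ true
  checked = ∀Bool-elim (f₀ p q r i j k α β) (∀Bool-elim (λ β → ∀Bool λ γ → f₀ p q r i j k α β γ)
    (∀Bool-elim (λ α → ∀Bool λ β → ∀Bool λ γ → f₀ p q r i j k α β γ) checked₃ α) β) γ

∑² : ∀ {A : Set} → List A → (A → A → ℤ) → ℤ
∑² U f = ∑ U λ a → ∑ U (f a)

∑³ : ∀ {A : Set} → List A → (A → A → A → ℤ) → ℤ
∑³ U f = ∑ U λ a → ∑² U (f a)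

module _ {A : Set} (U : List A) where

  ∑²-cong : ∀ {f g : A → A → ℤ} → (∀ a b → f a b ≡ g a b) → ∑² U f ≡ ∑² U g
  ∑²-cong h = ∑-cong U (λ a → ∑-cong U (h a))

  ∑²-+ : ∀ (f g : A → A → ℤ) → ∑² U (λ a b → f a b + g a b) ≡ ∑² U f + ∑² U g
  ∑²-+ f g = trans (∑-cong U (λ a → ∑-+ U (f a) (g a))) (∑-+ U _ _)

  ∑³-cong : ∀ {f g : A → A → A → ℤ} → (∀ a b c → f a b c ≡ g a b c) → ∑³ U f ≡ ∑³ U g
  ∑³-cong h = ∑-cong U (λ a → ∑²-cong (h a))

  ∑³-+ : ∀ (f g : A → A → A → ℤ) → ∑³ U (λ a b c → f a b c + g a b c) ≡ ∑³ U f + ∑³ U g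
  ∑³-+ f g = trans (∑-cong U (λ a → ∑²-+ (f a) (g a))) (∑-+ U _ _)

  ∑³-+-step : ∀ (f g : A → A → A → ℤ) {e} → ∑³ U f ≡ e →
    ∑³ U (λ a b c → f a b c + g a b c) ≡ e + ∑³ U g
  ∑³-+-step f g eq = trans (∑³-+ f g) (cong (λ r → r + ∑³ U g) eq)

  ∑³-*ˡ : ∀ k (f : A → A → A → ℤ) → ∑³ U (λ a b c → k * f a b c) ≡ k * ∑³ U f
  ∑³-*ˡ k f = trans (∑-cong U (λ a → trans (∑-cong U (λ b → ∑-*ˡ U k (f a b))) (∑-*ˡ U k _))) (∑-*ˡ U k _)

  ∑³-mono : ∀ {f g : A → A → A → ℤ} →
    (∀ a b c → a ∈ U → b ∈ U → c ∈ U → f a b c ≤ g a b c) → ∑³ U f ≤ ∑³ U g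
  ∑³-mono h = ∑-mono U λ a a∈ → ∑-mono U λ b b∈ → ∑-mono U λ c c∈ → h a b c a∈ b∈ c∈

  ∑³-rotate : ∀ (f : A → A → A → ℤ) → ∑³ U (λ a b c → f b c a) ≡ ∑³ U f
  ∑³-rotate f = trans (∑-swap U U _) (∑-cong U λ b → ∑-swap U U _)

  ∑³-fst : ∀ (f : A → ℤ) → ∑³ U (λ a _ _ → f a) ≡ ∑ U f * (# U * # U)
  ∑³-fst f = trans (∑-cong U λ a → trans (∑-cong U (λ b → ∑-const U (f a)))
    (trans (∑-const U _) (lem (# U) (f a)))) (∑-*ʳ U f _)
    where
    lem : ∀ p q → p * (p * q) ≡ q * (p * p)
    lem = solve-∀

  ∑³-fst₂ : ∀ (f : A → A → ℤ) → ∑³ U (λ a b _ → f a b) ≡ ∑² U f * # U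
  ∑³-fst₂ f = trans (∑-cong U λ a → trans (∑-cong U (λ b → trans (∑-const U (f a b)) (*-comm _ (f a b)))) (∑-*ʳ U (f a) (# U))) (∑-*ʳ U _ (# U))

  ∑³-filter : ∀ (p : A → Bool) (f : A → A → A → ℤ) →
    ∑³ (filterᵇ p U) f ≡ ∑³ U (λ a b c → χ (p a) * (χ (p b) * (χ (p c) * f a b c)))
  ∑³-filter p f = trans (∑-filter p U _) (∑-cong U λ a →
    trans (cong (χ (p a) *_) (trans (∑-filter p U _) (∑-cong U λ b →
      trans (cong (χ (p b) *_) (∑-filter p U _)) (sym (∑-*ˡ U (χ (p b)) _)))))
    (trans (sym (∑-*ˡ U (χ (p a)) _)) (∑-cong U λ b → sym (∑-*ˡ U (χ (p a)) _))))

module Arcs {V : Set} (arc : V → V → Arc) (arc-flip : ∀ u v → arc v u ≡ flip (arc u v)) where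

  s : V → V → ℤ
  s u v = val (arc u v)

  s-skew : ∀ u v → s v u ≡ - s u v
  s-skew u v = trans (cong val (arc-flip u v)) (val-flip (arc u v))

  -- 8 on cyclic triangles; unjoined or equal vertices count as half an arc each way, which makes the sums over U exact.
  cyc : V → V → V → ℤ
  cyc a b c = (1ℤ + s a b) * (1ℤ + s b c) * (1ℤ + s c a)

  deg : List V → V → ℤ
  deg U v = ∑ U (s v)

  Φ : List V → ℤ
  Φ U = ∑ U (λ v → deg U v * deg U v)

  Φ≥0 : ∀ U → 0ℤ ≤ Φ U
  Φ≥0 U = ∑-nonneg U λ v _ → sq≥0 (deg U v)

  cycAt : List V → V → ℤ
  cycAt U v = ∑² U (cyc v)

  deg-rev : ∀ U v → ∑ U (λ u → s u v) ≡ - deg U v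
  deg-rev U v = trans (∑-cong U (s-skew v)) (∑-neg U (s v))

  cycAt-formula : ∀ U v → cycAt U v ≡ # U * # U - deg U v * deg U v + (+ 2) * ∑ U (λ a → s v a * deg U a)
  cycAt-formula U v = begin
    cycAt U v
      ≡⟨ ∑²-cong U (λ a b → expand (s v a) (s a b) (s b v)) ⟩
    ∑² U (λ a b → t₁ a b + t₂ a b + t₃ a b + t₄ a b + t₅ a b + t₆ a b + t₇ a b)
      ≡⟨ trans (∑²-+ U _ t₇) (cong (λ r → r + ∑² U t₇) (trans (∑²-+ U _ t₆) (cong (λ r → r + ∑² U t₆)
        (trans (∑²-+ U _ t₅) (cong (λ r → r + ∑² U t₅) (trans (∑²-+ U _ t₄) (cong (λ r → r + ∑² U t₄)
        (trans (∑²-+ U _ t₃) (cong (λ r → r + ∑² U t₃) (∑²-+ U t₁ t₂)))))))))) ⟩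
    ∑² U t₁ + ∑² U t₂ + ∑² U t₃ + ∑² U t₄ + ∑² U t₅ + ∑² U t₆ + ∑² U t₇
      ≡⟨ cong₂ _+_ (cong₂ _+_ (cong₂ _+_ (cong₂ _+_ (cong₂ _+_ (cong₂ _+_ e₁ e₂) e₃) e₄) e₅) e₆) e₇ ⟩
    n * d + 0ℤ + n * (n + - d) + X + X + d * - d + 0ℤ
      ≡⟨ collect n d X ⟩
    n * n - d * d + (+ 2) * X ∎
    where
    open ≡-Reasoning
    n = # U
    d = deg U v
    X = ∑ U (λ a → s v a * deg U a)
    t₁ t₂ t₃ t₄ t₅ t₆ t₇ : V → V → ℤ
    t₁ a b = s v a
    t₂ a b = s a b
    t₃ a b = 1ℤ + s b v
    t₄ a b = s v a * s a b
    t₅ a b = s a b * s b v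
    t₆ a b = s v a * s b v
    t₇ a b = s v a * s a b * s b v
    expand : ∀ p q r → (1ℤ + p) * (1ℤ + q) * (1ℤ + r) ≡
      p + q + (1ℤ + r) + p * q + q * r + p * r + p * q * r
    expand = solve-∀
    collect : ∀ n d X → n * d + 0ℤ + n * (n + - d) + X + X + d * - d + 0ℤ ≡ n * n - d * d + (+ 2) * X
    collect = solve-∀
    e₁ : ∑² U t₁ ≡ n * d
    e₁ = trans (∑-cong U (λ a → ∑-const U (s v a))) (∑-*ˡ U n (s v))
    e₂ : ∑² U t₂ ≡ 0ℤ
    e₂ = ∑-skew U t₂ s-skew
    e₃ : ∑² U t₃ ≡ n * (n + - d)
    e₃ = trans (∑-const U _) (cong (n *_) (trans (∑-+ U _ _) (cong₂ _+_ (sym (#≡∑ U)) (deg-rev U v))))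
    e₄ : ∑² U t₄ ≡ X
    e₄ = ∑-cong U (λ a → ∑-*ˡ U (s v a) (s a))
    neg-swap : ∀ p q → - p * - q ≡ q * p
    neg-swap = solve-∀
    e₅ : ∑² U t₅ ≡ X
    e₅ = trans (∑-swap U U t₅) (∑-cong U λ b → trans (∑-*ʳ U (λ a → s a b) (s b v))
      (trans (cong₂ _*_ (deg-rev U b) (s-skew v b)) (neg-swap (deg U b) (s v b))))
    e₆ : ∑² U t₆ ≡ d * - d
    e₆ = trans (∑-prod U U (s v) (λ b → s b v)) (cong (d *_) (deg-rev U v))
    cube : ∀ p q r → - p * - q * - r ≡ - (r * q * p)
    cube = solve-∀
    e₇ : ∑² U t₇ ≡ 0ℤ
    e₇ = ∑-skew U t₇ λ a b →
      trans (cong₂ _*_ (cong₂ _*_ (s-skew b v) (s-skew a b)) (s-skew v a))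
        (cube (s b v) (s a b) (s v a))

  ∑cyc : ∀ U → ∑³ U cyc ≡ # U * # U * # U - (+ 3) * Φ U
  ∑cyc U = begin
    ∑ U (cycAt U)
      ≡⟨ ∑-cong U (cycAt-formula U) ⟩
    ∑ U (λ v → n * n - deg U v * deg U v + (+ 2) * ∑ U (λ a → s v a * deg U a))
      ≡⟨ trans (∑-+ U _ _) (cong₂ _+_ (trans (∑-- U _ _) (cong (_- Φ U) (∑-const U _))) (∑-*ˡ U (+ 2) _)) ⟩
    n * (n * n) - Φ U + (+ 2) * ∑² U (λ v a → s v a * deg U a)
      ≡⟨ cong (λ r → n * (n * n) - Φ U + (+ 2) * r) inner ⟩
    n * (n * n) - Φ U + (+ 2) * - Φ U
      ≡⟨ collect n (Φ U) ⟩
    n * n * n - (+ 3) * Φ U ∎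
    where
    open ≡-Reasoning
    n = # U
    collect : ∀ n p → n * (n * n) - p + (+ 2) * - p ≡ n * n * n - (+ 3) * p
    collect = solve-∀
    neg-out : ∀ p → - p * p ≡ - (p * p)
    neg-out = solve-∀
    inner : ∑² U (λ v a → s v a * deg U a) ≡ - Φ U
    inner = trans (∑-swap U U _) (trans (∑-cong U λ a → trans (∑-*ʳ U (λ v → s v a) (deg U a))
      (trans (cong (_* deg U a) (deg-rev U a)) (neg-out (deg U a)))) (∑-neg U _))

  0≤1+s : ∀ u v → 0ℤ ≤ 1ℤ + s u v
  0≤1+s u v with arc u v
  ... | out = nat≥0 2
  ... | inn = nat≥0 0
  ... | non = nat≥0 1

  cyc≥0 : ∀ a b c → 0ℤ ≤ cyc a b c
  cyc≥0 a b c = 0≤1+s a b ⊠ 0≤1+s b c ⊠ 0≤1+s c a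

  cyc-rotate : ∀ a b c → cyc b c a ≡ cyc a b c
  cyc-rotate a b c = lem (1ℤ + s a b) (1ℤ + s b c) (1ℤ + s c a)
    where
    lem : ∀ p q r → q * r * p ≡ p * q * r
    lem = solve-∀

  ∑cyc≤cube : ∀ U → ∑³ U cyc ≤ # U * # U * # U
  ∑cyc≤cube U = gap⁻¹ _ _ (nat≥0 3 ⊠ Φ≥0 U)
    (trans (cong (λ r → # U * # U * # U - r) (∑cyc U)) (lem (# U * # U * # U) (Φ U)))
    where
    lem : ∀ p q → p - (p - (+ 3) * q) ≡ (+ 3) * q
    lem = solve-∀

  mixed : V → V → V → V → Bool
  mixed x a b c = allOut (arc a b) (arc b c) (arc c a) ∧ mix (arc x a) (arc x b) (arc x c)

  zr : V → V → ℤ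
  zr u v = χ (isNon (arc u v))

  zr≥0 : ∀ u v → 0ℤ ≤ zr u v
  zr≥0 u v = χ≥0 (isNon (arc u v))

  FewNon : List V → Set
  FewNon U = ∀ v → ∑ U (zr v) ≤ (+ 2)

  all₃ : (V → Bool) → V → V → V → Bool
  all₃ hi a b c = hi a ∧ (hi b ∧ hi c)

  module _ (U : List V) (x : V) (hi : V → Bool) where

    outHigh innHigh : List V
    outHigh = filterᵇ (λ v → isOut (arc x v) ∧ hi v) U
    innHigh = filterᵇ (λ v → isInn (arc x v) ∧ hi v) U

    mixedTerm lowTerm : V → V → V → ℤ
    mixedTerm a b c = χ (mixed x a b c) * cyc a b c
    lowTerm a b c = χ (not (mixed x a b c) ∧ not (all₃ hi a b c)) * cyc a b c

    mixedWeight lowWeight : ℤ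
    mixedWeight = ∑³ U mixedTerm
    lowWeight = ∑³ U lowTerm

    private
      on : (Arc → Bool) → V → Bool
      on p v = p (arc x v) ∧ hi v
      mono : (Arc → Bool) → V → V → V → ℤ
      mono p a b c = χ (on p a) * (χ (on p b) * (χ (on p c) * cyc a b c))
      zeros : V → V → V → ℤ
      zeros a b c = (zr a b + zr b c + zr c a) + (zr x a + zr x b + zr x c)

    classify-pointwise : ∀ a b c → cyc a b c ≤
      mixedTerm a b c + lowTerm a b c + mono isOut a b c + mono isInn a b c + (+ 8) * zeros a b c
    classify-pointwise a b c = classify-arcs (arc a b) (arc b c) (arc c a) (arc x a) (arc x b) (arc x c) (hi a) (hi b) (hi c)

    private
      n = # U

      ∑mono : ∀ p → ∑³ U (mono p) ≤ # (filterᵇ (on p) U) * # (filterᵇ (on p) U) * # (filterᵇ (on p) U)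
      ∑mono p = ≤-trans (≤-reflexive (sym (∑³-filter U (on p) cyc))) (∑cyc≤cube (filterᵇ (on p) U))

      z₂ : V → V → V → ℤ
      z₂ a b _ = zr a b
      z₁ : V → V → V → ℤ
      z₁ a _ _ = zr x a

      ∑z₂ : FewNon U → ∑³ U z₂ ≤ (+ 2) * n * n
      ∑z₂ few = ≤-trans (≤-reflexive (∑³-fst₂ U zr)) (gap⁻¹ _ _
        (gap (≤-trans (∑-mono U (λ a _ → few a)) (≤-reflexive (∑-const U (+ 2)))) ⊠ nat≥0 (length U)) (lem n (∑² U zr)))
        where
        lem : ∀ n z → (+ 2) * n * n - z * n ≡ (n * (+ 2) - z) * n
        lem = solve-∀

      ∑z₁ : FewNon U → ∑³ U z₁ ≤ (+ 2) * n * n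
      ∑z₁ few = ≤-trans (≤-reflexive (∑³-fst U (zr x))) (gap⁻¹ _ _
        (gap (few x) ⊠ (nat≥0 (length U) ⊠ nat≥0 (length U))) (lem n (∑ U (zr x))))
        where
        lem : ∀ n z → (+ 2) * n * n - z * (n * n) ≡ ((+ 2) - z) * (n * n)
        lem = solve-∀

      ∑zeros : FewNon U → ∑³ U zeros ≤ (+ 12) * (n * n)
      ∑zeros few = begin
        ∑³ U zeros
          ≡⟨ trans (∑³-+ U _ _) (cong₂ _+_ (∑³-+-step U (λ a b c → zr a b + zr b c) (λ a b c → zr c a) (∑³-+ U _ _))
               (∑³-+-step U (λ a b c → zr x a + zr x b) (λ a b c → zr x c) (∑³-+ U _ _))) ⟩
        (∑³ U (λ a b c → zr a b) + ∑³ U (λ a b c → zr b c) + ∑³ U (λ a b c → zr c a))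
        + (∑³ U (λ a b c → zr x a) + ∑³ U (λ a b c → zr x b) + ∑³ U (λ a b c → zr x c))
          ≡⟨ cong₂ _+_ (cong₂ _+_ (addˡ (∑³ U z₂) (∑³-rotate U z₂)) (sym (∑³-rotate U (λ a b c → zr c a))))
                       (cong₂ _+_ (addˡ (∑³ U z₁) (∑³-rotate U z₁)) (sym (∑³-rotate U (λ a b c → zr x c)))) ⟩
        (∑³ U z₂ + ∑³ U z₂ + ∑³ U z₂) + (∑³ U z₁ + ∑³ U z₁ + ∑³ U z₁)
          ≤⟨ +-mono-≤ (+-mono-≤ (+-mono-≤ z₂≤ z₂≤) z₂≤) (+-mono-≤ (+-mono-≤ z₁≤ z₁≤) z₁≤) ⟩
        ((+ 2) * n * n + (+ 2) * n * n + (+ 2) * n * n) + ((+ 2) * n * n + (+ 2) * n * n + (+ 2) * n * n)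
          ≡⟨ lem n ⟩
        (+ 12) * (n * n) ∎
        where
        open ≤-Reasoning
        z₂≤ = ∑z₂ few
        z₁≤ = ∑z₁ few
        lem : ∀ n → ((+ 2) * n * n + (+ 2) * n * n + (+ 2) * n * n) + ((+ 2) * n * n + (+ 2) * n * n + (+ 2) * n * n) ≡ (+ 12) * (n * n)
        lem = solve-∀

    classify : FewNon U → n * n * n - (+ 3) * Φ U ≤ mixedWeight + lowWeight + # outHigh * # outHigh * # outHigh + # innHigh * # innHigh * # innHigh + (+ 96) * (n * n)
    classify few = begin
      n * n * n - (+ 3) * Φ U
        ≡⟨ sym (∑cyc U) ⟩
      ∑³ U cyc
        ≤⟨ ∑³-mono U (λ a b c _ _ _ → classify-pointwise a b c) ⟩
      ∑³ U (λ a b c → mixedTerm a b c + lowTerm a b c + mono isOut a b c + mono isInn a b c + (+ 8) * zeros a b c)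
        ≡⟨ trans (∑³-+ U _ (λ a b c → (+ 8) * zeros a b c)) (cong₂ _+_ (∑³-+-step U (λ a b c → mixedTerm a b c + lowTerm a b c + mono isOut a b c) (mono isInn)
             (∑³-+-step U (λ a b c → mixedTerm a b c + lowTerm a b c) (mono isOut) (∑³-+ U mixedTerm lowTerm))) (∑³-*ˡ U (+ 8) zeros)) ⟩
      mixedWeight + lowWeight + ∑³ U (mono isOut) + ∑³ U (mono isInn) + (+ 8) * ∑³ U zeros
        ≤⟨ +-mono-≤ (+-mono-≤ (+-monoʳ-≤ (mixedWeight + lowWeight) (∑mono isOut)) (∑mono isInn)) (*-monoˡ-≤-nonNeg (+ 8) (∑zeros few)) ⟩
      mixedWeight + lowWeight + # outHigh * # outHigh * # outHigh + # innHigh * # innHigh * # innHigh + (+ 8) * ((+ 12) * (n * n))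
        ≡⟨ addˡ (mixedWeight + lowWeight + # outHigh * # outHigh * # outHigh + # innHigh * # innHigh * # innHigh) (sym (*-assoc (+ 8) (+ 12) (n * n))) ⟩
      mixedWeight + lowWeight + # outHigh * # outHigh * # outHigh + # innHigh * # innHigh * # innHigh + (+ 96) * (n * n) ∎
      where open ≤-Reasoning

-- Tiles of nonnegative weight

ab : ℤ → ℤ
ab i = + ∣ i ∣

ab≥0 : ∀ i → 0ℤ ≤ ab i
ab≥0 i = nat≥0 ∣ i ∣

i≤ab : ∀ i → i ≤ ab i
i≤ab (+ n) = ≤-refl
i≤ab -[1+ n ] = -≤+

-i≤ab : ∀ i → - i ≤ ab i
-i≤ab i = subst (- i ≤_) (cong +_ (∣-i∣≡∣i∣ i)) (i≤ab (- i))

ab-sq : ∀ i → ab i * ab i ≡ i * i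
ab-sq (+ n) = refl
ab-sq -[1+ n ] = refl

val*≤ab : ∀ e i → val e * i ≤ ab i
val*≤ab out i = ≤-trans (≤-reflexive (*-identityˡ i)) (i≤ab i)
val*≤ab inn i = ≤-trans (≤-reflexive (-1*i≡-i i)) (-i≤ab i)
val*≤ab non i = ≤-trans (≤-reflexive (*-zeroˡ i)) (ab≥0 i)

argmax : ∀ {A : Set} (U : List A) (W : A → ℤ) → 0ℤ < # U → ∃ λ x → x ∈ U × (∀ v → v ∈ U → W v ≤ W x)
argmax [] W (+<+ ())
argmax (y ∷ []) W _ = y , here refl , λ { v (here refl) → ≤-refl }
argmax (y ∷ U@(_ ∷ _)) W _ with argmax U W (+<+ (ℕ.s≤s ℕ.z≤n))
... | x , x∈ , max with W y ≤? W x
... | yes p = x , there x∈ , λ { v (here refl) → p ; v (there v∈) → max v v∈ }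
... | no ¬p = y , here refl , λ { v (here refl) → ≤-refl ; v (there v∈) → ≤-trans (max v v∈) (<⇒≤ (≰⇒> ¬p)) }

cancel≥0 : ∀ k {i} → 0ℤ < k → 0ℤ ≤ k * i → 0ℤ ≤ i
cancel≥0 k {+ n} _ _ = nat≥0 n
cancel≥0 +[1+ k ] { -[1+ n ]} _ ()
cancel≥0 (+ 0) (+<+ ()) _

pos* : ∀ {i j} → 0ℤ < i → 0ℤ < j → 0ℤ < i * j
pos* {+[1+ _ ]} {+[1+ _ ]} _ _ = +<+ (ℕ.s≤s ℕ.z≤n)
pos* {+ 0} (+<+ ())
pos* {+[1+ _ ]} {+ 0} _ (+<+ ())

find³ : ∀ {A : Set} (U : List A) {P : A → A → A → Set} → (∀ a b c → Dec (P a b c)) →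
  ¬ (∀ a b c → a ∈ U → b ∈ U → c ∈ U → ¬ P a b c) →
  ∃ λ a → ∃ λ b → ∃ λ c → a ∈ U × b ∈ U × c ∈ U × P a b c
find³ U P? h with any? (λ a → any? (λ b → any? (P? a b) U) U) U
... | no ¬p = ⊥-elim (h λ a b c a∈ b∈ c∈ p → ¬p (lose a∈ (lose b∈ (lose c∈ p))))
... | yes p with find p
... | a , a∈ , pa with find pa
... | b , b∈ , pb with find pb
... | c , c∈ , pc = a , b , c , a∈ , b∈ , c∈ , pc

module Balanced {V : Set} (arc : V → V → Arc) (arc-flip : ∀ u v → arc v u ≡ flip (arc u v))
  (K : ℤ) (K-large : + 1219 ≤ (+ 3) * K) where

  open Arcs arc arc-flip public

  0<K : 0ℤ < K
  0<K = *-cancelˡ-<-nonNeg (+ 3) (<-≤-trans (+<+ (ℕ.s≤s ℕ.z≤n)) K-large)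

  0≤K : 0ℤ ≤ K
  0≤K = <⇒≤ 0<K

  Near : List V → V → Set
  Near U v = K * ab (deg U v) ≤ # U

  module _ (U : List V) where
    private
      n = # U
      n≥0 = nat≥0 (length U)

    maxCyc : ℤ
    maxCyc = n * n + (+ 2) * ∑ U (ab ∘ deg U)

    maxCyc≥0 : 0ℤ ≤ maxCyc
    maxCyc≥0 = n≥0 ⊠ n≥0 ⊹ nat≥0 2 ⊠ ∑-nonneg U (λ v _ → ab≥0 (deg U v))

    cycAt≤max : ∀ v → cycAt U v ≤ maxCyc
    cycAt≤max v = gap⁻¹ _ _
      (sq≥0 (deg U v) ⊹ nat≥0 2 ⊠ gap (∑-mono U {f = λ a → s v a * deg U a} (λ a _ → val*≤ab (arc v a) (deg U a))))
      (trans (cong (λ r → maxCyc - r) (cycAt-formula U v)) (lem (n * n) (deg U v) _ _))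
      where
      lem : ∀ z d X Y → z + (+ 2) * Y - (z - d * d + (+ 2) * X) ≡ d * d + (+ 2) * (Y - X)
      lem = solve-∀

    module _ (near : ∀ v → v ∈ U → Near U v) where

      K∑ab≤ : K * ∑ U (ab ∘ deg U) ≤ n * n
      K∑ab≤ = ≤-trans (≤-reflexive (sym (∑-*ˡ U K _))) (≤-trans (∑-mono U near) (≤-reflexive (∑-const U n)))

      Kmax≤ : K * maxCyc ≤ (K + (+ 2)) * (n * n)
      Kmax≤ = gap⁻¹ _ _ (nat≥0 2 ⊠ gap K∑ab≤) (lem K (n * n) _)
        where
        lem : ∀ K z Y → (K + (+ 2)) * z - K * (z + (+ 2) * Y) ≡ (+ 2) * (z - K * Y)
        lem = solve-∀

      KΦ≤ : K * Φ U ≤ n * n * n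
      KΦ≤ = begin
        K * Φ U ≡⟨ sym (∑-*ˡ U K _) ⟩
        ∑ U (λ v → K * (deg U v * deg U v)) ≤⟨ ∑-mono U (λ v v∈ → pt (deg U v) (near v v∈)) ⟩
        ∑ U (λ _ → n * n) ≡⟨ ∑-const U (n * n) ⟩
        n * (n * n) ≡⟨ sym (*-assoc n n n) ⟩
        n * n * n ∎
        where
        open ≤-Reasoning
        1≤K : 1ℤ ≤ K
        1≤K = i<j⇒suc[i]≤j 0<K
        lem₁ : ∀ K e n → n * n - K * (e * e) ≡ (n - K * e) * (n + e) + (K - 1ℤ) * e * n + 0ℤ
        lem₁ = solve-∀
        pt : ∀ d → K * ab d ≤ n → K * (d * d) ≤ n * n
        pt d h = subst (λ r → K * r ≤ n * n) (ab-sq d) (gap⁻¹ _ _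
          (gap h ⊠ (n≥0 ⊹ ab≥0 d) ⊹ gap 1≤K ⊠ ab≥0 d ⊠ n≥0 ⊹ nat≥0 0) (lem₁ K (ab d) n))

    module _ (x : V) (near-x : Near U x) (few : FewNon U) (hi : V → Bool) where

      private
        α = # (outHigh U x hi)
        β = # (innHigh U x hi)
        ℓ = ∑ U (λ v → χ (not (hi v)))

      2Kα≤ : (+ 2) * K * α ≤ (K + 1ℤ) * n
      2Kα≤ = gap⁻¹ _ _ (0≤K ⊠ gap 2α≤ ⊹ gap near-x ⊹ 0≤K ⊠ gap (i≤ab (deg U x))) (lem K α n (deg U x) (ab (deg U x)))
        where
        pt : ∀ e h → (+ 2) * χ (isOut e ∧ h) ≤ 1ℤ + val e
        pt out true = ≤-refl
        pt out false = nat≥0 2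
        pt inn h = ≤-refl
        pt non h = nat≥0 1
        2α≤ : (+ 2) * α ≤ n + deg U x
        2α≤ = begin
          (+ 2) * α ≡⟨ trans (cong ((+ 2) *_) (#-filter _ U)) (sym (∑-*ˡ U (+ 2) _)) ⟩
          ∑ U (λ v → (+ 2) * χ (isOut (arc x v) ∧ hi v)) ≤⟨ ∑-mono U (λ v _ → pt (arc x v) (hi v)) ⟩
          ∑ U (λ v → 1ℤ + s x v) ≡⟨ trans (∑-+ U _ _) (cong (_+ deg U x) (sym (#≡∑ U))) ⟩
          n + deg U x ∎
          where open ≤-Reasoning
        lem : ∀ K α n d e → (K + 1ℤ) * n - (+ 2) * K * α ≡ K * (n + d - (+ 2) * α) + (n - K * e) + K * (e - d)
        lem = solve-∀

      2Kβ≤ : (+ 2) * K * β ≤ (K + 1ℤ) * n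
      2Kβ≤ = gap⁻¹ _ _ (0≤K ⊠ gap 2β≤ ⊹ gap near-x ⊹ 0≤K ⊠ gap (-i≤ab (deg U x))) (lem K β n (deg U x) (ab (deg U x)))
        where
        pt : ∀ e h → (+ 2) * χ (isInn e ∧ h) ≤ 1ℤ + - val e
        pt out h = ≤-refl
        pt inn true = ≤-refl
        pt inn false = nat≥0 2
        pt non h = nat≥0 1
        2β≤ : (+ 2) * β ≤ n + - deg U x
        2β≤ = begin
          (+ 2) * β ≡⟨ trans (cong ((+ 2) *_) (#-filter _ U)) (sym (∑-*ˡ U (+ 2) _)) ⟩
          ∑ U (λ v → (+ 2) * χ (isInn (arc x v) ∧ hi v)) ≤⟨ ∑-mono U (λ v _ → pt (arc x v) (hi v)) ⟩
          ∑ U (λ v → 1ℤ + - s x v) ≡⟨ trans (∑-+ U _ _) (cong₂ _+_ (sym (#≡∑ U)) (∑-neg U (s x))) ⟩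
          n + - deg U x ∎
          where open ≤-Reasoning
        lem : ∀ K α n d e → (K + 1ℤ) * n - (+ 2) * K * α ≡ K * (n + - d - (+ 2) * α) + (n - K * e) + K * (e - - d)
        lem = solve-∀

      α+β+ℓ≤ : α + β + ℓ ≤ n
      α+β+ℓ≤ = begin
        α + β + ℓ ≡⟨ cong (_+ ℓ) (trans (cong₂ _+_ (#-filter _ U) (#-filter _ U)) (sym (∑-+ U _ _))) ⟩
        ∑ U (λ v → χ (isOut (arc x v) ∧ hi v) + χ (isInn (arc x v) ∧ hi v)) + ℓ ≡⟨ sym (∑-+ U _ _) ⟩
        ∑ U (λ v → χ (isOut (arc x v) ∧ hi v) + χ (isInn (arc x v) ∧ hi v) + χ (not (hi v)))
          ≤⟨ ∑-mono U (λ v _ → pt (arc x v) (hi v)) ⟩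
        ∑ U (λ _ → 1ℤ) ≡⟨ sym (#≡∑ U) ⟩
        n ∎
        where
        open ≤-Reasoning
        pt : ∀ e h → χ (isOut e ∧ h) + χ (isInn e ∧ h) + χ (not h) ≤ 1ℤ
        pt out true = ≤-refl
        pt out false = ≤-refl
        pt inn true = ≤-refl
        pt inn false = ≤-refl
        pt non true = nat≥0 1
        pt non false = ≤-refl

      cubes≤ : (+ 4) * K * (α * α * α + β * β * β) ≤ (K + (+ 3)) * (n * n * n - ℓ * (n * n))
      cubes≤ = gap⁻¹ _ _
        (gap (square 2Kα≤ (nat≥0 _)) ⊠ nat≥0 _ ⊹ gap (square 2Kβ≤ (nat≥0 _)) ⊠ nat≥0 _
          ⊹ (0≤K ⊹ nat≥0 3) ⊠ (n≥0 ⊠ n≥0) ⊠ gap α+β+ℓ≤)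
        (lem K α β n ℓ)
        where
        1≤K : 1ℤ ≤ K
        1≤K = i<j⇒suc[i]≤j 0<K
        lem : ∀ K α β n ℓ → (K + (+ 3)) * (n * n * n - ℓ * (n * n)) - (+ 4) * K * (α * α * α + β * β * β) ≡
          ((K + (+ 3)) * (n * n) - (+ 4) * K * (α * α)) * α + ((K + (+ 3)) * (n * n) - (+ 4) * K * (β * β)) * β
          + (K + (+ 3)) * (n * n) * (n - (α + β + ℓ))
        lem = solve-∀
        lem₂ : ∀ K γ n → K * ((K + (+ 3)) * (n * n) - (+ 4) * K * (γ * γ)) ≡
          ((K + 1ℤ) * n - (+ 2) * K * γ) * ((K + 1ℤ) * n + (+ 2) * K * γ) + (K - 1ℤ) * (n * n)
        lem₂ = solve-∀
        square : ∀ {γ} → (+ 2) * K * γ ≤ (K + 1ℤ) * n → 0ℤ ≤ γ → (+ 4) * K * (γ * γ) ≤ (K + (+ 3)) * (n * n)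
        square {γ} h p = 0≤i-j⇒j≤i (cancel≥0 K 0<K (subst (0ℤ ≤_) (sym (lem₂ K γ n))
          (gap h ⊠ ((0≤K ⊹ nat≥0 1) ⊠ n≥0 ⊹ nat≥0 2 ⊠ 0≤K ⊠ p) ⊹ gap 1≤K ⊠ (n≥0 ⊠ n≥0))))

    ∑cyc*D : ∀ (D : V → ℤ) → ∑³ U (λ a b c → cyc a b c * (D a + D b + D c)) ≡ (+ 3) * ∑ U (λ v → cycAt U v * D v)
    ∑cyc*D D = begin
      ∑³ U (λ a b c → cyc a b c * (D a + D b + D c))
        ≡⟨ ∑³-cong U (λ a b c → trans (lem₁ (cyc a b c) (D a) (D b) (D c))
             (cong₂ (λ p q → g a b c + p * D b + q * D c) (sym (cyc-rotate a b c))
               (sym (trans (cyc-rotate b c a) (cyc-rotate a b c))))) ⟩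
      ∑³ U (λ a b c → g a b c + g b c a + g c a b)
        ≡⟨ trans (∑³-+-step U (λ a b c → g a b c + g b c a) (λ a b c → g c a b) (∑³-+ U g (λ a b c → g b c a)))
             (cong₂ (λ p q → ∑³ U g + p + q) (∑³-rotate U g) (sym (∑³-rotate U (λ a b c → g c a b)))) ⟩
      ∑³ U g + ∑³ U g + ∑³ U g
        ≡⟨ cong (λ r → r + r + r) (∑-cong U λ a → ∑²-*ʳ (cyc a) (D a)) ⟩
      S + S + S
        ≡⟨ lem₂ S ⟩
      (+ 3) * S ∎
      where
      open ≡-Reasoning
      g : V → V → V → ℤ
      g a b c = cyc a b c * D a
      S = ∑ U (λ v → cycAt U v * D v)
      lem₁ : ∀ C p q r → C * (p + q + r) ≡ C * p + C * q + C * r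
      lem₁ = solve-∀
      lem₂ : ∀ p → p + p + p ≡ (+ 3) * p
      lem₂ = solve-∀
      ∑²-*ʳ : ∀ (f : V → V → ℤ) k → ∑² U (λ a b → f a b * k) ≡ ∑² U f * k
      ∑²-*ʳ f k = trans (∑-cong U (λ a → ∑-*ʳ U (f a) k)) (∑-*ʳ U _ k)

    ∑cyc*D≤ : ∀ (D : V → ℤ) → (∀ v → v ∈ U → 0ℤ ≤ D v) →
      ∑³ U (λ a b c → cyc a b c * (D a + D b + D c)) ≤ (+ 3) * (maxCyc * ∑ U D)
    ∑cyc*D≤ D D≥0 = ≤-trans (≤-reflexive (∑cyc*D D)) (*-monoˡ-≤-nonNeg (+ 3)
      (≤-trans (∑-mono U λ v v∈ → gap⁻¹ _ _ (gap (cycAt≤max v) ⊠ D≥0 v v∈) (lem maxCyc (cycAt U v) (D v)))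
        (≤-reflexive (∑-*ˡ U maxCyc D))))
      where
      lem : ∀ t u d → t * d - u * d ≡ (t - u) * d
      lem = solve-∀

    Large : Set
    Large = K * (+ 96) ≤ n

    module _ (near : ∀ v → v ∈ U → Near U v) (few : FewNon U) (large : Large) (0<n : 0ℤ < n) where

      module _ (x : V) (near-x : Near U x) where

        private
          always : V → Bool
          always _ = true
          c = n * n * n
          M₁ = mixedWeight U x always

        K*96z≤ : K * ((+ 96) * (n * n)) ≤ c
        K*96z≤ = gap⁻¹ _ _ (gap large ⊠ (n≥0 ⊠ n≥0)) (lem K n)
          where
          lem : ∀ K n → n * n * n - K * ((+ 96) * (n * n)) ≡ (n - K * (+ 96)) * (n * n)
          lem = solve-∀

        M₁-bound : (+ 3) * K * c ≤ (+ 4) * K * M₁ + (+ 19) * c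
        M₁-bound = gap⁻¹ _ _
          (nat≥0 4 ⊠ 0≤K ⊠ gap full ⊹ gap (cubes≤ x near-x few always) ⊹ nat≥0 12 ⊠ gap (KΦ≤ near) ⊹ nat≥0 4 ⊠ gap K*96z≤
            ⊹ (0≤K ⊹ nat≥0 3) ⊠ (∑-nonneg U (λ v _ → χ≥0 (not (always v))) ⊠ (n≥0 ⊠ n≥0)))
          (lem K c M₁ (Φ U) (cube (outHigh U x always)) (cube (innHigh U x always)) ((+ 96) * (n * n)) (∑ U (λ v → χ (not (always v)))) (n * n))
          where
          cube : List V → ℤ
          cube xs = # xs * # xs * # xs
          L-zero : lowWeight U x always ≡ 0ℤ
          L-zero = trans (∑³-cong U (λ a b c → pt (mixed x a b c) (cyc a b c)))
            (trans (∑-cong U λ _ → trans (∑-cong U λ _ → ∑-zero U) (∑-zero U)) (∑-zero U))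
            where
            pt : ∀ m C → χ (not m ∧ false) * C ≡ 0ℤ
            pt true C = *-zeroˡ C
            pt false C = *-zeroˡ C
          full : c - (+ 3) * Φ U ≤ M₁ + 0ℤ + cube (outHigh U x always) + cube (innHigh U x always) + (+ 96) * (n * n)
          full = subst (λ r → c - (+ 3) * Φ U ≤ M₁ + r + cube (outHigh U x always) + cube (innHigh U x always) + (+ 96) * (n * n)) L-zero (classify U x always few)
          lem : ∀ K c M P a b e l z → (+ 4) * K * M + (+ 19) * c - (+ 3) * K * c ≡
            (+ 4) * K * (M + 0ℤ + a + b + e - (c - (+ 3) * P)) + ((K + (+ 3)) * (c - l * z) - (+ 4) * K * (a + b)) + (+ 12) * (c - K * P) + (+ 4) * (c - K * e) + (K + (+ 3)) * (l * z)
          lem = solve-∀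

        private
          0<c : 0ℤ < c
          0<c = pos* (pos* 0<n 0<n) 0<n

        0<M₁ : 0ℤ < M₁
        0<M₁ with 0ℤ <? M₁
        ... | yes p = p
        ... | no ¬p = ⊥-elim (<⇒≱ 0<c (0≤i-j⇒j≤i (cancel≥0 (+ 1200) (+<+ (ℕ.s≤s ℕ.z≤n)) (subst (0ℤ ≤_) (lem K c M₁)
            (gap M₁-bound ⊹ nat≥0 4 ⊠ 0≤K ⊠ gap (≮⇒≥ ¬p) ⊹ gap K-large ⊠ <⇒≤ 0<c)))))
          where
          lem : ∀ K c M → (+ 4) * K * M + (+ 19) * c - (+ 3) * K * c + (+ 4) * K * (0ℤ - M) + ((+ 3) * K - (+ 1219)) * c ≡ (+ 1200) * (0ℤ - c)
          lem = solve-∀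

      heavy-tile : ∀ (W : V → ℤ) → 0ℤ ≤ ∑ U W → ∃ λ x → x ∈ U × ∃ λ a → ∃ λ b → ∃ λ c →
        a ∈ U × b ∈ U × c ∈ U × mixed x a b c ≡ true × 0ℤ ≤ W x + W a + W b + W c
      heavy-tile W ∑W≥0 with argmax U W 0<n
      ... | x , x∈ , max = x , x∈ , find³ U (λ a b c → (mixed x a b c Bool.≟ true) ×-dec (0ℤ ≤? W x + W a + W b + W c))
        λ none → contra λ a b c a∈ b∈ c∈ m → ≰⇒> λ p → none a b c a∈ b∈ c∈ (m , p)
        where
        w = W x
        c = n * n * n
        hi : V → Bool
        hi v = 0ℤ ≤ᵇ W v
        lo : V → ℤ
        lo v = χ (not (hi v))
        D : V → ℤ
        D v = w - W v
        D≥0 : ∀ v → v ∈ U → 0ℤ ≤ D v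
        D≥0 v v∈ = gap (max v v∈)
        m = mixedWeight U x hi
        l = lowWeight U x hi
        ℓ = ∑ U lo
        q = ℓ * (n * n)
        near-x = near x x∈
        w≥0 : 0ℤ ≤ w
        w≥0 = cancel≥0 n 0<n (≤-trans ∑W≥0 (≤-trans (∑-mono U max) (≤-reflexive (∑-const U w))))
        S = (+ 3) * (maxCyc * n)

        module _ (neg : ∀ a b c → a ∈ U → b ∈ U → c ∈ U → mixed x a b c ≡ true → W x + W a + W b + W c < 0ℤ) where

          weight : ((+ 4) * w + 1ℤ) * m + w * l ≤ S * w
          weight = begin
            ((+ 4) * w + 1ℤ) * m + w * l
              ≡⟨ sym (trans (∑³-+ U _ _) (cong₂ _+_ (∑³-*ˡ U ((+ 4) * w + 1ℤ) (mixedTerm U x hi)) (∑³-*ˡ U w (lowTerm U x hi)))) ⟩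
            ∑³ U (λ a b c → ((+ 4) * w + 1ℤ) * mixedTerm U x hi a b c + w * lowTerm U x hi a b c)
              ≤⟨ ∑³-mono U (λ a b c a∈ b∈ c∈ → pt a b c (D≥0 a a∈) (D≥0 b b∈) (D≥0 c c∈) (neg a b c a∈ b∈ c∈)) ⟩
            ∑³ U (λ a b c → cyc a b c * (D a + D b + D c))
              ≤⟨ ∑cyc*D≤ D D≥0 ⟩
            (+ 3) * (maxCyc * ∑ U D)
              ≤⟨ gap⁻¹ _ _ (nat≥0 3 ⊠ (maxCyc≥0 ⊠ ∑W≥0)) (trans (cong (λ r → S * w - (+ 3) * (maxCyc * r)) ∑D) (lem maxCyc n w (∑ U W))) ⟩
            S * w ∎
            where
            open ≤-Reasoning
            ∑D : ∑ U D ≡ n * w - ∑ U W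
            ∑D = trans (∑-- U (λ _ → w) W) (cong (_- ∑ U W) (∑-const U w))
            lem : ∀ t n w y → (+ 3) * (t * n) * w - (+ 3) * (t * (n * w - y)) ≡ (+ 3) * (t * y)
            lem = solve-∀
            hi-false : ∀ {v} → hi v ≡ false → W v ≤ 0ℤ
            hi-false {v} h with 0ℤ ≤? W v
            ... | no ¬p = <⇒≤ (≰⇒> ¬p)
            ... | yes p = ⊥-elim (subst Bool.T h (≤⇒≤ᵇ p))
            lem-mixed : ∀ w p q r C → C * ((w - p) + (w - q) + (w - r)) - (((+ 4) * w + 1ℤ) * (1ℤ * C) + w * (0ℤ * C)) ≡
              C * (0ℤ - (1ℤ + (w + p + q + r)))
            lem-mixed = solve-∀
            lem-lo : ∀ w p q r C → C * (p + q + r) - (((+ 4) * w + 1ℤ) * (0ℤ * C) + w * (1ℤ * C)) ≡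
              C * (p + q + r - w)
            lem-lo = solve-∀
            lem-hi : ∀ w p C → C * p - (((+ 4) * w + 1ℤ) * (0ℤ * C) + w * (0ℤ * C)) ≡ C * p
            lem-hi = solve-∀
            low : ∀ a b c → all₃ hi a b c ≡ false → 0ℤ ≤ D a → 0ℤ ≤ D b → 0ℤ ≤ D c → w ≤ D a + D b + D c
            low a b c h pa pb pc with hi a in ea | hi b in eb | hi c in ec
            ... | false | _ | _ = gap⁻¹ _ _ (gap (hi-false ea) ⊹ pb ⊹ pc) (r₁ w (W a) (D b) (D c))
              where
              r₁ : ∀ w p q r → w - p + q + r - w ≡ 0ℤ - p + q + r
              r₁ = solve-∀
            ... | true | false | _ = gap⁻¹ _ _ (gap (hi-false eb) ⊹ pa ⊹ pc) (r₁ w (W b) (D a) (D c))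
              where
              r₁ : ∀ w p q r → q + (w - p) + r - w ≡ 0ℤ - p + q + r
              r₁ = solve-∀
            ... | true | true | false = gap⁻¹ _ _ (gap (hi-false ec) ⊹ pa ⊹ pb) (r₁ w (W c) (D a) (D b))
              where
              r₁ : ∀ w p q r → q + r + (w - p) - w ≡ 0ℤ - p + q + r
              r₁ = solve-∀
            pt : ∀ a b c → 0ℤ ≤ D a → 0ℤ ≤ D b → 0ℤ ≤ D c → (mixed x a b c ≡ true → w + W a + W b + W c < 0ℤ) →
              ((+ 4) * w + 1ℤ) * mixedTerm U x hi a b c + w * lowTerm U x hi a b c ≤ cyc a b c * (D a + D b + D c)
            pt a b c pa pb pc h with mixed x a b c | all₃ hi a b c in eh
            ... | true | _ = gap⁻¹ _ _ (cyc≥0 a b c ⊠ gap (i<j⇒suc[i]≤j (h refl))) (lem-mixed w (W a) (W b) (W c) (cyc a b c))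
            ... | false | false = gap⁻¹ _ _ (cyc≥0 a b c ⊠ gap (low a b c eh pa pb pc)) (lem-lo w (D a) (D b) (D c) (cyc a b c))
            ... | false | true = gap⁻¹ _ _ (cyc≥0 a b c ⊠ (pa ⊹ pb ⊹ pc)) (lem-hi w (D a + D b + D c) (cyc a b c))

          m≤q : K * m ≤ (+ 3) * (K + (+ 2)) * q
          m≤q = gap⁻¹ _ _ (0≤K ⊠ gap m≤ ⊹ nat≥0 3 ⊠ gap (Kmax≤ near) ⊠ ∑-nonneg U (λ v _ → χ≥0 (not (hi v))))
            (lem K m ℓ (n * n) maxCyc)
            where
            lem : ∀ K m l z t → (+ 3) * (K + (+ 2)) * (l * z) - K * m ≡
              K * ((+ 3) * (t * l) - m) + (+ 3) * ((K + (+ 2)) * z - K * t) * l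
            lem = solve-∀
            hi-true : ∀ {v} → hi v ≡ true → 0ℤ ≤ W v
            hi-true {v} h = ≤ᵇ⇒≤ (subst Bool.T (sym h) _)
            pt : ∀ a b c → (mixed x a b c ≡ true → w + W a + W b + W c < 0ℤ) →
              mixedTerm U x hi a b c ≤ cyc a b c * (lo a + lo b + lo c)
            pt a b c h with mixed x a b c
            ... | false = subst (_≤ cyc a b c * (lo a + lo b + lo c)) (sym (*-zeroˡ (cyc a b c)))
              (cyc≥0 a b c ⊠ (χ≥0 (not (hi a)) ⊹ χ≥0 (not (hi b)) ⊹ χ≥0 (not (hi c))))
            ... | true = gap⁻¹ _ _ (cyc≥0 a b c ⊠ gap some) (r₁ (cyc a b c) (lo a + lo b + lo c))
              where
              r₁ : ∀ C p → C * p - 1ℤ * C ≡ C * (p - 1ℤ)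
              r₁ = solve-∀
              some : 1ℤ ≤ lo a + lo b + lo c
              some with hi a in ea | hi b in eb | hi c in ec
              ... | true | true | true = ⊥-elim (<⇒≱ (h refl) (w≥0 ⊹ hi-true ea ⊹ hi-true eb ⊹ hi-true ec))
              ... | false | p | r = +-mono-≤ (+-monoʳ-≤ (+ 1) (χ≥0 (not p))) (χ≥0 (not r))
              ... | true | false | r = +-monoʳ-≤ (+ 1) (χ≥0 (not r))
              ... | true | true | false = ≤-refl
            m≤ : m ≤ (+ 3) * (maxCyc * ℓ)
            m≤ = ≤-trans (∑³-mono U (λ a b c a∈ b∈ c∈ → pt a b c (neg a b c a∈ b∈ c∈)))
              (∑cyc*D≤ lo (λ v _ → χ≥0 (not (hi v))))

          -- In units of n³ and up to error terms, m ≥ 3/4, m + l ≥ 3/4 + q/4 and m ≤ 3q, so that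
          -- 4m + l ≥ (3 + 1/12) m + 3/4 ≥ 3 + 1/16, whereas S = 3.  The slack 1/16 absorbs the errors when 3K ≥ 1219.
          S≤ : S ≤ (+ 4) * m + l
          S≤ = 0≤i-j⇒j≤i (cancel≥0 ((+ 48) * K) 0<48K (subst (0ℤ ≤_)
            (sym (lem K c m l (cube (outHigh U x hi)) (cube (innHigh U x hi)) S (Φ U) ((+ 96) * (n * n)) q))
            (nat≥0 48 ⊠ 0≤K ⊠ gap (classify U x hi few) ⊹ nat≥0 12 ⊠ gap (cubes≤ x near-x few hi) ⊹ nat≥0 4 ⊠ gap m≤q
              ⊹ nat≥0 37 ⊠ gap (M₁-bound x near-x) ⊹ nat≥0 48 ⊠ gap KS≤ ⊹ nat≥0 144 ⊠ gap (KΦ≤ near)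
              ⊹ nat≥0 48 ⊠ gap (K*96z≤ x near-x) ⊹ nat≥0 12 ⊠ q≥0 ⊹ gap K-large ⊠ (n≥0 ⊠ n≥0 ⊠ n≥0))))
            where
            cube : List V → ℤ
            cube xs = # xs * # xs * # xs
            q≥0 : 0ℤ ≤ q
            q≥0 = ∑-nonneg U (λ v _ → χ≥0 (not (hi v))) ⊠ (n≥0 ⊠ n≥0)
            0<48K : 0ℤ < (+ 48) * K
            0<48K = *-monoˡ-<-pos (+ 48) 0<K
            KS≤ : K * S ≤ (+ 3) * (K + (+ 2)) * c
            KS≤ = gap⁻¹ _ _ (nat≥0 3 ⊠ gap (Kmax≤ near) ⊠ n≥0) (r₁ K maxCyc n)
              where
              r₁ : ∀ K t n → (+ 3) * (K + (+ 2)) * (n * n * n) - K * ((+ 3) * (t * n)) ≡ (+ 3) * ((K + (+ 2)) * (n * n) - K * t) * n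
              r₁ = solve-∀
            lem : ∀ K c m l a b S P e q → (+ 48) * K * ((+ 4) * m + l - S) ≡
              (+ 48) * K * (m + l + a + b + e - (c - (+ 3) * P)) + (+ 12) * ((K + (+ 3)) * (c - q) - (+ 4) * K * (a + b))
              + (+ 4) * ((+ 3) * (K + (+ 2)) * q - K * m) + (+ 37) * ((+ 4) * K * m + (+ 19) * c - (+ 3) * K * c)
              + (+ 48) * ((+ 3) * (K + (+ 2)) * c - K * S) + (+ 144) * (c - K * P) + (+ 48) * (c - K * e) + (+ 12) * q
              + ((+ 3) * K - (+ 1219)) * c
            lem = solve-∀

          contra : ⊥
          contra = <⇒≱ (0<M₁ x near-x) (0≤i-j⇒j≤i (subst (0ℤ ≤_) (lem w m l S) (gap weight ⊹ gap S≤ ⊠ w≥0)))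
            where
            lem : ∀ w m l S → S * w - (((+ 4) * w + 1ℤ) * m + w * l) + ((+ 4) * m + l - S) * w ≡ 0ℤ - m
            lem = solve-∀

      pick : (∀ v → Near U v) → ∀ z (X : List V) → 0ℤ < # X → ∃ λ a → ∃ λ b → ∃ λ c →
        a ∈ U × b ∈ U × c ∈ U × mixed z a b c ≡ true × # X ≤ (+ 3) * # (filterᵇ (λ x → mixed x a b c) X)
      pick near-all z X 0<X = find³ U (λ a b c → (mixed z a b c Bool.≟ true) ×-dec (# X ≤? _)) contra
        where
        k = # X
        c₀ = n * n * n
        μ : V → V → V → V → ℤ
        μ x a b c = χ (mixed x a b c) * cyc a b c
        Mx : V → ℤ
        Mx x = ∑³ U (μ x)
        both : V → V → V → V → ℤ
        both x a b c = χ (mixed z a b c) * cyc a b c * χ (mixed x a b c)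

        lower : ∀ x → Mx z + Mx x - c₀ ≤ ∑³ U (both x)
        lower x = begin
          Mx z + Mx x - c₀
            ≤⟨ +-monoʳ-≤ (Mx z + Mx x) (neg-mono-≤ (∑cyc≤cube U)) ⟩
          Mx z + Mx x + - ∑³ U cyc
            ≡⟨ addˡ (Mx z + Mx x) (trans (sym (-1*i≡-i _)) (sym (∑³-*ˡ U -1ℤ cyc))) ⟩
          Mx z + Mx x + ∑³ U (λ a b c → -1ℤ * cyc a b c)
            ≡⟨ sym (∑³-+-step U (λ a b c → μ z a b c + μ x a b c) (λ a b c → -1ℤ * cyc a b c) (∑³-+ U (μ z) (μ x))) ⟩
          ∑³ U (λ a b c → μ z a b c + μ x a b c + -1ℤ * cyc a b c)
            ≤⟨ ∑³-mono U (λ a b c _ _ _ → pt (mixed z a b c) (mixed x a b c) (cyc a b c) (cyc≥0 a b c)) ⟩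
          ∑³ U (both x) ∎
          where
          open ≤-Reasoning
          r₁ : ∀ C → 1ℤ * C * 1ℤ - (1ℤ * C + 1ℤ * C + -1ℤ * C) ≡ 0ℤ
          r₁ = solve-∀
          r₂ : ∀ C → 1ℤ * C * 0ℤ - (1ℤ * C + 0ℤ * C + -1ℤ * C) ≡ 0ℤ
          r₂ = solve-∀
          r₃ : ∀ C → 0ℤ * C * 1ℤ - (0ℤ * C + 1ℤ * C + -1ℤ * C) ≡ 0ℤ
          r₃ = solve-∀
          r₄ : ∀ C → 0ℤ * C * 0ℤ - (0ℤ * C + 0ℤ * C + -1ℤ * C) ≡ C
          r₄ = solve-∀
          pt : ∀ p q C → 0ℤ ≤ C → χ p * C + χ q * C + -1ℤ * C ≤ χ p * C * χ q
          pt true true C h = gap⁻¹ _ _ ≤-refl (r₁ C)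
          pt true false C h = gap⁻¹ _ _ ≤-refl (r₂ C)
          pt false true C h = gap⁻¹ _ _ ≤-refl (r₃ C)
          pt false false C h = gap⁻¹ _ _ h (r₄ C)

        cnt : V → V → V → ℤ
        cnt a b c = # (filterᵇ (λ x → mixed x a b c) X)

        exchange : ∑ X (λ x → ∑³ U (both x)) ≡ ∑³ U (λ a b c → χ (mixed z a b c) * cyc a b c * cnt a b c)
        exchange = trans (∑-swap X U _) (∑-cong U λ a → trans (∑-swap X U _) (∑-cong U λ b → trans (∑-swap X U _)
          (∑-cong U λ c → trans (∑-*ˡ X (χ (mixed z a b c) * cyc a b c) (λ x → χ (mixed x a b c)))
            (cong (λ r → χ (mixed z a b c) * cyc a b c * r) (sym (#-filter (λ x → mixed x a b c) X))))))

        total = ∑ X (λ x → ∑³ U (both x))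

        total≥ : k * ((+ 2) * K * c₀ - (+ 38) * c₀) ≤ (+ 4) * K * total
        total≥ = begin
          k * ((+ 2) * K * c₀ - (+ 38) * c₀)
            ≡⟨ sym (∑-const X _) ⟩
          ∑ X (λ _ → (+ 2) * K * c₀ - (+ 38) * c₀)
            ≤⟨ ∑-mono X (λ x _ → gap⁻¹ _ _ (nat≥0 4 ⊠ 0≤K ⊠ gap (lower x) ⊹ gap (M₁-bound z (near-all z)) ⊹ gap (M₁-bound x (near-all x)))
                 (r₁ K c₀ (Mx z) (Mx x) (∑³ U (both x)))) ⟩
          ∑ X (λ x → (+ 4) * K * ∑³ U (both x))
            ≡⟨ ∑-*ˡ X ((+ 4) * K) _ ⟩
          (+ 4) * K * total ∎
          where
          open ≤-Reasoning
          r₁ : ∀ K c p q r → (+ 4) * K * r - ((+ 2) * K * c - (+ 38) * c) ≡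
            (+ 4) * K * (r - (p + q - c)) + ((+ 4) * K * p + (+ 19) * c - (+ 3) * K * c) + ((+ 4) * K * q + (+ 19) * c - (+ 3) * K * c)
          r₁ = solve-∀

        contra : ¬ (∀ a b c → a ∈ U → b ∈ U → c ∈ U → ¬ (mixed z a b c ≡ true × k ≤ (+ 3) * cnt a b c))
        contra none = <⇒≱ (pos* 0<X (pos* (pos* 0<n 0<n) 0<n)) (0≤i-j⇒j≤i (cancel≥0 (+ 2096) (+<+ (ℕ.s≤s ℕ.z≤n))
          (subst (0ℤ ≤_) (r₁ K k c₀ total)
            (nat≥0 9 ⊠ gap total≥ ⊹ nat≥0 12 ⊠ 0≤K ⊠ gap total≤ ⊹ nat≥0 2 ⊠ gap K-large ⊠ (nat≥0 (length X) ⊠ (n≥0 ⊠ n≥0 ⊠ n≥0))))))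
          where
          r₁ : ∀ K k c t → (+ 9) * ((+ 4) * K * t - k * ((+ 2) * K * c - (+ 38) * c)) + (+ 12) * K * (k * c - (+ 3) * t)
            + (+ 2) * ((+ 3) * K - (+ 1219)) * (k * c) ≡ (+ 2096) * (0ℤ - k * c)
          r₁ = solve-∀
          r₂ : ∀ k C p → k * C - (+ 3) * (1ℤ * C * p) ≡ C * (k - (+ 3) * p)
          r₂ = solve-∀
          r₃ : ∀ k C p → k * C - (+ 3) * (0ℤ * C * p) ≡ k * C
          r₃ = solve-∀
          pt : ∀ a b c → ¬ (mixed z a b c ≡ true × k ≤ (+ 3) * cnt a b c) →
            (+ 3) * (χ (mixed z a b c) * cyc a b c * cnt a b c) ≤ k * cyc a b c
          pt a b c h with mixed z a b c
          ... | true = gap⁻¹ _ _ (cyc≥0 a b c ⊠ gap (<⇒≤ (≰⇒> (λ p → h (refl , p))))) (r₂ k (cyc a b c) (cnt a b c))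
          ... | false = gap⁻¹ _ _ (nat≥0 (length X) ⊠ cyc≥0 a b c) (r₃ k (cyc a b c) (cnt a b c))
          total≤ : (+ 3) * total ≤ k * c₀
          total≤ = begin
            (+ 3) * total
              ≡⟨ trans (cong ((+ 3) *_) exchange) (sym (∑³-*ˡ U (+ 3) _)) ⟩
            ∑³ U (λ a b c → (+ 3) * (χ (mixed z a b c) * cyc a b c * cnt a b c))
              ≤⟨ ∑³-mono U (λ a b c a∈ b∈ c∈ → pt a b c (none a b c a∈ b∈ c∈)) ⟩
            ∑³ U (λ a b c → k * cyc a b c)
              ≡⟨ ∑³-*ˡ U k cyc ⟩
            k * ∑³ U cyc
              ≤⟨ *-monoˡ-≤-nonNeg k (∑cyc≤cube U) ⟩
            k * c₀ ∎
            where open ≤-Reasoning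

-- Almost perfect tilings

split-∈ : ∀ {A : Set} {v : A} {U} → v ∈ U → ∃ λ U′ → U ↭ v ∷ U′
split-∈ v∈ with ∈-∃++ v∈
... | ys , zs , refl = ys ++ zs , shift _ ys zs

split-∈-other : ∀ {A : Set} {u v : A} {U U′} → U ↭ v ∷ U′ → u ≢ v → u ∈ U → u ∈ U′
split-∈-other p u≢v u∈ with ∈-resp-↭ p u∈
... | here eq = ⊥-elim (u≢v eq)
... | there u∈′ = u∈′

module Tilings {V : Set} (arc : V → V → Arc) (arc-flip : ∀ u v → arc v u ≡ flip (arc u v))
  (K : ℤ) (K-large : + 1219 ≤ (+ 3) * K) where

  open Balanced arc arc-flip K K-large public

  data Tiled : List V → Set where
    []   : Tiled []
    tile : ∀ {x a b c us vs} → mixed x a b c ≡ true → Tiled us → vs ↭ x ∷ a ∷ b ∷ c ∷ us → Tiled vs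

  Tiled-↭ : ∀ {us vs} → us ↭ vs → Tiled us → Tiled vs
  Tiled-↭ p [] with refl ← ↭-empty-inv (↭-sym p) = []
  Tiled-↭ p (tile m t q) = tile m t (↭-trans (↭-sym p) q)

  Tiled-++ : ∀ {us vs} → Tiled us → Tiled vs → Tiled (us ++ vs)
  Tiled-++ [] t = t
  Tiled-++ {vs = vs} (tile m s q) t = tile m (Tiled-++ s t) (++⁺ʳ vs q)

  arc-loop : ∀ v → arc v v ≡ non
  arc-loop v with arc v v | arc-flip v v
  ... | non | _ = refl

  allOut⇒ : ∀ {p q r} → allOut p q r ≡ true → p ≡ out × q ≡ out × r ≡ out
  allOut⇒ {out} {out} {out} _ = refl , refl , refl

  mix⇒ : ∀ {p q r} → mix p q r ≡ true → p ≢ non × q ≢ non × r ≢ non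
  mix⇒ {out} {out} {inn} _ = (λ ()) , (λ ()) , (λ ())
  mix⇒ {out} {inn} {out} _ = (λ ()) , (λ ()) , (λ ())
  mix⇒ {inn} {out} {out} _ = (λ ()) , (λ ()) , (λ ())
  mix⇒ {out} {inn} {inn} _ = (λ ()) , (λ ()) , (λ ())
  mix⇒ {inn} {out} {inn} _ = (λ ()) , (λ ()) , (λ ())
  mix⇒ {inn} {inn} {out} _ = (λ ()) , (λ ()) , (λ ())

  adjacent⇒≢ : ∀ {u v} → arc u v ≢ non → v ≢ u
  adjacent⇒≢ {u} h refl = h (arc-loop u)

  mixed⇒ : ∀ {x a b c} → mixed x a b c ≡ true → a ≢ x × b ≢ x × c ≢ x × b ≢ a × c ≢ a × c ≢ b
  mixed⇒ {x} {a} {b} {c} m with ∧-split (allOut (arc a b) (arc b c) (arc c a)) m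
  ... | m₁ , m₂ with allOut⇒ {arc a b} m₁ | mix⇒ {arc x a} m₂
  ... | ab , bc , ca | xa , xb , xc = adjacent⇒≢ xa , adjacent⇒≢ xb , adjacent⇒≢ xc ,
    adjacent⇒≢ (out≢ ab) , adjacent⇒≢ (out≢ ca) ∘ sym , adjacent⇒≢ (out≢ bc)
    where
    out≢ : ∀ {e} → e ≡ out → e ≢ non
    out≢ refl ()

  split-triple : ∀ {x a b c U} → mixed x a b c ≡ true → a ∈ U → b ∈ U → c ∈ U → ∃ λ U′ → U ↭ a ∷ b ∷ c ∷ U′
  split-triple m a∈ b∈ c∈ with mixed⇒ m | split-∈ a∈
  ... | _ , _ , _ , b≢a , c≢a , c≢b | U₁ , p₁ with split-∈ (split-∈-other p₁ b≢a b∈)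
  ... | U₂ , p₂ with split-∈ (split-∈-other p₂ c≢b (split-∈-other p₁ c≢a c∈))
  ... | U₃ , p₃ = U₃ , ↭-trans p₁ (↭-prep _ (↭-trans p₂ (↭-prep _ p₃)))

  split-tile : ∀ {x a b c U} → mixed x a b c ≡ true → x ∈ U → a ∈ U → b ∈ U → c ∈ U → ∃ λ U′ → U ↭ x ∷ a ∷ b ∷ c ∷ U′
  split-tile m x∈ a∈ b∈ c∈ with mixed⇒ m | split-∈ x∈
  ... | a≢x , b≢x , c≢x , _ | U₁ , p₁ with split-triple m (split-∈-other p₁ a≢x a∈) (split-∈-other p₁ b≢x b∈) (split-∈-other p₁ c≢x c∈)
  ... | U₂ , p₂ = U₂ , ↭-trans p₁ (↭-prep _ p₂)

  few-sub : ∀ {U R U′} → U ↭ R ++ U′ → FewNon U → FewNon U′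
  few-sub {U} {R} {U′} p few v = ≤-trans (gap⁻¹ _ _ (∑-nonneg R (λ u _ → zr≥0 v u)) (lem (∑ R (zr v)) (∑ U′ (zr v))))
    (subst (_≤ (+ 2)) (trans (∑-↭ p (zr v)) (∑-++ R U′ (zr v))) (few v))
    where
    lem : ∀ p q → p + q - q ≡ p
    lem = solve-∀

  module _ (U : List V) where
    private
      n = # U
      d = deg U

    W : V → ℤ
    W q = ∑ U (λ v → d v * s v q)

    ∑W : ∑ U W ≡ Φ U
    ∑W = trans (∑-swap U U _) (∑-cong U λ v → ∑-*ˡ U (d v) (s v))

    Φ-shift : ∀ (e : V → ℤ) {R U′} → U ↭ R ++ U′ → (∀ v → deg U′ v ≡ d v - e v) →
      Φ U′ + ∑ R (λ v → (d v - e v) * (d v - e v)) ≡ Φ U - (+ 2) * ∑ U (λ v → d v * e v) + ∑ U (λ v → e v * e v)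
    Φ-shift e {R} {U′} p h = begin
      Φ U′ + ∑ R f
        ≡⟨ cong₂ _+_ (∑-cong U′ λ v → cong₂ _*_ (h v) (h v)) refl ⟩
      ∑ U′ f + ∑ R f
        ≡⟨ +-comm (∑ U′ f) (∑ R f) ⟩
      ∑ R f + ∑ U′ f
        ≡⟨ sym (trans (∑-↭ p f) (∑-++ R U′ f)) ⟩
      ∑ U f
        ≡⟨ ∑-cong U (λ v → lem (d v) (e v)) ⟩
      ∑ U (λ v → d v * d v - (+ 2) * (d v * e v) + e v * e v)
        ≡⟨ trans (∑-+ U _ _) (cong (_+ ∑ U (λ v → e v * e v)) (trans (∑-- U _ _) (cong (λ r → Φ U - r) (∑-*ˡ U (+ 2) _)))) ⟩
      Φ U - (+ 2) * ∑ U (λ v → d v * e v) + ∑ U (λ v → e v * e v) ∎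
      where
      open ≡-Reasoning
      f : V → ℤ
      f v = (d v - e v) * (d v - e v)
      lem : ∀ d e → (d - e) * (d - e) ≡ d * d - (+ 2) * (d * e) + e * e
      lem = solve-∀

    Φ-tile : ∀ {x a b c U′} → U ↭ x ∷ a ∷ b ∷ c ∷ U′ →
      Φ U′ ≤ Φ U - (+ 2) * (W x + W a + W b + W c) + (+ 16) * n
    Φ-tile {x} {a} {b} {c} {U′} p = gap⁻¹ _ _
      (∑-nonneg (x ∷ a ∷ b ∷ c ∷ []) (λ v _ → sq≥0 (d v - e v)) ⊹ gap e²≤)
      (lem (Φ U) (Φ U′) (W x + W a + W b + W c) Σq (∑ U (λ v → e v * e v)) ((+ 16) * n)
        (subst (λ r → Φ U′ + Σq ≡ Φ U - (+ 2) * r + ∑ U (λ v → e v * e v)) ∑de (Φ-shift e {x ∷ a ∷ b ∷ c ∷ []} p d′)))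
      where
      e : V → ℤ
      e v = s v x + s v a + s v b + s v c
      Σq = ∑ (x ∷ a ∷ b ∷ c ∷ []) (λ v → (d v - e v) * (d v - e v))
      d′ : ∀ v → deg U′ v ≡ d v - e v
      d′ v = trans (lem₁ (s v x) (s v a) (s v b) (s v c) (deg U′ v)) (cong (_- e v) (sym (∑-↭ p (s v))))
        where
        lem₁ : ∀ p q r t D → D ≡ p + (q + (r + (t + D))) - (p + q + r + t)
        lem₁ = solve-∀
      ∑de : ∑ U (λ v → d v * e v) ≡ W x + W a + W b + W c
      ∑de = trans (∑-cong U λ v → lem₁ (d v) (s v x) (s v a) (s v b) (s v c))
        (trans (∑-+ U _ _) (cong₂ _+_ (trans (∑-+ U _ _) (cong₂ _+_ (∑-+ U _ _) refl)) refl))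
        where
        lem₁ : ∀ d p q r t → d * (p + q + r + t) ≡ d * p + d * q + d * r + d * t
        lem₁ = solve-∀
      pt : ∀ p q r t → (val p + val q + val r + val t) * (val p + val q + val r + val t) ≤ (+ 16)
      pt p q r t = ≤ᵇ⇒≤ (subst Bool.T (sym (∀Arc-elim (g p q r) (∀Arc-elim (λ r → ∀Arc (g p q r))
        (∀Arc-elim (λ q → ∀Arc λ r → ∀Arc (g p q r)) (∀Arc-elim (λ p → ∀Arc λ q → ∀Arc λ r → ∀Arc (g p q r)) refl p) q) r) t)) _)
        where
        g : Arc → Arc → Arc → Arc → Bool
        g p q r t = (val p + val q + val r + val t) * (val p + val q + val r + val t) ≤ᵇ (+ 16)
      e²≤ : ∑ U (λ v → e v * e v) ≤ (+ 16) * n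
      e²≤ = ≤-trans (∑-mono U (λ v _ → pt (arc v x) (arc v a) (arc v b) (arc v c)))
        (≤-reflexive (trans (∑-const U (+ 16)) (*-comm n (+ 16))))
      lem : ∀ P P′ w q E N → P′ + q ≡ P - (+ 2) * w + E → P - (+ 2) * w + N - P′ ≡ q + (N - E)
      lem P P′ w q E N h = trans (trans (lem₁ P P′ w q E N) (cong (λ r → r - (P′ + q) + q + (N - E)) (sym h))) (lem₂ P′ q (N - E))
        where
        lem₁ : ∀ P P′ w q E N → P - (+ 2) * w + N - P′ ≡ P - (+ 2) * w + E - (P′ + q) + q + (N - E)
        lem₁ = solve-∀
        lem₂ : ∀ P′ q X → P′ + q - (P′ + q) + q + X ≡ q + X
        lem₂ = solve-∀

    Φ-remove : ∀ {v U′} → U ↭ v ∷ U′ → Φ U′ ≤ Φ U + (+ 2) * ∑ U (ab ∘ d) + n - d v * d v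
    Φ-remove {x} {U′} p = gap⁻¹ _ _
      (gap e²≤ ⊹ nat≥0 2 ⊠ gap W≥)
      (lem (Φ U) (Φ U′) (W x) (∑ U (ab ∘ d)) n (d x) (∑ U (λ v → s v x * s v x))
        (trans (cong (λ r → Φ U′ + ((d x - r) * (d x - r) + 0ℤ)) (sym (cong val (arc-loop x)))) (Φ-shift (λ v → s v x) {x ∷ []} p d′)))
      where
      d′ : ∀ v → deg U′ v ≡ d v - s v x
      d′ v = trans (lem₁ (s v x) (deg U′ v)) (cong (_- s v x) (sym (∑-↭ p (s v))))
        where
        lem₁ : ∀ p D → D ≡ p + D - p
        lem₁ = solve-∀
      W≥ : - ∑ U (ab ∘ d) ≤ W x
      W≥ = ≤-trans (≤-reflexive (sym (∑-neg U (ab ∘ d)))) (∑-mono U λ v _ → pt (arc v x) (d v))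
        where
        pt : ∀ e i → - ab i ≤ i * val e
        pt out i = subst₂ _≤_ refl (trans (neg-involutive i) (sym (*-identityʳ i))) (neg-mono-≤ (-i≤ab i))
        pt inn i = subst₂ _≤_ refl (trans (sym (-1*i≡-i i)) (*-comm -1ℤ i)) (neg-mono-≤ (i≤ab i))
        pt non i = subst (- ab i ≤_) (sym (*-zeroʳ i)) (neg-mono-≤ (ab≥0 i))
      e²≤ : ∑ U (λ v → s v x * s v x) ≤ n
      e²≤ = ≤-trans (∑-mono U (λ v _ → pt (arc v x))) (≤-reflexive (sym (#≡∑ U)))
        where
        pt : ∀ e → val e * val e ≤ 1ℤ
        pt out = ≤-refl
        pt inn = ≤-refl
        pt non = nat≥0 1
      lem : ∀ P P′ w B n d E → P′ + ((d - 0ℤ) * (d - 0ℤ) + 0ℤ) ≡ P - (+ 2) * w + E →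
        P + (+ 2) * B + n - d * d - P′ ≡ (n - E) + (+ 2) * (w - - B)
      lem P P′ w B n d E h = trans (lem₁ P P′ w B n d E) (trans (cong (λ r → r - (P′ + ((d - 0ℤ) * (d - 0ℤ) + 0ℤ)) + ((n - E) + (+ 2) * (w - - B))) (sym h)) (lem₂ (P′ + ((d - 0ℤ) * (d - 0ℤ) + 0ℤ)) _))
        where
        lem₁ : ∀ P P′ w B n d E → P + (+ 2) * B + n - d * d - P′ ≡ P - (+ 2) * w + E - (P′ + ((d - 0ℤ) * (d - 0ℤ) + 0ℤ)) + ((n - E) + (+ 2) * (w - - B))
        lem₁ = solve-∀
        lem₂ : ∀ p X → p - p + X ≡ X
        lem₂ = solve-∀

  module Nibbling (a b t : ℤ) (0≤a : 0ℤ ≤ a) (0≤b : 0ℤ ≤ b)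
    (a-small : (+ 32) * (K * K) * a ≤ t) (b-small : (+ 32) * (K * K) * b ≤ t * t)
    (t-large : (+ 32) * (K * K) ≤ t) (t-large′ : K * (+ 96) ≤ t) where

    private
      κ = K * K

      κ≥0 : 0ℤ ≤ κ
      κ≥0 = sq≥0 K

      1≤K : 1ℤ ≤ K
      1≤K = i<j⇒suc[i]≤j 0<K

      1≤κ : 1ℤ ≤ κ
      1≤κ = gap⁻¹ _ _ (gap 1≤K ⊠ (0≤K ⊹ nat≥0 1)) (lem K)
        where
        lem : ∀ K → K * K - 1ℤ ≡ (K - 1ℤ) * (K + 1ℤ)
        lem = solve-∀

      32≤t : + 32 ≤ t
      32≤t = ≤-trans (gap⁻¹ _ _ (nat≥0 32 ⊠ gap 1≤κ) (lem κ)) t-large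
        where
        lem : ∀ κ → (+ 32) * κ - (+ 32) ≡ (+ 32) * (κ - 1ℤ)
        lem = solve-∀

      0≤t : 0ℤ ≤ t
      0≤t = ≤-trans (nat≥0 32) 32≤t

      a≤t : a ≤ t
      a≤t = gap⁻¹ _ _ (gap a-small ⊹ nat≥0 32 ⊠ gap 1≤κ ⊠ 0≤a ⊹ nat≥0 31 ⊠ 0≤a) (lem κ a t)
        where
        lem : ∀ κ a t → t - a ≡ t - (+ 32) * κ * a + (+ 32) * (κ - 1ℤ) * a + (+ 31) * a
        lem = solve-∀

      b≤t² : b ≤ t * t
      b≤t² = gap⁻¹ _ _ (gap b-small ⊹ nat≥0 32 ⊠ gap 1≤κ ⊠ 0≤b ⊹ nat≥0 31 ⊠ 0≤b) (lem κ b (t * t))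
        where
        lem : ∀ κ a t → t - a ≡ t - (+ 32) * κ * a + (+ 32) * (κ - 1ℤ) * a + (+ 31) * a
        lem = solve-∀

    -- The state of the deletion process: U is what remains and τ vertices have been discarded so far.  The right-hand
    -- side scales like n², which is the rate at which removing tiles balanced on average shrinks Φ.
    Invariant : List V → ℤ → Set
    Invariant U τ = (+ 4) * κ * Φ U + τ * (# U * # U) ≤ a * (# U * # U) + b * # U

    module Step (U : List V) (τ : ℤ) (0≤τ : 0ℤ ≤ τ) (inv : Invariant U τ)
      (b-large : (+ 64) * κ * # U ≤ (+ 3) * b) (few : FewNon U) where
      private
        n = # U
        P = Φ U
        0≤n = nat≥0 (length U)
        0≤P = Φ≥0 U

      few-discarded : 0ℤ < n → t ≤ n → τ ≤ (+ 2) * t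
      few-discarded 0<n t≤n = 0≤i-j⇒j≤i (cancel≥0 n 0<n (cancel≥0 n 0<n (subst (0ℤ ≤_) (sym (lem κ P τ a b t n))
        (gap inv ⊹ nat≥0 4 ⊠ κ≥0 ⊠ 0≤P ⊹ gap a≤t ⊠ (0≤n ⊠ 0≤n) ⊹ gap b≤t² ⊠ 0≤n ⊹ 0≤t ⊠ gap t≤n ⊠ 0≤n))))
        where
        lem : ∀ κ P τ a b t n → n * (n * ((+ 2) * t - τ)) ≡ a * (n * n) + b * n - ((+ 4) * κ * P + τ * (n * n))
          + (+ 4) * κ * P + (t - a) * (n * n) + (t * t - b) * n + t * (n - t) * n
        lem = solve-∀

      module _ (2t<n : (+ 2) * t < n) where

        private
          2t≤n = <⇒≤ 2t<n

        0<n : 0ℤ < n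
        0<n = ≤-<-trans (nat≥0 2 ⊠ 0≤t) 2t<n

        tile-inv : ∀ {U′ P′} → P′ ≡ Φ U′ → n ≡ (+ 4) + # U′ → n * P′ ≤ n * P - (+ 8) * P + (+ 16) * (n * n) → Invariant U′ τ
        tile-inv {U′} refl n≡ h = 0≤i-j⇒j≤i (cancel≥0 n 0<n (subst (0ℤ ≤_)
          (trans (lem κ P (Φ U′) τ a b n) (cong (λ n′ → n * (a * (n′ * n′) + b * n′ - ((+ 4) * κ * Φ U′ + τ * (n′ * n′)))) n′≡))
          (nat≥0 4 ⊠ κ≥0 ⊠ gap h ⊹ 0≤n-8 ⊠ gap inv ⊹ 0≤n ⊠ gap b-large ⊹ nat≥0 16 ⊠ τn≤ ⊹ 0≤n-16 ⊠ 0≤b)))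
          where
          n′≡ : n - (+ 4) ≡ # U′
          n′≡ = trans (cong (_- (+ 4)) n≡) (lem₁ (# U′))
            where
            lem₁ : ∀ p → (+ 4) + p - (+ 4) ≡ p
            lem₁ = solve-∀
          0≤n-16 : 0ℤ ≤ n - (+ 16)
          0≤n-16 = subst (0ℤ ≤_) (lem₁ n t) (gap 2t≤n ⊹ nat≥0 2 ⊠ gap 32≤t ⊹ nat≥0 48)
            where
            lem₁ : ∀ n t → n - (+ 2) * t + (+ 2) * (t - (+ 32)) + (+ 48) ≡ n - (+ 16)
            lem₁ = solve-∀
          0≤n-8 : 0ℤ ≤ n - (+ 8)
          0≤n-8 = subst (0ℤ ≤_) (lem₁ n) (0≤n-16 ⊹ nat≥0 8)
            where
            lem₁ : ∀ n → n - (+ 16) + (+ 8) ≡ n - (+ 8)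
            lem₁ = solve-∀
          τn≤ : 0ℤ ≤ a * n + b - τ * n
          τn≤ = cancel≥0 n 0<n (subst (0ℤ ≤_) (sym (lem₁ κ P τ a b n)) (gap inv ⊹ nat≥0 4 ⊠ κ≥0 ⊠ 0≤P))
            where
            lem₁ : ∀ κ P τ a b n → n * (a * n + b - τ * n) ≡ a * (n * n) + b * n - ((+ 4) * κ * P + τ * (n * n)) + (+ 4) * κ * P
            lem₁ = solve-∀
          lem : ∀ κ P P′ τ a b n →
            (+ 4) * κ * (n * P - (+ 8) * P + (+ 16) * (n * n) - n * P′)
            + (n - (+ 8)) * (a * (n * n) + b * n - ((+ 4) * κ * P + τ * (n * n)))
            + n * ((+ 3) * b - (+ 64) * κ * n) + (+ 16) * (a * n + b - τ * n) + (n - (+ 16)) * b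
            ≡ n * (a * ((n - (+ 4)) * (n - (+ 4))) + b * (n - (+ 4)) - ((+ 4) * κ * P′ + τ * ((n - (+ 4)) * (n - (+ 4)))))
          lem = solve-∀

        remove-inv : ∀ {U′} d → n < K * ab d → n ≡ 1ℤ + # U′ →
          Φ U′ ≤ P + (+ 2) * ∑ U (ab ∘ deg U) + n - d * d → Invariant U′ (1ℤ + τ)
        remove-inv {U′} d bad n≡ h = 0≤i-j⇒j≤i (cancel≥0 (+ 16) (+<+ (ℕ.s≤s ℕ.z≤n)) (subst (0ℤ ≤_)
          (trans (lem κ P (Φ U′) τ a b n t Σd d) (cong (λ n′ → (+ 16) * (a * (n′ * n′) + b * n′ - ((+ 4) * κ * Φ U′ + (1ℤ + τ) * (n′ * n′)))) n′≡))
          (nat≥0 64 ⊠ κ≥0 ⊠ gap h ⊹ nat≥0 16 ⊠ gap inv ⊹ 0≤Σd-bound ⊹ 0≤n-64κ ⊠ 0≤n ⊹ nat≥0 64 ⊠ κd²≥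
            ⊹ nat≥0 16 ⊠ 0≤n ⊠ (gap 2t≤n ⊹ nat≥0 2 ⊠ gap a≤t)
            ⊹ nat≥0 4 ⊠ (gap 2t≤n ⊠ (0≤n ⊹ nat≥0 2 ⊠ 0≤t) ⊹ nat≥0 4 ⊠ gap b≤t²)
            ⊹ (nat≥0 16 ⊠ (0≤n ⊠ 0≤n) ⊹ nat≥0 16 ⊠ 0≤a ⊹ nat≥0 32 ⊠ gap 1≤n ⊹ nat≥0 16 ⊹ 0≤τ ⊠ (nat≥0 16 ⊠ 0≤n ⊹ nat≥0 16 ⊠ gap 1≤n)))))
          where
          Σd = ∑ U (ab ∘ deg U)
          1≤n : 1ℤ ≤ n
          1≤n = i<j⇒suc[i]≤j 0<n
          n′≡ : n - 1ℤ ≡ # U′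
          n′≡ = trans (cong (_- 1ℤ) n≡) (lem₁ (# U′))
            where
            lem₁ : ∀ p → 1ℤ + p - 1ℤ ≡ p
            lem₁ = solve-∀
          0≤n-64κ : 0ℤ ≤ n - (+ 64) * κ
          0≤n-64κ = subst (0ℤ ≤_) (lem₁ n t κ) (gap 2t≤n ⊹ nat≥0 2 ⊠ gap t-large)
            where
            lem₁ : ∀ n t κ → n - (+ 2) * t + (+ 2) * (t - (+ 32) * κ) ≡ n - (+ 64) * κ
            lem₁ = solve-∀
          κd²≥ : 0ℤ ≤ κ * (d * d) - n * n
          κd²≥ = subst (0ℤ ≤_) (trans (lem₁ K (ab d) n) (cong (λ r → κ * r - n * n) (ab-sq d)))
            (gap (<⇒≤ bad) ⊠ (0≤K ⊠ ab≥0 d ⊹ 0≤n))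
            where
            lem₁ : ∀ K e n → (K * e - n) * (K * e + n) ≡ K * K * (e * e) - n * n
            lem₁ = solve-∀
          -- Sum of (8κ|d| − n)² ≥ 0 over U.
          ∑ab≤ : (+ 16) * κ * n * Σd ≤ (+ 64) * κ * κ * P + n * (n * n)
          ∑ab≤ = begin
            (+ 16) * κ * n * Σd
              ≡⟨ sym (∑-*ˡ U ((+ 16) * κ * n) (ab ∘ deg U)) ⟩
            ∑ U (λ v → (+ 16) * κ * n * ab (deg U v))
              ≤⟨ ∑-mono U (λ v _ → pt (deg U v)) ⟩
            ∑ U (λ v → (+ 64) * κ * κ * (deg U v * deg U v) + n * n)
              ≡⟨ trans (∑-+ U _ _) (cong₂ _+_ (∑-*ˡ U ((+ 64) * κ * κ) _) (∑-const U (n * n))) ⟩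
            (+ 64) * κ * κ * P + n * (n * n) ∎
            where
            open ≤-Reasoning
            lem₁ : ∀ κ n e → (+ 64) * κ * κ * (e * e) + n * n - (+ 16) * κ * n * e ≡ ((+ 8) * κ * e - n) * ((+ 8) * κ * e - n)
            lem₁ = solve-∀
            pt : ∀ i → (+ 16) * κ * n * ab i ≤ (+ 64) * κ * κ * (i * i) + n * n
            pt i = subst (λ r → (+ 16) * κ * n * ab i ≤ (+ 64) * κ * κ * r + n * n) (ab-sq i)
              (gap⁻¹ _ _ (sq≥0 ((+ 8) * κ * ab i - n)) (lem₁ κ n (ab i)))
          0≤Σd-bound : 0ℤ ≤ (+ 11) * (n * n) - (+ 128) * κ * Σd
          0≤Σd-bound = cancel≥0 n 0<n (subst (0ℤ ≤_) (lem₁ κ P τ a b n t Σd)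
            (nat≥0 8 ⊠ gap ∑ab≤ ⊹ nat≥0 128 ⊠ κ≥0 ⊠ gap inv ⊹ nat≥0 128 ⊠ κ≥0 ⊠ 0≤τ ⊠ (0≤n ⊠ 0≤n)
              ⊹ nat≥0 4 ⊠ gap a-small ⊠ (0≤n ⊠ 0≤n) ⊹ nat≥0 2 ⊠ gap 2t≤n ⊠ (0≤n ⊠ 0≤n)
              ⊹ nat≥0 4 ⊠ gap b-small ⊠ 0≤n ⊹ gap 2t≤n ⊠ (0≤n ⊹ nat≥0 2 ⊠ 0≤t) ⊠ 0≤n))
            where
            lem₁ : ∀ κ P τ a b n t B →
              (+ 8) * ((+ 64) * κ * κ * P + n * (n * n) - (+ 16) * κ * n * B)
              + (+ 128) * κ * (a * (n * n) + b * n - ((+ 4) * κ * P + τ * (n * n))) + (+ 128) * κ * τ * (n * n)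
              + (+ 4) * (t - (+ 32) * κ * a) * (n * n) + (+ 2) * (n - (+ 2) * t) * (n * n)
              + (+ 4) * (t * t - (+ 32) * κ * b) * n + (n - (+ 2) * t) * (n + (+ 2) * t) * n
              ≡ n * ((+ 11) * (n * n) - (+ 128) * κ * B)
            lem₁ = solve-∀
          lem : ∀ κ P P′ τ a b n t B d →
            (+ 64) * κ * (P + (+ 2) * B + n - d * d - P′) + (+ 16) * (a * (n * n) + b * n - ((+ 4) * κ * P + τ * (n * n)))
            + ((+ 11) * (n * n) - (+ 128) * κ * B) + (n - (+ 64) * κ) * n + (+ 64) * (κ * (d * d) - n * n)
            + (+ 16) * n * (n - (+ 2) * t + (+ 2) * (t - a))
            + (+ 4) * ((n - (+ 2) * t) * (n + (+ 2) * t) + (+ 4) * (t * t - b))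
            + ((+ 16) * (n * n) + (+ 16) * a + (+ 32) * (n - 1ℤ) + (+ 16) + τ * ((+ 16) * n + (+ 16) * (n - 1ℤ)))
            ≡ (+ 16) * (a * ((n - 1ℤ) * (n - 1ℤ)) + b * (n - 1ℤ) - ((+ 4) * κ * P′ + (1ℤ + τ) * ((n - 1ℤ) * (n - 1ℤ))))
          lem = solve-∀

    record Leftover (U : List V) (τ : ℤ) : Set where
      constructor leftover
      field
        {tiles} : List V
        {rest}  : List V
        tiled   : Tiled tiles
        split   : U ↭ tiles ++ rest
        small   : # rest + τ ≤ (+ 4) * t

    record Ready (U : List V) (τ : ℤ) : Set where
      constructor ready
      field
        0≤τ     : 0ℤ ≤ τ
        inv     : Invariant U τ
        b-large : (+ 64) * κ * # U ≤ (+ 3) * b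
        few     : FewNon U
        t≤n     : t ≤ # U

    private
      b-large-sub : ∀ {n n′} k → 0ℤ ≤ k → n ≡ k + n′ → (+ 64) * κ * n ≤ (+ 3) * b → (+ 64) * κ * n′ ≤ (+ 3) * b
      b-large-sub {n′ = n′} k 0≤k refl h = gap⁻¹ _ _ (gap h ⊹ nat≥0 64 ⊠ κ≥0 ⊠ 0≤k) (lem κ k n′ b)
        where
        lem : ∀ κ k n b → (+ 3) * b - (+ 64) * κ * n ≡ (+ 3) * b - (+ 64) * κ * (k + n) + (+ 64) * κ * k
        lem = solve-∀

      t≤n-sub : ∀ {n n′} k → k ≤ + 32 → n ≡ k + n′ → (+ 2) * t < n → t ≤ n′
      t≤n-sub {n′ = n′} k k≤ refl h = gap⁻¹ _ _ (gap (<⇒≤ h) ⊹ gap 32≤t ⊹ gap k≤) (lem k n′ t)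
        where
        lem : ∀ k n t → n - t ≡ k + n - (+ 2) * t + (t - (+ 32)) + ((+ 32) - k)
        lem = solve-∀

    module _ {U τ} (r : Ready U τ) (recurse : ∀ U′ τ′ → length U′ ℕ.< length U → Ready U′ τ′ → Leftover U′ τ′) where
      open Ready r
      private
        n = # U
        module S = Step U τ 0≤τ inv b-large few

      stop : n ≤ (+ 2) * t → Leftover U τ
      stop n≤2t = leftover [] ↭-refl (gap⁻¹ _ _ (gap n≤2t ⊹ gap (S.few-discarded 0<n t≤n)) (lem n τ t))
        where
        0<n : 0ℤ < n
        0<n = <-≤-trans (<-≤-trans (+<+ (ℕ.s≤s ℕ.z≤n)) 32≤t) t≤n
        lem : ∀ n τ t → (+ 4) * t - (n + τ) ≡ (+ 2) * t - n + ((+ 2) * t - τ)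
        lem = solve-∀

      discard : (+ 2) * t < n → ∀ {v} → v ∈ U → n < K * ab (deg U v) → Leftover U τ
      discard 2t<n {v} v∈ far with split-∈ v∈
      ... | U′ , perm = finish (recurse U′ (1ℤ + τ) (ℕ.≤-reflexive (sym (↭-length perm))) ready′)
        where
        n≡ : n ≡ 1ℤ + # U′
        n≡ = cong +_ (↭-length perm)
        ready′ : Ready U′ (1ℤ + τ)
        ready′ = ready (nat≥0 1 ⊹ 0≤τ) (S.remove-inv 2t<n {U′} (deg U v) far n≡ (Φ-remove U perm))
          (b-large-sub {n} {# U′} 1ℤ (nat≥0 1) n≡ b-large) (few-sub {U} {v ∷ []} {U′} perm few) (t≤n-sub {n} {# U′} 1ℤ (+≤+ (ℕ.s≤s ℕ.z≤n)) n≡ 2t<n)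
        finish : Leftover U′ (1ℤ + τ) → Leftover U τ
        finish (leftover {tiles} {rest} tiled split small) = leftover {rest = v ∷ rest} tiled
          (↭-trans perm (↭-trans (↭-prep v split) (↭-sym (shift v tiles rest))))
          (≤-trans (≤-reflexive (lem (# rest) τ)) small)
          where
          lem : ∀ r τ → 1ℤ + r + τ ≡ r + (1ℤ + τ)
          lem = solve-∀

      surplus : V → ℤ
      surplus q = n * W U q - Φ U

      ∑surplus : 0ℤ ≤ ∑ U surplus
      ∑surplus = ≤-reflexive (sym (trans (∑-- U _ _) (trans (cong₂ _-_
        (trans (∑-*ˡ U n (W U)) (cong (n *_) (∑W U))) (∑-const U (Φ U))) (+-inverseʳ (n * Φ U)))))

      remove : ∀ {x p q r U′} → (+ 2) * t < n → mixed x p q r ≡ true → 0ℤ ≤ surplus x + surplus p + surplus q + surplus r →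
        U ↭ x ∷ p ∷ q ∷ r ∷ U′ → Leftover U τ
      remove {x} {p} {q} {r} {U′} 2t<n mx heavy perm = finish (recurse U′ τ (ℕ.≤-trans (ℕ.m≤n+m _ 3) (ℕ.≤-reflexive (sym (↭-length perm)))) ready′)
        where
        n≡ : n ≡ (+ 4) + # U′
        n≡ = cong +_ (↭-length perm)
        shrink : n * Φ U′ ≤ n * Φ U - (+ 8) * Φ U + (+ 16) * (n * n)
        shrink = gap⁻¹ _ _ (nat≥0 (length U) ⊠ gap (Φ-tile U perm) ⊹ nat≥0 2 ⊠ heavy)
          (lem n (Φ U) (Φ U′) (W U x) (W U p) (W U q) (W U r))
          where
          lem : ∀ n P P′ x p q r → n * P - (+ 8) * P + (+ 16) * (n * n) - n * P′ ≡
            n * (P - (+ 2) * (x + p + q + r) + (+ 16) * n - P′)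
            + (+ 2) * (n * x - P + (n * p - P) + (n * q - P) + (n * r - P))
          lem = solve-∀
        ready′ : Ready U′ τ
        ready′ = ready 0≤τ (S.tile-inv 2t<n {U′} refl n≡ shrink)
          (b-large-sub {n} {# U′} (+ 4) (nat≥0 4) n≡ b-large) (few-sub {U} {x ∷ p ∷ q ∷ r ∷ []} {U′} perm few)
          (t≤n-sub {n} {# U′} (+ 4) (+≤+ (ℕ.s≤s (ℕ.s≤s (ℕ.s≤s (ℕ.s≤s ℕ.z≤n))))) n≡ 2t<n)
        finish : Leftover U′ τ → Leftover U τ
        finish (leftover tiled split small) = leftover (tile mx tiled ↭-refl)
          (↭-trans perm (↭-prep x (↭-prep p (↭-prep q (↭-prep r split))))) small

      remove-tile : (+ 2) * t < n → (∀ v → v ∈ U → Near U v) → Leftover U τ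
      remove-tile 2t<n near =
        let x , x∈ , p , q , r , p∈ , q∈ , r∈ , mx , heavy = heavy-tile U near few (≤-trans t-large′ t≤n) (S.0<n 2t<n) surplus ∑surplus
            _ , perm = split-tile mx x∈ p∈ q∈ r∈
        in remove 2t<n mx heavy perm

      nibble-step : Leftover U τ
      nibble-step with n ≤? (+ 2) * t | all? (λ v → K * ab (deg U v) ≤? n) U
      ... | yes n≤2t | _ = stop n≤2t
      ... | no n≰2t | yes near = remove-tile (≰⇒> n≰2t) (λ v → All.lookup near)
      ... | no n≰2t | no far with find (¬All⇒Any¬ (λ v → K * ab (deg U v) ≤? n) U far)
      ... | v , v∈ , far-v = discard (≰⇒> n≰2t) v∈ (≰⇒> far-v)

    nibble : ∀ m U τ → length U ℕ.< m → Ready U τ → Leftover U τ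
    nibble (suc m) U τ (ℕ.s≤s len) r = nibble-step r λ U′ τ′ len′ → nibble m U′ τ′ (ℕ.≤-trans len′ len)

-- Absorption

∈-filterᵇ⁺ : ∀ {A : Set} (p : A → Bool) {v} xs → v ∈ xs → p v ≡ true → v ∈ filterᵇ p xs
∈-filterᵇ⁺ p (x ∷ xs) (here refl) h with p x
... | true = here refl
∈-filterᵇ⁺ p (x ∷ xs) (there v∈) h with p x
... | true = there (∈-filterᵇ⁺ p xs v∈ h)
... | false = ∈-filterᵇ⁺ p xs v∈ h

#-++ : ∀ {A : Set} (xs ys : List A) → # (xs ++ ys) ≡ # xs + # ys
#-++ xs ys = cong +_ (length-++ xs)

module Absorbers {V : Set} (arc : V → V → Arc) (arc-flip : ∀ u v → arc v u ≡ flip (arc u v))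
  (K : ℤ) (K-large : + 1219 ≤ (+ 3) * K)
  (Vs : List V) (complete : ∀ v → v ∈ Vs) where

  open Tilings arc arc-flip K K-large public

  module Reservoir (few-Vs : FewNon Vs) (balanced : ∀ v → ab (deg Vs v) ≤ 1ℤ)
    (ρ : ℤ) (room : K * (1ℤ + ρ) + ρ ≤ # Vs) (room′ : K * (+ 96) + ρ ≤ # Vs)
    (h : ℕ) (h-large : # Vs * (+ 2) ^ h < (+ 3) ^ h) (h-small : (+ 12) * + h + (+ 9) + ρ < # Vs) where

    record Triple (z : V) (X U : List V) : Set where
      constructor triple
      field
        {a b c} : V
        {rest}  : List V
        split   : U ↭ a ∷ b ∷ c ∷ rest
        mixed-z : mixed z a b c ≡ true
        most    : # X ≤ (+ 3) * # (filterᵇ (λ x → mixed x a b c) X)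

    module Available {R U : List V} (perm : Vs ↭ R ++ U) (#R≤ρ : # R ≤ ρ) where

      #Vs : # Vs ≡ # R + # U
      #Vs = trans (cong +_ (↭-length perm)) (#-++ R U)

      |d|≤ : ∀ v → ab (deg U v) ≤ 1ℤ + # R
      |d|≤ v = begin
        ab (deg U v)
          ≡⟨ cong ab (trans (lem₁ (deg R v) (deg U v)) (cong (_- deg R v) (sym (trans (∑-↭ perm (s v)) (∑-++ R U (s v)))))) ⟩
        ab (deg Vs v - deg R v)
          ≤⟨ ab-+ (deg Vs v) (- deg R v) ⟩
        ab (deg Vs v) + ab (- deg R v)
          ≡⟨ addˡ (ab (deg Vs v)) (cong +_ (∣-i∣≡∣i∣ (deg R v))) ⟩
        ab (deg Vs v) + ab (deg R v)
          ≤⟨ +-mono-≤ (balanced v) (deg≤ R) ⟩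
        1ℤ + # R ∎
        where
        open ≤-Reasoning
        lem₁ : ∀ p q → q ≡ p + q - p
        lem₁ = solve-∀
        ab-val : ∀ e → ab (val e) ≤ 1ℤ
        ab-val out = ≤-refl
        ab-val inn = ≤-refl
        ab-val non = nat≥0 1
        ab-+ : ∀ i j → ab (i + j) ≤ ab i + ab j
        ab-+ i j = +≤+ (∣i+j∣≤∣i∣+∣j∣ i j)
        deg≤ : ∀ xs → ab (deg xs v) ≤ # xs
        deg≤ [] = ≤-refl
        deg≤ (x ∷ xs) = ≤-trans (ab-+ (s v x) (deg xs v)) (+-mono-≤ (ab-val (arc v x)) (deg≤ xs))

      near : ∀ v → Near U v
      near v = gap⁻¹ _ _ (gap room ⊹ (0≤K ⊹ nat≥0 1) ⊠ gap #R≤ρ ⊹ 0≤K ⊠ gap (|d|≤ v))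
        (trans (lem K (# R) (# U) ρ (ab (deg U v))) (cong (λ n → n - (K * (1ℤ + ρ) + ρ) + (K + 1ℤ) * (ρ - # R) + K * (1ℤ + # R - ab (deg U v))) (sym #Vs)))
        where
        lem : ∀ K r u ρ d → u - K * d ≡ r + u - (K * (1ℤ + ρ) + ρ) + (K + 1ℤ) * (ρ - r) + K * (1ℤ + r - d)
        lem = solve-∀

      large : Large U
      large = gap⁻¹ _ _ (gap room′ ⊹ gap #R≤ρ) (trans (lem K (# R) (# U) ρ)
        (cong (λ n → n - (K * (+ 96) + ρ) + (ρ - # R)) (sym #Vs)))
        where
        lem : ∀ K r u ρ → u - K * (+ 96) ≡ r + u - (K * (+ 96) + ρ) + (ρ - r)
        lem = solve-∀

      0<#U : 0ℤ < # U
      0<#U = <-≤-trans (*-monoʳ-<-pos (+ 96) 0<K) large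

      few : FewNon U
      few = few-sub {Vs} {R} {U} perm few-Vs

      pick-triple : ∀ z (X : List V) → 0ℤ < # X → Triple z X U
      pick-triple z X 0<X =
        let a , b , c , a∈ , b∈ , c∈ , mz , most = pick U (λ v _ → near v) few large 0<#U near z X 0<X
            _ , p = split-triple mz a∈ b∈ c∈
        in triple p mz most

    extend : ∀ {R U : List V} (S : List V) {U′} → Vs ↭ R ++ U → U ↭ S ++ U′ → Vs ↭ (S ++ R) ++ U′
    extend {R} S {U′} p q = ↭-trans p (↭-trans (++⁺ˡ R q) (↭-trans (shifts R S) (↭-reflexive (sym (++-assoc S R U′)))))

    mates : V → V → V → List V → ℤ
    mates a b c U = ∑ U (λ v → χ (mixed v a b c))

    χ≤1 : ∀ p → χ p ≤ 1ℤ
    χ≤1 true = ≤-refl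
    χ≤1 false = nat≥0 1

    ∑χ≤# : ∀ (p : V → Bool) xs → ∑ xs (χ ∘ p) ≤ # xs
    ∑χ≤# p xs = ≤-trans (∑-mono xs (λ v _ → χ≤1 (p v))) (≤-reflexive (sym (#≡∑ xs)))

    mates-sub : ∀ a b c {U} S {U′} → U ↭ S ++ U′ → mates a b c U ≤ # S + mates a b c U′
    mates-sub a b c S {U′} p = ≤-trans (≤-reflexive (trans (∑-↭ p _) (∑-++ S U′ _)))
      (+-monoˡ-≤ (mates a b c U′) (∑χ≤# (λ v → mixed v a b c) S))

    #-split : ∀ (p : V → Bool) xs → # (filterᵇ p xs) + # (filterᵇ (not ∘ p) xs) ≡ # xs
    #-split p xs = trans (cong₂ _+_ (#-filter p xs) (#-filter (not ∘ p) xs)) (trans (sym (∑-+ xs _ _))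
      (trans (∑-cong xs (λ v → lem (p v))) (sym (#≡∑ xs))))
      where
      lem : ∀ b → χ b + χ (not b) ≡ 1ℤ
      lem true = refl
      lem false = refl

    record Slot (a b c : V) (X U : List V) (bound : ℤ) : Set where
      constructor mkSlot
      field
        {used}  : List V
        {rest}  : List V
        split   : U ↭ used ++ rest
        tiled   : Tiled used
        absorbs : ∀ x → x ∈ X → Tiled (x ∷ a ∷ b ∷ c ∷ used)
        small   : # used ≤ bound

    -- A vertex x that is mixed to a′ b′ c′ enters by taking the place of z, which then joins the hub a b c.
    enlarge : ∀ {a b c z a′ b′ c′ X U U′ k} → mixed z a b c ≡ true → mixed z a′ b′ c′ ≡ true → U ↭ z ∷ a′ ∷ b′ ∷ c′ ∷ U′ →
      Slot a b c (filterᵇ (λ x → not (mixed x a′ b′ c′)) X) U′ ((+ 4) * + k) → Slot a b c X U ((+ 4) * + suc k)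
    enlarge {a} {b} {c} {z} {a′} {b′} {c′} {X} {k = k} mixed-z mz perm (mkSlot {Bs} split tiled absorbs small) = mkSlot
      (↭-trans perm (↭-prep z (↭-prep a′ (↭-prep b′ (↭-prep c′ split)))))
      (tile mz tiled ↭-refl)
      absorbs′
      (≤-trans (+-monoʳ-≤ (+ 4) small) (≤-reflexive (lem (+ k))))
      where
      lem : ∀ k → (+ 4) + (+ 4) * k ≡ (+ 4) * (1ℤ + k)
      lem = solve-∀
      absorbs′ : ∀ x → x ∈ X → Tiled (x ∷ a ∷ b ∷ c ∷ z ∷ a′ ∷ b′ ∷ c′ ∷ Bs)
      absorbs′ x x∈ with mixed x a′ b′ c′ in mx
      ... | true = tile mx (tile mixed-z tiled ↭-refl)
        (↭-prep x (↭-trans (shifts (a ∷ b ∷ c ∷ z ∷ []) (a′ ∷ b′ ∷ c′ ∷ []))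
          (↭-prep a′ (↭-prep b′ (↭-prep c′ (shift z (a ∷ b ∷ c ∷ []) Bs))))))
      ... | false = tile mz (absorbs x (∈-filterᵇ⁺ (λ x → not (mixed x a′ b′ c′)) X x∈ (cong not mx)))
        (shifts (x ∷ a ∷ b ∷ c ∷ []) (z ∷ a′ ∷ b′ ∷ c′ ∷ []))

    private
      0≤2^ : ∀ k → 0ℤ ≤ (+ 2) ^ k
      0≤2^ zero = nat≥0 1
      0≤2^ (suc k) = nat≥0 2 ⊠ 0≤2^ k

    cover-rest : ∀ k (p : V → Bool) X → # X ≤ (+ 3) * # (filterᵇ p X) → # X * (+ 2) ^ suc k < (+ 3) ^ suc k →
      # (filterᵇ (not ∘ p) X) * (+ 2) ^ k < (+ 3) ^ k
    cover-rest k p X most cover = *-cancelˡ-<-nonNeg (+ 3) (≤-<-trans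
      (gap⁻¹ ((+ 3) * (# X′ * (+ 2) ^ k)) (# X * ((+ 2) * (+ 2) ^ k)) (gap 3X′≤2X ⊠ 0≤2^ k) (lem (# X) (# X′) ((+ 2) ^ k))) cover)
      where
      X′ = filterᵇ (not ∘ p) X
      lem : ∀ x y t → x * ((+ 2) * t) - (+ 3) * (y * t) ≡ ((+ 2) * x - (+ 3) * y) * t
      lem = solve-∀
      3X′≤2X : (+ 3) * # X′ ≤ (+ 2) * # X
      3X′≤2X = subst (λ x → (+ 3) * # X′ ≤ (+ 2) * x) (#-split p X)
        (gap⁻¹ ((+ 3) * # X′) ((+ 2) * (# (filterᵇ p X) + # X′)) (gap (subst (_≤ (+ 3) * # (filterᵇ p X)) (sym (#-split p X)) most))
          (lem₁ (# (filterᵇ p X)) (# X′)))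
        where
        lem₁ : ∀ p q → (+ 2) * (p + q) - (+ 3) * q ≡ (+ 3) * p - (p + q)
        lem₁ = solve-∀

    Fill : ℕ → V → V → V → Set
    Fill k a b c = ∀ {R U} X → Vs ↭ R ++ U → # R + (+ 4) * + k ≤ ρ → (+ 4) * + k < mates a b c U →
      # X * (+ 2) ^ k < (+ 3) ^ k → Slot a b c X U ((+ 4) * + k)

    module Round {k a b c} (rec : Fill k a b c) {R U : List V} (X : List V) (perm : Vs ↭ R ++ U)
      (R≤ : # R + (+ 4) * + suc k ≤ ρ) (cand : (+ 4) * + suc k < mates a b c U)
      (cover : # X * (+ 2) ^ suc k < (+ 3) ^ suc k) (0<X : 0ℤ < # X) where

      R₁≤ : 1ℤ + # R ≤ ρ
      R₁≤ = ≤-trans (gap⁻¹ (1ℤ + # R) (# R + (+ 4) * (1ℤ + + k)) (nat≥0 3 ⊹ nat≥0 4 ⊠ nat≥0 k) (lem (# R) (+ k))) R≤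
        where
        lem : ∀ r k → r + (+ 4) * (1ℤ + k) - (1ℤ + r) ≡ (+ 3) + (+ 4) * k
        lem = solve-∀

      R₂≤ : (+ 4) + # R + (+ 4) * + k ≤ ρ
      R₂≤ = subst (_≤ ρ) (lem (# R) (+ k)) R≤
        where
        lem : ∀ r k → r + (+ 4) * (1ℤ + k) ≡ (+ 4) + r + (+ 4) * k
        lem = solve-∀

      candidates : ∀ m₂ → mates a b c U ≤ (+ 4) + m₂ → (+ 4) * + k < m₂
      candidates m₂ q = suc[i]≤j⇒i<j (gap⁻¹ (1ℤ + (+ 4) * + k) m₂ (gap (i<j⇒suc[i]≤j cand) ⊹ gap q) (lem (+ k) (mates a b c U) m₂))
        where
        lem : ∀ k m m₂ → m₂ - (1ℤ + (+ 4) * k) ≡ m - (1ℤ + (+ 4) * (1ℤ + k)) + ((+ 4) + m₂ - m)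
        lem = solve-∀

      χ-true : ∀ {p} → 0ℤ < χ p → p ≡ true
      χ-true {true} _ = refl
      χ-true {false} (+<+ ())

      with-triple : ∀ {z a′ b′ c′ U₂} → mixed z a b c ≡ true → U ↭ z ∷ a′ ∷ b′ ∷ c′ ∷ U₂ → mixed z a′ b′ c′ ≡ true →
        # X ≤ (+ 3) * # (filterᵇ (λ x → mixed x a′ b′ c′) X) → Slot a b c X U ((+ 4) * + suc k)
      with-triple {z} {a′} {b′} {c′} {U₂} mz p mz′ most = enlarge {k = k} mz mz′ p
        (rec {z ∷ a′ ∷ b′ ∷ c′ ∷ R} {U₂} (filterᵇ (λ x → not (mixed x a′ b′ c′)) X) (extend (z ∷ a′ ∷ b′ ∷ c′ ∷ []) perm p) R₂≤
          (candidates (mates a b c U₂) (mates-sub a b c {U} (z ∷ a′ ∷ b′ ∷ c′ ∷ []) {U₂} p))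
          (cover-rest k (λ x → mixed x a′ b′ c′) X most cover))

      with-z : ∀ {z U₁} → mixed z a b c ≡ true → U ↭ z ∷ U₁ → Slot a b c X U ((+ 4) * + suc k)
      with-z {z} {U₁} mz p₁ = finish (Available.pick-triple {z ∷ R} {U₁} (extend (z ∷ []) perm p₁) R₁≤ z X 0<X)
        where
        finish : Triple z X U₁ → Slot a b c X U ((+ 4) * + suc k)
        finish (triple p₂ mz′ most) = with-triple mz (↭-trans p₁ (↭-prep z p₂)) mz′ most

      round : Slot a b c X U ((+ 4) * + suc k)
      round = finish (∑-pos U (λ v → χ (mixed v a b c)) (≤-<-trans (nat≥0 4 ⊠ nat≥0 (suc k)) cand))
        where
        finish : (∃ λ z → z ∈ U × 0ℤ < χ (mixed z a b c)) → Slot a b c X U ((+ 4) * + suc k)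
        finish (z , z∈ , pos) = with-z (χ-true pos) (proj₂ (split-∈ z∈))

    fill : ∀ k a b c → Fill k a b c
    fill k a b c [] perm R≤ cand cover = mkSlot ↭-refl [] (λ _ ()) (nat≥0 4 ⊠ nat≥0 k)
    fill zero a b c (_ ∷ X) perm R≤ cand (+<+ (ℕ.s≤s ()))
    fill (suc k) a b c {R} {U} X@(_ ∷ _) perm R≤ cand cover =
      Round.round {k} (fill k a b c) {R} {U} X perm R≤ cand cover (+<+ (ℕ.s≤s ℕ.z≤n))

    record Universal (y : V) (U : List V) : Set where
      constructor mkUniversal
      field
        {used}  : List V
        {rest}  : List V
        split   : U ↭ used ++ rest
        tiled   : Tiled (y ∷ used)
        absorbs : ∀ x → Tiled (x ∷ used)
        small   : # used ≤ (+ 4) * + h + (+ 3)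

    universal : ∀ y {R U} → Vs ↭ R ++ U → # R + ((+ 4) * + h + (+ 3)) ≤ ρ → Universal y U
    universal y {R} {U} perm R≤ = with-hub (Available.pick-triple {R} {U} perm R≤′ y U (Available.0<#U {R} {U} perm R≤′))
      where
      R≤′ : # R ≤ ρ
      R≤′ = ≤-trans (gap⁻¹ (# R) (# R + ((+ 4) * + h + (+ 3))) (nat≥0 4 ⊠ nat≥0 h ⊹ nat≥0 3) (lem (# R) (+ h))) R≤
        where
        lem : ∀ r k → r + ((+ 4) * k + (+ 3)) - r ≡ (+ 4) * k + (+ 3)
        lem = solve-∀
      R₁≤ : (+ 3) + # R + (+ 4) * + h ≤ ρ
      R₁≤ = subst (_≤ ρ) (lem (# R) (+ h)) R≤
        where
        lem : ∀ r k → r + ((+ 4) * k + (+ 3)) ≡ (+ 3) + r + (+ 4) * k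
        lem = solve-∀
      #Vs : # Vs ≡ # R + # U
      #Vs = trans (cong +_ (↭-length perm)) (#-++ R U)
      candidates : ∀ m m₁ → # U ≤ (+ 3) * m → m ≤ (+ 3) + m₁ → (+ 4) * + h < m₁
      candidates m m₁ p q = *-cancelˡ-<-nonNeg (+ 3) (suc[i]≤j⇒i<j (gap⁻¹ (1ℤ + (+ 3) * ((+ 4) * + h)) ((+ 3) * m₁)
        (gap h-small′ ⊹ gap R≤ ⊹ nat≥0 4 ⊠ nat≥0 h ⊹ nat≥0 3 ⊹ gap p ⊹ nat≥0 3 ⊠ gap q)
        (lem₁ (+ h) m m₁ (# U) (# R) ρ)))
        where
        h-small′ : 1ℤ + ((+ 12) * + h + (+ 9) + ρ) ≤ # R + # U
        h-small′ = subst (1ℤ + ((+ 12) * + h + (+ 9) + ρ) ≤_) #Vs (i<j⇒suc[i]≤j h-small)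
        lem₁ : ∀ h m m₁ u r ρ → (+ 3) * m₁ - (1ℤ + (+ 3) * ((+ 4) * h)) ≡
          r + u - (1ℤ + ((+ 12) * h + (+ 9) + ρ)) + (ρ - (r + ((+ 4) * h + (+ 3)))) + (+ 4) * h + (+ 3)
          + ((+ 3) * m - u) + (+ 3) * ((+ 3) + m₁ - m)
        lem₁ = solve-∀
      finish : ∀ {a b c U₁} → mixed y a b c ≡ true → U ↭ a ∷ b ∷ c ∷ U₁ → Slot a b c Vs U₁ ((+ 4) * + h) → Universal y U
      finish {a} {b} {c} my p₁ (mkSlot split tiled absorbs small) = mkUniversal
        (↭-trans p₁ (↭-prep a (↭-prep b (↭-prep c split))))
        (tile my tiled ↭-refl)
        (λ x → absorbs x (complete x))
        (≤-trans (+-monoʳ-≤ (+ 3) small) (≤-reflexive (+-comm (+ 3) ((+ 4) * + h))))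
      with-hub : Triple y U U → Universal y U
      with-hub (triple {a} {b} {c} {U₁} p₁ my most) = finish my p₁
        (fill h a b c {a ∷ b ∷ c ∷ R} {U₁} Vs (extend (a ∷ b ∷ c ∷ []) perm p₁) R₁≤
          (candidates (mates a b c U) (mates a b c U₁) (subst (λ r → # U ≤ (+ 3) * r) (#-filter (λ v → mixed v a b c) U) most)
            (mates-sub a b c {U} (a ∷ b ∷ c ∷ []) {U₁} p₁))
          h-large)

    σ : ℤ
    σ = (+ 4) * + h + (+ 3)

    0≤σ : 0ℤ ≤ σ
    0≤σ = nat≥0 4 ⊠ nat≥0 h ⊹ nat≥0 3

    record Slots (ys U : List V) : Set where
      constructor mkSlots
      field
        {used}  : List V
        {rest}  : List V
        split   : U ↭ used ++ rest
        absorbs : ∀ xs → length xs ≡ length ys → Tiled (xs ++ used)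
        tiled   : Tiled (ys ++ used)
        small   : # used ≤ # ys * σ

    join : ∀ {y ys U} (u : Universal y U) → Slots ys (Universal.rest u) → Slots (y ∷ ys) U
    join {y} {ys} (mkUniversal {A} split₁ tiled₁ absorbs₁ small₁) (mkSlots {A′} split₂ absorbs₂ tiled₂ small₂) = mkSlots
      (↭-trans split₁ (↭-trans (++⁺ˡ A split₂) (↭-reflexive (sym (++-assoc A A′ _)))))
      (λ { (x ∷ xs) eq → Tiled-↭ (↭-prep x (shifts A xs)) (Tiled-++ (absorbs₁ x) (absorbs₂ xs (ℕ.suc-injective eq))) })
      (Tiled-↭ (↭-prep y (shifts A ys)) (Tiled-++ tiled₁ tiled₂))
      (≤-trans (≤-reflexive (#-++ A A′)) (≤-trans (+-mono-≤ small₁ small₂) (≤-reflexive (lem (# ys) σ))))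
      where
      lem : ∀ m σ → σ + m * σ ≡ (1ℤ + m) * σ
      lem = solve-∀

    slots : ∀ ys {R U} → Vs ↭ R ++ U → # R + # ys * σ ≤ ρ → Slots ys U
    slots [] perm R≤ = mkSlots ↭-refl (λ { [] _ → [] }) [] ≤-refl
    slots (y ∷ ys) {R} {U} perm R≤ = join u (slots ys (extend (Universal.used u) perm (Universal.split u)) R′≤)
      where
      lem : ∀ r m σ → r + (1ℤ + m) * σ - (r + σ) ≡ m * σ
      lem = solve-∀
      u : Universal y U
      u = universal y perm (≤-trans (gap⁻¹ (# R + σ) (# R + (1ℤ + # ys) * σ) (nat≥0 (length ys) ⊠ 0≤σ) (lem (# R) (# ys) σ)) R≤)
      S = Universal.used u
      lem₁ : ∀ a r m σ → r + (1ℤ + m) * σ - (a + r + m * σ) ≡ σ - a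
      lem₁ = solve-∀
      R′≤ : # (S ++ R) + # ys * σ ≤ ρ
      R′≤ = subst (λ r → r + # ys * σ ≤ ρ) (sym (#-++ S R)) (≤-trans
        (gap⁻¹ (# S + # R + # ys * σ) (# R + (1ℤ + # ys) * σ) (gap (Universal.small u)) (lem₁ (# S) (# R) (# ys) σ)) R≤)

    record Tiles (m : ℕ) (U : List V) : Set where
      constructor mkTiles
      field
        {used}  : List V
        {rest}  : List V
        split   : U ↭ used ++ rest
        count   : length used ≡ m ℕ.* 4
        prefix  : ∀ j → j ℕ.≤ m → ∃ λ us → ∃ λ vs → used ≡ us ++ vs × length us ≡ j ℕ.* 4 × Tiled us

    tiles : ∀ m {R U} → Vs ↭ R ++ U → # R + + (m ℕ.* 4) ≤ ρ → Tiles m U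
    tiles zero perm R≤ = mkTiles ↭-refl refl (λ { zero _ → [] , [] , refl , refl , [] })
    tiles (suc m) {R} {U} perm R≤ = with-y (∑-pos U (λ _ → 1ℤ) (subst (0ℤ <_) (#≡∑ U) (Available.0<#U {R} {U} perm R≤′)))
      where
      R≤′ : # R ≤ ρ
      R≤′ = ≤-trans (i≤i+j (# R) (+ (suc m ℕ.* 4))) R≤
      R₀≤ : 1ℤ + # R ≤ ρ
      R₀≤ = ≤-trans (gap⁻¹ (1ℤ + # R) (# R + ((+ 4) + + (m ℕ.* 4))) (nat≥0 3 ⊹ nat≥0 (m ℕ.* 4)) (lem (# R) (+ (m ℕ.* 4)))) R≤
        where
        lem : ∀ r k → r + ((+ 4) + k) - (1ℤ + r) ≡ (+ 3) + k
        lem = solve-∀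
      R₁≤ : (+ 4) + # R + + (m ℕ.* 4) ≤ ρ
      R₁≤ = subst (_≤ ρ) (lem (# R) (+ (m ℕ.* 4))) R≤
        where
        lem : ∀ r k → r + ((+ 4) + k) ≡ (+ 4) + r + k
        lem = solve-∀
      add : ∀ {y a b c U₁} → mixed y a b c ≡ true → U ↭ y ∷ a ∷ b ∷ c ∷ U₁ → Tiles m U₁ → Tiles (suc m) U
      add {y} {a} {b} {c} my p (mkTiles {ys} split count prefix) = mkTiles
        (↭-trans p (↭-prep y (↭-prep a (↭-prep b (↭-prep c split)))))
        (cong (4 ℕ.+_) count)
        λ { zero _ → [] , _ , refl , refl , []
          ; (suc j) (ℕ.s≤s j≤m) → let us , vs , eq , len , t = prefix j j≤m in
              y ∷ a ∷ b ∷ c ∷ us , vs , cong (λ zs → y ∷ a ∷ b ∷ c ∷ zs) eq , cong (4 ℕ.+_) len , tile my t ↭-refl }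
      with-triple : ∀ {y U₀} → U ↭ y ∷ U₀ → Triple y (y ∷ []) U₀ → Tiles (suc m) U
      with-triple {y} p₀ (triple {a} {b} {c} {U₁} p₁ my _) = add my p (tiles m {y ∷ a ∷ b ∷ c ∷ R} {U₁} (extend (y ∷ a ∷ b ∷ c ∷ []) perm p) R₁≤)
        where
        p : U ↭ y ∷ a ∷ b ∷ c ∷ U₁
        p = ↭-trans p₀ (↭-prep y p₁)
      with-y : (∃ λ y → y ∈ U × 0ℤ < 1ℤ) → Tiles (suc m) U
      with-y (y , y∈ , _) = with-triple p₀ (Available.pick-triple {y ∷ R} (extend (y ∷ []) perm p₀) R₀≤ y (y ∷ []) (+<+ (ℕ.s≤s ℕ.z≤n)))
        where p₀ = proj₂ (split-∈ y∈)

    record Absorber (m : ℕ) : Set where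
      constructor mkAbsorber
      field
        {used}  : List V
        {rest}  : List V
        split   : Vs ↭ used ++ rest
        tiled   : Tiled used
        absorbs : ∀ j → j ℕ.≤ m → ∀ L → length L ≡ j ℕ.* 4 → Tiled (L ++ used)
        small   : # used ≤ + (m ℕ.* 4) * (1ℤ + σ)

    absorber : ∀ m → + (m ℕ.* 4) * (1ℤ + σ) ≤ ρ → Absorber m
    absorber m m≤ = assemble (slots ys split₁ (subst (_≤ ρ) total m≤))
      where
      lem : ∀ m σ → m * (1ℤ + σ) - (0ℤ + m) ≡ m * σ
      lem = solve-∀
      open Tiles (tiles m {[]} ↭-refl (≤-trans (gap⁻¹ (0ℤ + + (m ℕ.* 4)) (+ (m ℕ.* 4) * (1ℤ + σ)) (nat≥0 (m ℕ.* 4) ⊠ 0≤σ) (lem (+ (m ℕ.* 4)) σ)) m≤))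
        renaming (used to ys; split to split₁)
      lem₁ : ∀ m σ → m * (1ℤ + σ) ≡ m + m * σ
      lem₁ = solve-∀
      total : + (m ℕ.* 4) * (1ℤ + σ) ≡ # ys + # ys * σ
      total = trans (cong (λ k → + k * (1ℤ + σ)) (sym count)) (lem₁ (# ys) σ)
      assemble : Slots ys _ → Absorber m
      assemble (mkSlots {A} {rest} split₂ absorbs tiled small) = mkAbsorber
        (↭-trans split₁ (↭-trans (++⁺ˡ ys split₂) (↭-reflexive (sym (++-assoc ys A rest)))))
        tiled
        absorbs′
        (≤-trans (≤-reflexive (#-++ ys A)) (≤-trans (+-monoʳ-≤ (# ys) small) (≤-reflexive (sym total))))
        where
        absorbs′ : ∀ j → j ℕ.≤ m → ∀ L → length L ≡ j ℕ.* 4 → Tiled (L ++ (ys ++ A))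
        absorbs′ j j≤m L len =
          let us , vs , eq , len-us , t = prefix j j≤m
          in subst (λ zs → Tiled (L ++ (zs ++ A))) (sym eq) (Tiled-↭
            (↭-trans (++⁺ˡ us (↭-reflexive (++-assoc L vs A))) (↭-trans (shifts us L)
              (++⁺ˡ L (↭-reflexive (sym (++-assoc us vs A))))))
            (Tiled-++ t (absorbs (L ++ vs) (trans (length-++ L) (trans (cong (ℕ._+ length vs) (trans len (sym len-us)))
              (trans (sym (length-++ us)) (cong length (sym eq))))))))

-- Oriented graphs and copies of D₁₁₂

Unique-↭ : ∀ {A : Set} {us vs : List A} → us ↭ vs → Unique us → Unique vs
Unique-↭ Perm.refl u = u
Unique-↭ (Perm.prep x p) (x∉ ∷ u) = All-resp-↭ p x∉ ∷ Unique-↭ p u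
Unique-↭ (Perm.swap x y p) ((x≢y ∷ x∉) ∷ (y∉ ∷ u)) =
  (x≢y ∘ sym ∷ All-resp-↭ p y∉) ∷ (All-resp-↭ p x∉ ∷ Unique-↭ p u)
Unique-↭ (Perm.trans p q) u = Unique-↭ q (Unique-↭ p u)

module FromGraph {n : ℕ} (G : OrientedGraph n) where

  arc : Fin n → Fin n → Arc
  arc u v = if adj G u v then out else if adj G v u then inn else non

  arc-flip : ∀ u v → arc v u ≡ flip (arc u v)
  arc-flip u v with adj G u v in uv | adj G v u in vu
  ... | true | true with () ← trans (sym vu) (oriented G u v uv)
  ... | true | false = refl
  ... | false | true = refl
  ... | false | false = refl

  out⇒adj : ∀ {u v} → arc u v ≡ out → adj G u v ≡ true
  out⇒adj {u} {v} h with adj G u v | adj G v u | h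
  ... | true | _ | _ = refl
  ... | false | true | ()
  ... | false | false | ()

  inn⇒adj : ∀ {u v} → arc u v ≡ inn → adj G v u ≡ true
  inn⇒adj {u} {v} h with adj G u v | adj G v u | h
  ... | false | true | _ = refl
  ... | true | _ | ()
  ... | false | false | ()

  quad : Fin n → Fin n → Fin n → Fin n → Fin 4 → Fin n
  quad p q r w zero = p
  quad p q r w (suc zero) = q
  quad p q r w (suc (suc zero)) = r
  quad p q r w (suc (suc (suc zero))) = w

  comparable : ∀ x y → x ≡ y ⊎ (adj D112 x y ≡ true ⊎ adj D112 y x ≡ true)
  comparable zero zero = inj₁ refl
  comparable zero (suc zero) = inj₂ (inj₁ refl)
  comparable zero (suc (suc zero)) = inj₂ (inj₂ refl)
  comparable zero (suc (suc (suc zero))) = inj₂ (inj₂ refl)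
  comparable (suc zero) zero = inj₂ (inj₂ refl)
  comparable (suc zero) (suc zero) = inj₁ refl
  comparable (suc zero) (suc (suc zero)) = inj₂ (inj₁ refl)
  comparable (suc zero) (suc (suc (suc zero))) = inj₂ (inj₁ refl)
  comparable (suc (suc zero)) zero = inj₂ (inj₁ refl)
  comparable (suc (suc zero)) (suc zero) = inj₂ (inj₂ refl)
  comparable (suc (suc zero)) (suc (suc zero)) = inj₁ refl
  comparable (suc (suc zero)) (suc (suc (suc zero))) = inj₂ (inj₁ refl)
  comparable (suc (suc (suc zero))) zero = inj₂ (inj₁ refl)
  comparable (suc (suc (suc zero))) (suc zero) = inj₂ (inj₂ refl)
  comparable (suc (suc (suc zero))) (suc (suc zero)) = inj₂ (inj₂ refl)
  comparable (suc (suc (suc zero))) (suc (suc (suc zero))) = inj₁ refl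

  quad-copy : ∀ {p q r w} → adj G p q ≡ true → adj G q r ≡ true → adj G q w ≡ true →
    adj G r p ≡ true → adj G w p ≡ true → adj G r w ≡ true → IsCopy D112 G (quad p q r w)
  quad-copy {p} {q} {r} {w} pq qr qw rp wp rw = injective , arcs
    where
    arcs : ∀ x y → adj D112 x y ≡ true → adj G (quad p q r w x) (quad p q r w y) ≡ true
    arcs zero (suc zero) _ = pq
    arcs (suc zero) (suc (suc zero)) _ = qr
    arcs (suc zero) (suc (suc (suc zero))) _ = qw
    arcs (suc (suc zero)) zero _ = rp
    arcs (suc (suc (suc zero))) zero _ = wp
    arcs (suc (suc zero)) (suc (suc (suc zero))) _ = rw
    loop : ∀ {u v} → u ≡ v → adj G u v ≡ true → ⊥
    loop {u} refl h with () ← trans (sym h) (loopless G u)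
    injective : ∀ x y → quad p q r w x ≡ quad p q r w y → x ≡ y
    injective x y eq with comparable x y
    ... | inj₁ x≡y = x≡y
    ... | inj₂ (inj₁ xy) = ⊥-elim (loop eq (arcs x y xy))
    ... | inj₂ (inj₂ yx) = ⊥-elim (loop (sym eq) (arcs y x yx))

  record Copy (vs : List (Fin n)) : Set where
    constructor mkCopy
    field
      {p q r w} : Fin n
      copy : IsCopy D112 G (quad p q r w)
      perm : vs ↭ p ∷ q ∷ r ∷ w ∷ []

  module _ (K : ℤ) (K-large : + 1219 ≤ (+ 3) * K) where
    open Tilings arc arc-flip K K-large

    private
      -- For a → x → b with a → b → c → a, the remaining arc x c decides which vertices play a, b, c₁, c₂.
      copy-at : ∀ {x a b c} → arc a b ≡ out → arc b c ≡ out → arc c a ≡ out → arc x a ≡ inn → arc x b ≡ out →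
        arc x c ≡ inn ⊎ arc x c ≡ out → Copy (x ∷ a ∷ b ∷ c ∷ [])
      copy-at {x} {a} {b} {c} ab bc ca xa xb (inj₁ xc) = mkCopy
        (quad-copy (out⇒adj bc) (out⇒adj ca) (inn⇒adj xc) (out⇒adj ab) (out⇒adj xb) (inn⇒adj xa))
        (↭-trans (∷↭∷ʳ x (a ∷ b ∷ c ∷ [])) (↭-trans (∷↭∷ʳ a (b ∷ c ∷ x ∷ [])) (↭-prep b (↭-prep c (↭-swap x a ↭-refl)))))
      copy-at {x} {a} {b} {c} ab bc ca xa xb (inj₂ xc) = mkCopy
        (quad-copy (out⇒adj ca) (inn⇒adj xa) (out⇒adj ab) (out⇒adj xc) (out⇒adj bc) (out⇒adj xb))
        (↭-sym (↭-trans (↭-swap c a ↭-refl) (↭-trans (↭-prep a (↭-swap c x ↭-refl)) (↭-trans (↭-swap a x ↭-refl) (↭-prep x (↭-prep a (↭-swap c b ↭-refl)))))))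

      rotate : ∀ {x a b c : Fin n} → x ∷ a ∷ b ∷ c ∷ [] ↭ x ∷ b ∷ c ∷ a ∷ []
      rotate {x} {a} {b} {c} = ↭-prep x (↭-trans (↭-swap a b ↭-refl) (↭-prep b (↭-swap a c ↭-refl)))

      recast : ∀ {us vs} → us ↭ vs → Copy vs → Copy us
      recast p (mkCopy c q) = mkCopy c (↭-trans p q)

    mixed-copy : ∀ {x a b c} → mixed x a b c ≡ true → Copy (x ∷ a ∷ b ∷ c ∷ [])
    mixed-copy {x} {a} {b} {c} m with ∧-split (allOut (arc a b) (arc b c) (arc c a)) m
    ... | m₁ , m₂ with allOut⇒ {arc a b} m₁
    ... | ab , bc , ca with arc x a in xa | arc x b in xb | arc x c in xc | m₂
    ... | inn | out | inn | _ = copy-at ab bc ca xa xb (inj₁ xc)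
    ... | inn | out | out | _ = copy-at ab bc ca xa xb (inj₂ xc)
    ... | inn | inn | out | _ = recast rotate (copy-at bc ca ab xb xc (inj₁ xa))
    ... | out | inn | out | _ = recast rotate (copy-at bc ca ab xb xc (inj₂ xa))
    ... | out | inn | inn | _ = recast (↭-trans rotate rotate) (copy-at ca ab bc xc xa (inj₁ xb))
    ... | out | out | inn | _ = recast (↭-trans rotate rotate) (copy-at ca ab bc xc xa (inj₂ xb))

    record Packing (vs : List (Fin n)) : Set where
      constructor packing
      field
        {k}      : ℕ
        f        : Fin k → Fin 4 → Fin n
        copies   : ∀ i → IsCopy D112 G (f i)
        disjoint : ∀ i j x y → f i x ≡ f j y → i ≡ j
        inside   : ∀ i x → f i x ∈ vs
        covers   : ∀ v → v ∈ vs → ∃ λ i → ∃ λ x → f i x ≡ v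

    quad-∈ : ∀ {p q r w} x → quad p q r w x ∈ p ∷ q ∷ r ∷ w ∷ []
    quad-∈ zero = here refl
    quad-∈ (suc zero) = there (here refl)
    quad-∈ (suc (suc zero)) = there (there (here refl))
    quad-∈ (suc (suc (suc zero))) = there (there (there (here refl)))

    ∈-quad : ∀ {p q r w v} us → v ∈ p ∷ q ∷ r ∷ w ∷ us → (∃ λ x → quad p q r w x ≡ v) ⊎ v ∈ us
    ∈-quad us (here refl) = inj₁ (zero , refl)
    ∈-quad us (there (here refl)) = inj₁ (suc zero , refl)
    ∈-quad us (there (there (here refl))) = inj₁ (suc (suc zero) , refl)
    ∈-quad us (there (there (there (here refl)))) = inj₁ (suc (suc (suc zero)) , refl)
    ∈-quad us (there (there (there (there v∈)))) = inj₂ v∈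

    private
      separate : ∀ (us : List (Fin n)) {vs v} → Unique (us ++ vs) → v ∈ us → v ∈ vs → ⊥
      separate (u ∷ us) (u∉ ∷ _) (here refl) v∈vs = All.lookup u∉ (∈-++⁺ʳ us v∈vs) refl
      separate (u ∷ us) (_ ∷ uq) (there v∈us) v∈vs = separate us uq v∈us v∈vs

    add-copy : ∀ {p q r w us vs} → vs ↭ p ∷ q ∷ r ∷ w ∷ us → Unique (p ∷ q ∷ r ∷ w ∷ us) →
      IsCopy D112 G (quad p q r w) → Packing us → Packing vs
    add-copy {p} {q} {r} {w} {us} {vs} perm uq c (packing {k} f copies disjoint inside covers) =
      packing f′ copies′ disjoint′ inside′ covers′
      where
      f′ : Fin (suc k) → Fin 4 → Fin n
      f′ zero = quad p q r w
      f′ (suc i) = f i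
      copies′ : ∀ i → IsCopy D112 G (f′ i)
      copies′ zero = c
      copies′ (suc i) = copies i
      apart : ∀ x i y → quad p q r w x ≡ f i y → ⊥
      apart x i y eq = separate (p ∷ q ∷ r ∷ w ∷ []) uq (quad-∈ x) (subst (_∈ us) (sym eq) (inside i y))
      disjoint′ : ∀ i j x y → f′ i x ≡ f′ j y → i ≡ j
      disjoint′ zero zero _ _ _ = refl
      disjoint′ zero (suc j) x y eq = ⊥-elim (apart x j y eq)
      disjoint′ (suc i) zero x y eq = ⊥-elim (apart y i x (sym eq))
      disjoint′ (suc i) (suc j) x y eq = cong suc (disjoint i j x y eq)
      inside′ : ∀ i x → f′ i x ∈ vs
      inside′ zero x = ∈-resp-↭ (↭-sym perm) (∈-++⁺ˡ (quad-∈ x))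
      inside′ (suc i) x = ∈-resp-↭ (↭-sym perm) (there (there (there (there (inside i x)))))
      covers′ : ∀ v → v ∈ vs → ∃ λ i → ∃ λ x → f′ i x ≡ v
      covers′ v v∈ with ∈-quad us (∈-resp-↭ perm v∈)
      ... | inj₁ (x , eq) = zero , x , eq
      ... | inj₂ v∈us with covers v v∈us
      ... | i , x , eq = suc i , x , eq

    private
      drop-unique : ∀ (us : List (Fin n)) {vs} → Unique (us ++ vs) → Unique vs
      drop-unique [] uq = uq
      drop-unique (_ ∷ us) (_ ∷ uq) = drop-unique us uq

    tiled⇒packing : ∀ {vs} → Tiled vs → Unique vs → Packing vs
    tiled⇒packing [] _ = packing {k = 0} (λ ()) (λ ()) (λ ()) (λ ()) (λ v ())
    tiled⇒packing (tile {us = us} m t perm) uq with mixed-copy m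
    ... | mkCopy {p} {q} {r} {w} c perm′ = add-copy whole (Unique-↭ whole uq) c
        (tiled⇒packing t (drop-unique (p ∷ q ∷ r ∷ w ∷ []) (Unique-↭ whole uq)))
      where
      whole = ↭-trans perm (++⁺ʳ us perm′)

    tiled⇒perfect : Tiled (allFin n) → PerfectTiling D112 G
    tiled⇒perfect t with tiled⇒packing t (allFin⁺ n)
    ... | packing f copies disjoint _ covers = _ , f , copies , disjoint , λ v → covers v (∈-allFin v)

  -- For even n the definition allows pairs of vertices that are not joined, but at most one such pair at each vertex.
  module _ (semi : SemiRegularTournament G) where
    open Arcs arc arc-flip

    private
      Vs = allFin n
      k = (n ℕ.∸ 1) / 2
      outs inns nons : Fin n → ℤ
      outs v = ∑ Vs (λ u → χ (isOut (arc v u)))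
      inns v = ∑ Vs (λ u → χ (isInn (arc v u)))
      nons v = ∑ Vs (zr v)

      sum≡∑ : ∀ (f : Fin n → Bool) (xs : List (Fin n)) → + sum (map (λ u → if f u then 1 else 0) xs) ≡ ∑ xs (χ ∘ f)
      sum≡∑ f [] = refl
      sum≡∑ f (x ∷ xs) = trans (pos-+ (if f x then 1 else 0) _) (cong₂ _+_ (lem (f x)) (sum≡∑ f xs))
        where
        lem : ∀ b → + (if b then 1 else 0) ≡ χ b
        lem true = refl
        lem false = refl

      isOut-arc : ∀ v u → adj G v u ≡ isOut (arc v u)
      isOut-arc v u with adj G v u | adj G u v
      ... | true | _ = refl
      ... | false | true = refl
      ... | false | false = refl

      isInn-arc : ∀ v u → adj G u v ≡ isInn (arc v u)
      isInn-arc v u with adj G v u in vu | adj G u v in uv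
      ... | true | true with () ← trans (sym uv) (oriented G v u vu)
      ... | true | false = refl
      ... | false | true = refl
      ... | false | false = refl

      k≤outs : ∀ v → + k ≤ outs v
      k≤outs v = subst (+ k ≤_) (trans (sum≡∑ (adj G v) Vs) (∑-cong Vs (λ u → cong χ (isOut-arc v u))))
        (+≤+ (proj₁ (proj₁ semi v)))

      k≤inns : ∀ v → + k ≤ inns v
      k≤inns v = subst (+ k ≤_) (trans (sum≡∑ (λ u → adj G u v) Vs) (∑-cong Vs (λ u → cong χ (isInn-arc v u))))
        (+≤+ (proj₂ (proj₁ semi v)))

      total : ∀ v → outs v + inns v + nons v ≡ + n
      total v = trans (sym (trans (∑-+ Vs _ _) (cong (_+ nons v) (∑-+ Vs _ _))))
        (trans (∑-cong Vs (λ u → lem (arc v u))) (trans (sym (#≡∑ Vs)) (cong +_ (length-tabulate _))))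
        where
        lem : ∀ e → χ (isOut e) + χ (isInn e) + χ (isNon e) ≡ 1ℤ
        lem out = refl
        lem inn = refl
        lem non = refl

      arc-self : ∀ v → arc v v ≡ non
      arc-self v rewrite loopless G v = refl

      1≤nons : ∀ v → 1ℤ ≤ nons v
      1≤nons v with split-∈ (∈-allFin v)
      ... | U′ , perm = subst (1ℤ ≤_) (sym (∑-↭ perm (zr v)))
        (≤-trans (+-monoʳ-≤ 1ℤ (∑-nonneg U′ (λ u _ → zr≥0 v u)))
          (≤-reflexive (cong (λ e → χ (isNon e) + ∑ U′ (zr v)) (sym (arc-self v)))))

      n≤2k+2 : + n ≤ (+ 2) * + k + (+ 2)
      n≤2k+2 = subst (+ n ≤_) (trans (pos-+ (2 ℕ.* k) 2) (cong (_+ (+ 2)) (pos-* 2 k))) (+≤+ (bound n))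
        where
        bound : ∀ n → n ℕ.≤ 2 ℕ.* ((n ℕ.∸ 1) / 2) ℕ.+ 2
        bound zero = ℕ.z≤n
        bound (suc m) = begin
          suc m ≡⟨ cong suc (m≡m%n+[m/n]*n m 2) ⟩
          suc (m % 2 ℕ.+ (m / 2) ℕ.* 2) ≤⟨ ℕ.+-monoˡ-≤ ((m / 2) ℕ.* 2) (m%n<n m 2) ⟩
          2 ℕ.+ (m / 2) ℕ.* 2 ≡⟨ trans (ℕ.+-comm 2 _) (cong (ℕ._+ 2) (ℕ.*-comm (m / 2) 2)) ⟩
          2 ℕ.* (m / 2) ℕ.+ 2 ∎
          where open ℕ.≤-Reasoning

    few-non : FewNon Vs
    few-non v = gap⁻¹ _ _ (gap (k≤outs v) ⊹ gap (k≤inns v) ⊹ gap n≤2k+2)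
      (trans (lem (outs v) (inns v) (nons v) (+ k)) (cong (λ m → outs v - + k + (inns v - + k) + ((+ 2) * + k + (+ 2) - m)) (total v)))
      where
      lem : ∀ o i z k → (+ 2) - z ≡ o - k + (i - k) + ((+ 2) * k + (+ 2) - (o + i + z))
      lem = solve-∀

    near-regular : ∀ v → ab (deg Vs v) ≤ 1ℤ
    near-regular v = ab≤ upper lower
      where
      deg≡ : deg Vs v ≡ outs v - inns v
      deg≡ = trans (∑-cong Vs (λ u → lem (arc v u))) (∑-- Vs _ _)
        where
        lem : ∀ e → val e ≡ χ (isOut e) - χ (isInn e)
        lem out = refl
        lem inn = refl
        lem non = refl
      n≤ : outs v + inns v + nons v ≤ (+ 2) * + k + (+ 2)
      n≤ = subst (_≤ (+ 2) * + k + (+ 2)) (sym (total v)) n≤2k+2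
      upper : deg Vs v ≤ 1ℤ
      upper = subst (_≤ 1ℤ) (sym deg≡) (gap⁻¹ (outs v - inns v) 1ℤ (gap n≤ ⊹ gap (1≤nons v) ⊹ nat≥0 2 ⊠ gap (k≤inns v)) (lem (outs v) (inns v) (nons v) (+ k)))
        where
        lem : ∀ o i z k → 1ℤ - (o - i) ≡ (+ 2) * k + (+ 2) - (o + i + z) + (z - 1ℤ) + (+ 2) * (i - k)
        lem = solve-∀
      lower : - deg Vs v ≤ 1ℤ
      lower = subst (λ d → - d ≤ 1ℤ) (sym deg≡) (gap⁻¹ (- (outs v - inns v)) 1ℤ (gap n≤ ⊹ gap (1≤nons v) ⊹ nat≥0 2 ⊠ gap (k≤outs v)) (lem (outs v) (inns v) (nons v) (+ k)))
        where
        lem : ∀ o i z k → 1ℤ - - (o - i) ≡ (+ 2) * k + (+ 2) - (o + i + z) + (z - 1ℤ) + (+ 2) * (o - k)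
        lem = solve-∀
      ab≤ : ∀ {i} → i ≤ 1ℤ → - i ≤ 1ℤ → ab i ≤ 1ℤ
      ab≤ {+ m} p q = p
      ab≤ { -[1+ m ]} p q = q

-- Choice of the parameters

2^6e≤3^4e : ∀ e → (+ 2) ^ e * (+ 2) ^ e * (+ 2) ^ (e ℕ.* 4) ≤ (+ 3) ^ (e ℕ.* 4)
2^6e≤3^4e zero = ≤-refl
2^6e≤3^4e (suc e) = gap⁻¹ _ _ (nat≥0 64 ⊠ gap (2^6e≤3^4e e) ⊹ nat≥0 17 ⊠ 0≤3^ (e ℕ.* 4)) (lem ((+ 2) ^ e) ((+ 2) ^ (e ℕ.* 4)) ((+ 3) ^ (e ℕ.* 4)))
  where
  0≤3^ : ∀ k → 0ℤ ≤ (+ 3) ^ k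
  0≤3^ zero = nat≥0 1
  0≤3^ (suc k) = nat≥0 3 ⊠ 0≤3^ k
  lem : ∀ p x y → (+ 3) * ((+ 3) * ((+ 3) * ((+ 3) * y))) - (+ 2) * p * ((+ 2) * p) * ((+ 2) * ((+ 2) * ((+ 2) * ((+ 2) * x)))) ≡
    (+ 64) * (y - p * p * x) + (+ 17) * y
  lem = solve-∀

1≤2^ : ∀ k → 1ℤ ≤ (+ 2) ^ k
1≤2^ zero = ≤-refl
1≤2^ (suc k) = gap⁻¹ 1ℤ ((+ 2) * (+ 2) ^ k) (nat≥0 2 ⊠ gap (1≤2^ k) ⊹ nat≥0 1) (lem ((+ 2) ^ k))
  where
  lem : ∀ x → (+ 2) * x - 1ℤ ≡ (+ 2) * (x - 1ℤ) + 1ℤ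
  lem = solve-∀

-- a is within a factor of two of √N, and a-huge says that it exceeds a power of log N.
module Sizes (K J a N : ℤ) (K-large : + 1219 ≤ (+ 3) * K) (1≤J : 1ℤ ≤ J) (1≤a : 1ℤ ≤ a)
  (N≤a² : N ≤ a * a) (a²≤4N : a * a ≤ (+ 4) * N)
  (a-huge : (+ 128) * (K * K) * (((+ 512) * (K * K) * J) * ((+ 512) * (K * K) * J)) ≤ a) where

  κ B ρ t b : ℤ
  κ = K * K
  B = (+ 512) * κ * J
  ρ = B * a
  t = (+ 32) * κ * a
  b = (+ 22) * κ * N

  3≤K : + 3 ≤ K
  3≤K = 0≤i-j⇒j≤i (cancel≥0 (+ 3) (+<+ (ℕ.s≤s ℕ.z≤n)) (subst (0ℤ ≤_) (lem K) (gap K-large ⊹ nat≥0 1210)))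
    where
    lem : ∀ K → (+ 3) * K - (+ 1219) + (+ 1210) ≡ (+ 3) * (K - (+ 3))
    lem = solve-∀

  0≤K : 0ℤ ≤ K
  0≤K = ≤-trans (nat≥0 3) 3≤K

  0≤κ : 0ℤ ≤ κ
  0≤κ = sq≥0 K

  0≤J : 0ℤ ≤ J
  0≤J = ≤-trans (nat≥0 1) 1≤J

  0≤a : 0ℤ ≤ a
  0≤a = ≤-trans (nat≥0 1) 1≤a

  1≤κ : 1ℤ ≤ κ
  1≤κ = gap⁻¹ 1ℤ κ (gap 3≤K ⊠ (0≤K ⊹ nat≥0 3) ⊹ nat≥0 8) (lem K)
    where
    lem : ∀ K → K * K - 1ℤ ≡ (K - (+ 3)) * (K + (+ 3)) + (+ 8)
    lem = solve-∀

  K≤κ : K ≤ κ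
  K≤κ = gap⁻¹ K κ (gap 3≤K ⊠ 0≤K ⊹ nat≥0 2 ⊠ 0≤K) (lem K)
    where
    lem : ∀ K → K * K - K ≡ (K - (+ 3)) * K + (+ 2) * K
    lem = solve-∀

  96K≤32κ : K * (+ 96) ≤ (+ 32) * κ
  96K≤32κ = gap⁻¹ (K * (+ 96)) ((+ 32) * κ) (nat≥0 32 ⊠ gap 3≤K ⊠ 0≤K) (lem K)
    where
    lem : ∀ K → (+ 32) * (K * K) - K * (+ 96) ≡ (+ 32) * (K - (+ 3)) * K
    lem = solve-∀

  32κ≤B : (+ 32) * κ ≤ B
  32κ≤B = gap⁻¹ ((+ 32) * κ) B (nat≥0 512 ⊠ 0≤κ ⊠ gap 1≤J ⊹ nat≥0 480 ⊠ 0≤κ) (lem κ J)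
    where
    lem : ∀ κ J → (+ 512) * κ * J - (+ 32) * κ ≡ (+ 512) * κ * (J - 1ℤ) + (+ 480) * κ
    lem = solve-∀

  12J≤B : (+ 12) * J ≤ B
  12J≤B = gap⁻¹ ((+ 12) * J) B (nat≥0 512 ⊠ gap 1≤κ ⊠ 0≤J ⊹ nat≥0 500 ⊠ 0≤J) (lem κ J)
    where
    lem : ∀ κ J → (+ 512) * κ * J - (+ 12) * J ≡ (+ 512) * (κ - 1ℤ) * J + (+ 500) * J
    lem = solve-∀

  1≤B : 1ℤ ≤ B
  1≤B = ≤-trans 1≤J (≤-trans (gap⁻¹ J ((+ 12) * J) (nat≥0 11 ⊠ 0≤J) (lem J)) 12J≤B)
    where
    lem : ∀ J → (+ 12) * J - J ≡ (+ 11) * J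
    lem = solve-∀

  0≤B : 0ℤ ≤ B
  0≤B = ≤-trans (nat≥0 1) 1≤B

  0≤ρ : 0ℤ ≤ ρ
  0≤ρ = 0≤B ⊠ 0≤a

  B≤ρ : B ≤ ρ
  B≤ρ = gap⁻¹ B ρ (0≤B ⊠ gap 1≤a) (lem B a)
    where
    lem : ∀ B a → B * a - B ≡ B * (a - 1ℤ)
    lem = solve-∀

  1≤ρ : 1ℤ ≤ ρ
  1≤ρ = ≤-trans 1≤B B≤ρ

  0≤t : 0ℤ ≤ t
  0≤t = nat≥0 32 ⊠ 0≤κ ⊠ 0≤a

  t≤ρ : t ≤ ρ
  t≤ρ = gap⁻¹ t ρ (gap 32κ≤B ⊠ 0≤a) (lem κ B a)
    where
    lem : ∀ κ B a → B * a - (+ 32) * κ * a ≡ (B - (+ 32) * κ) * a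
    lem = solve-∀

  X : ℤ
  X = κ * (B * B) * a

  0≤X : 0ℤ ≤ X
  0≤X = 0≤κ ⊠ (0≤B ⊠ 0≤B) ⊠ 0≤a

  ρ≤X : ρ ≤ X
  ρ≤X = gap⁻¹ ρ X ((gap 1≤κ ⊠ 0≤B ⊹ gap 1≤B) ⊠ 0≤ρ) (lem κ B a)
    where
    lem : ∀ κ B a → κ * (B * B) * a - B * a ≡ ((κ - 1ℤ) * B + (B - 1ℤ)) * (B * a)
    lem = solve-∀

  Kρ≤X : K * ρ ≤ X
  Kρ≤X = gap⁻¹ (K * ρ) X ((0≤κ ⊠ gap 1≤B ⊹ gap K≤κ) ⊠ 0≤ρ) (lem K κ B a)
    where
    lem : ∀ K κ B a → κ * (B * B) * a - K * (B * a) ≡ (κ * (B - 1ℤ) + (κ - K)) * (B * a)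
    lem = solve-∀

  32X≤N : (+ 32) * X ≤ N
  32X≤N = 0≤i-j⇒j≤i (cancel≥0 (+ 4) (+<+ (ℕ.s≤s ℕ.z≤n)) (subst (0ℤ ≤_) (lem κ B a N) (gap a-huge ⊠ 0≤a ⊹ gap a²≤4N)))
    where
    lem : ∀ κ B a N → (a - (+ 128) * κ * (B * B)) * a + ((+ 4) * N - a * a) ≡ (+ 4) * (N - (+ 32) * (κ * (B * B) * a))
    lem = solve-∀

  room : K * (1ℤ + ρ) + ρ ≤ N
  room = gap⁻¹ (K * (1ℤ + ρ) + ρ) N (gap 32X≤N ⊹ nat≥0 2 ⊠ gap Kρ≤X ⊹ gap ρ≤X ⊹ 0≤K ⊠ gap 1≤ρ ⊹ nat≥0 29 ⊠ 0≤X) (lem K ρ X N)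
    where
    lem : ∀ K ρ X N → N - (K * (1ℤ + ρ) + ρ) ≡ N - (+ 32) * X + (+ 2) * (X - K * ρ) + (X - ρ) + K * (ρ - 1ℤ) + (+ 29) * X
    lem = solve-∀

  room′ : K * (+ 96) + ρ ≤ N
  room′ = gap⁻¹ (K * (+ 96) + ρ) N (gap 32X≤N ⊹ gap (≤-trans 96K≤32κ (≤-trans 32κ≤B B≤ρ)) ⊹ nat≥0 2 ⊠ gap ρ≤X ⊹ nat≥0 30 ⊠ 0≤X)
    (lem (K * (+ 96)) ρ X N)
    where
    lem : ∀ L ρ X N → N - (L + ρ) ≡ N - (+ 32) * X + (ρ - L) + (+ 2) * (X - ρ) + (+ 30) * X
    lem = solve-∀

  rounds : 1ℤ + ((+ 12) * (J - 1ℤ) + (+ 9) + ρ) ≤ N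
  rounds = gap⁻¹ (1ℤ + ((+ 12) * (J - 1ℤ) + (+ 9) + ρ)) N (gap 32X≤N ⊹ gap (≤-trans 12J≤B B≤ρ) ⊹ nat≥0 2 ⊠ gap ρ≤X ⊹ nat≥0 30 ⊠ 0≤X ⊹ nat≥0 2)
    (lem J ρ X N)
    where
    lem : ∀ J ρ X N → N - (1ℤ + ((+ 12) * (J - 1ℤ) + (+ 9) + ρ)) ≡ N - (+ 32) * X + (ρ - (+ 12) * J) + (+ 2) * (X - ρ) + (+ 30) * X + (+ 2)
    lem = solve-∀

  t+ρ≤N : t + ρ ≤ N
  t+ρ≤N = gap⁻¹ (t + ρ) N (gap 32X≤N ⊹ gap t≤ρ ⊹ nat≥0 2 ⊠ gap ρ≤X ⊹ nat≥0 30 ⊠ 0≤X) (lem t ρ X N)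
    where
    lem : ∀ L ρ X N → N - (L + ρ) ≡ N - (+ 32) * X + (ρ - L) + (+ 2) * (X - ρ) + (+ 30) * X
    lem = solve-∀

  b-small : (+ 32) * κ * b ≤ t * t
  b-small = gap⁻¹ ((+ 32) * κ * b) (t * t) (nat≥0 704 ⊠ (0≤κ ⊠ 0≤κ) ⊠ gap N≤a² ⊹ nat≥0 320 ⊠ (0≤κ ⊠ 0≤κ) ⊠ (0≤a ⊠ 0≤a)) (lem κ a N)
    where
    lem : ∀ κ a N → (+ 32) * κ * a * ((+ 32) * κ * a) - (+ 32) * κ * ((+ 22) * κ * N) ≡ (+ 704) * (κ * κ) * (a * a - N) + (+ 320) * (κ * κ) * (a * a)
    lem = solve-∀

  32κ≤t : (+ 32) * κ ≤ t
  32κ≤t = gap⁻¹ ((+ 32) * κ) t (nat≥0 32 ⊠ 0≤κ ⊠ gap 1≤a) (lem κ a)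
    where
    lem : ∀ κ a → (+ 32) * κ * a - (+ 32) * κ ≡ (+ 32) * κ * (a - 1ℤ)
    lem = solve-∀

  module _ (n′ : ℤ) (N-ρ≤n′ : N - ρ ≤ n′) (n′≤N : n′ ≤ N) where

    initial : (+ 4) * κ * ((1ℤ + ρ) * (1ℤ + ρ)) ≤ a * n′
    initial = gap⁻¹ ((+ 4) * κ * ((1ℤ + ρ) * (1ℤ + ρ))) (a * n′)
      (0≤a ⊠ gap N-ρ≤n′ ⊹ 0≤a ⊠ (gap 32X≤N ⊹ gap ρ≤X ⊹ nat≥0 15 ⊠ 0≤X) ⊹ nat≥0 4 ⊠ 0≤κ ⊠ gap 1≤ρ ⊠ (nat≥0 3 ⊠ 0≤ρ ⊹ nat≥0 1))
      (lem κ B a N n′)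
      where
      lem : ∀ κ B a N n′ → a * n′ - (+ 4) * κ * ((1ℤ + B * a) * (1ℤ + B * a)) ≡
        a * (n′ - (N - B * a)) + a * (N - (+ 32) * (κ * (B * B) * a) + (κ * (B * B) * a - B * a) + (+ 15) * (κ * (B * B) * a))
        + (+ 4) * κ * (B * a - 1ℤ) * ((+ 3) * (B * a) + 1ℤ)
      lem = solve-∀

    b-large : (+ 64) * κ * n′ ≤ (+ 3) * b
    b-large = gap⁻¹ ((+ 64) * κ * n′) ((+ 3) * b) (nat≥0 64 ⊠ 0≤κ ⊠ gap n′≤N ⊹ nat≥0 2 ⊠ 0≤κ ⊠ 0≤N) (lem κ N n′)
      where
      0≤N : 0ℤ ≤ N
      0≤N = ≤-trans (0≤t ⊹ 0≤ρ) t+ρ≤N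
      lem : ∀ κ N n → (+ 3) * ((+ 22) * κ * N) - (+ 64) * κ * n ≡ (+ 64) * κ * (N - n) + (+ 2) * κ * N
      lem = solve-∀

    t≤n′ : t ≤ n′
    t≤n′ = gap⁻¹ t n′ (gap t+ρ≤N ⊹ gap N-ρ≤n′) (lem t ρ N n′)
      where
      lem : ∀ t ρ N n → n - t ≡ N - (t + ρ) + (n - (N - ρ))
      lem = solve-∀

module Assembly {n : ℕ} (G : OrientedGraph n) (semi : SemiRegularTournament G) (4∣n : 4 ∣ n)
  (K : ℤ) (K-large : + 1219 ≤ (+ 3) * K) (j : ℕ)
  (N<a² : + n < (+ 2) ^ suc j * (+ 2) ^ suc j) (a²≤4N : (+ 2) ^ suc j * (+ 2) ^ suc j ≤ (+ 4) * + n)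
  (a-huge : (+ 128) * (K * K) * (((+ 512) * (K * K) * + suc (suc j ℕ.* 4)) * ((+ 512) * (K * K) * + suc (suc j ℕ.* 4))) ≤ (+ 2) ^ suc j) where

  open FromGraph G
  open Absorbers arc arc-flip K K-large (allFin n) ∈-allFin

  private
    a : ℤ
    a = (+ 2) ^ suc j
    h : ℕ
    h = suc j ℕ.* 4
    J : ℤ
    J = + suc h

    module S = Sizes K J a (+ n) K-large (+≤+ (ℕ.s≤s ℕ.z≤n)) (1≤2^ (suc j)) (<⇒≤ N<a²) a²≤4N a-huge

    #allFin : # (allFin n) ≡ + n
    #allFin = cong +_ (length-tabulate {n = n} (λ i → i))

    h-large : # (allFin n) * (+ 2) ^ h < (+ 3) ^ h
    h-large = subst (λ m → m * (+ 2) ^ h < (+ 3) ^ h) (sym #allFin) (suc[i]≤j⇒i<j (gap⁻¹ (1ℤ + + n * (+ 2) ^ h) ((+ 3) ^ h)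
      (gap (2^6e≤3^4e (suc j)) ⊹ gap (i<j⇒suc[i]≤j N<a²) ⊠ ≤-trans (nat≥0 1) (1≤2^ h) ⊹ gap (1≤2^ h))
      (lem a ((+ 2) ^ h) ((+ 3) ^ h) (+ n))))
      where
      lem : ∀ a x y n → y - (1ℤ + n * x) ≡ y - a * a * x + (a * a - (1ℤ + n)) * x + (x - 1ℤ)
      lem = solve-∀

    h-small : (+ 12) * + h + (+ 9) + S.ρ < # (allFin n)
    h-small = subst ((+ 12) * + h + (+ 9) + S.ρ <_) (sym #allFin) (suc[i]≤j⇒i<j
      (subst (λ i → 1ℤ + ((+ 12) * i + (+ 9) + S.ρ) ≤ + n) (lem (+ h)) S.rounds))
      where
      lem : ∀ h → 1ℤ + h - 1ℤ ≡ h
      lem = solve-∀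

    open Reservoir (few-non semi) (near-regular semi) S.ρ
      (subst (K * (1ℤ + S.ρ) + S.ρ ≤_) (sym #allFin) S.room)
      (subst (K * (+ 96) + S.ρ ≤_) (sym #allFin) S.room′) h h-large h-small

    m : ℕ
    m = ∣ S.t ∣

    m≡t : + m ≡ S.t
    m≡t = 0≤i⇒+∣i∣≡i S.0≤t

    absorber-size : + (m ℕ.* 4) * (1ℤ + σ) ≡ S.ρ
    absorber-size = trans (cong (_* (1ℤ + σ)) (trans (pos-* m 4) (cong (_* (+ 4)) m≡t))) (lem S.κ a (+ h))
      where
      lem : ∀ κ a h → (+ 32) * κ * a * (+ 4) * (1ℤ + ((+ 4) * h + (+ 3))) ≡ (+ 512) * κ * (1ℤ + h) * a
      lem = solve-∀

    tiled-length : ∀ {vs} → Tiled vs → 4 ∣ length vs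
    tiled-length [] = divides 0 refl
    tiled-length (tile _ t p) = subst (4 ∣_) (sym (↭-length p)) (∣m∣n⇒∣m+n (divides 1 refl) (tiled-length t))

  private module WithAbsorber (𝔸 : Absorber m) where
    module A = Absorber 𝔸

    U : List (Fin n)
    U = A.rest

    #used≤ρ : # A.used ≤ S.ρ
    #used≤ρ = subst (# A.used ≤_) absorber-size A.small

    n≡ : + n ≡ # A.used + # U
    n≡ = trans (sym #allFin) (trans (cong +_ (↭-length A.split)) (#-++ A.used U))

    N-ρ≤#U : + n - S.ρ ≤ # U
    N-ρ≤#U = subst (λ n → n - S.ρ ≤ # U) (sym n≡) (gap⁻¹ (# A.used + # U - S.ρ) (# U) (gap #used≤ρ) (lem (# A.used) (# U) S.ρ))
      where
      lem : ∀ r u ρ → u - (r + u - ρ) ≡ ρ - r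
      lem = solve-∀

    #U≤N : # U ≤ + n
    #U≤N = subst (# U ≤_) (sym n≡) (i≤j+i (# U) (# A.used))

    module Av = Available {A.used} {U} A.split #used≤ρ

    Φ≤ : Φ U ≤ # U * ((1ℤ + S.ρ) * (1ℤ + S.ρ))
    Φ≤ = ≤-trans (∑-mono U {λ v → deg U v * deg U v} {λ _ → (1ℤ + S.ρ) * (1ℤ + S.ρ)} (λ v _ → pt v)) (≤-reflexive (∑-const U ((1ℤ + S.ρ) * (1ℤ + S.ρ))))
      where
      lem : ∀ e r → r * r - e * e ≡ (r - e) * (r + e)
      lem = solve-∀
      d≤ : ∀ v → ab (deg U v) ≤ 1ℤ + S.ρ
      d≤ v = ≤-trans (Av.|d|≤ v) (+-monoʳ-≤ 1ℤ #used≤ρ)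
      pt : ∀ v → deg U v * deg U v ≤ (1ℤ + S.ρ) * (1ℤ + S.ρ)
      pt v = subst (_≤ (1ℤ + S.ρ) * (1ℤ + S.ρ)) (ab-sq (deg U v)) (gap⁻¹ (ab (deg U v) * ab (deg U v)) ((1ℤ + S.ρ) * (1ℤ + S.ρ))
        (gap (d≤ v) ⊠ (nat≥0 1 ⊹ S.0≤ρ ⊹ ab≥0 (deg U v))) (lem (ab (deg U v)) (1ℤ + S.ρ)))

    0≤b : 0ℤ ≤ S.b
    0≤b = nat≥0 22 ⊠ S.0≤κ ⊠ nat≥0 n

    open Nibbling a S.b S.t S.0≤a 0≤b ≤-refl S.b-small S.32κ≤t (≤-trans S.96K≤32κ S.32κ≤t)

    invariant : Invariant U 0ℤ
    invariant = gap⁻¹ ((+ 4) * S.κ * Φ U + 0ℤ * (# U * # U)) (a * (# U * # U) + S.b * # U)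
      (nat≥0 4 ⊠ S.0≤κ ⊠ gap Φ≤ ⊹ gap (S.initial (# U) N-ρ≤#U #U≤N) ⊠ nat≥0 (length U) ⊹ 0≤b ⊠ nat≥0 (length U))
      (lem S.κ (Φ U) (# U) a S.b (1ℤ + S.ρ))
      where
      lem : ∀ κ P n a b r → a * (n * n) + b * n - ((+ 4) * κ * P + 0ℤ * (n * n)) ≡
        (+ 4) * κ * (n * (r * r) - P) + (a * n - (+ 4) * κ * (r * r)) * n + b * n
      lem = solve-∀

    initially : Ready U 0ℤ
    initially = ready ≤-refl invariant (S.b-large (# U) N-ρ≤#U #U≤N) Av.few (S.t≤n′ (# U) N-ρ≤#U #U≤N)

    module WithLeftover (𝕃 : Leftover U 0ℤ) where
      module L = Leftover 𝕃

      whole : allFin n ↭ L.tiles ++ (L.rest ++ A.used)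
      whole = ↭-trans A.split (↭-trans (++⁺ˡ A.used L.split) (↭-trans (shifts A.used L.tiles) (++⁺ˡ L.tiles (++-comm A.used L.rest))))

      4∣rest : 4 ∣ length L.rest
      4∣rest = ∣m+n∣m⇒∣n {m = length A.used} (subst (4 ∣_) eq′ (∣m+n∣m⇒∣n {m = length L.tiles} (subst (4 ∣_) eq 4∣n) (tiled-length L.tiled)))
        (tiled-length A.tiled)
        where
        eq : n ≡ length L.tiles ℕ.+ length (L.rest ++ A.used)
        eq = trans (sym (length-tabulate {n = n} (λ i → i))) (trans (↭-length whole) (length-++ L.tiles))
        eq′ : length (L.rest ++ A.used) ≡ length A.used ℕ.+ length L.rest
        eq′ = trans (length-++ L.rest) (ℕ.+-comm (length L.rest) (length A.used))

      few-rest : ∀ q → length L.rest ≡ q ℕ.* 4 → q ℕ.≤ m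
      few-rest q eq = ℕ.*-cancelʳ-≤ q m 4 (drop‿+≤+ (begin
        + (q ℕ.* 4) ≡⟨ cong +_ (sym eq) ⟩
        # L.rest ≡⟨ sym (+-identityʳ (# L.rest)) ⟩
        # L.rest + 0ℤ ≤⟨ L.small ⟩
        (+ 4) * S.t ≡⟨ cong ((+ 4) *_) (sym m≡t) ⟩
        (+ 4) * + m ≡⟨ *-comm (+ 4) (+ m) ⟩
        + m * (+ 4) ≡⟨ sym (pos-* m 4) ⟩
        + (m ℕ.* 4) ∎))
        where open ≤-Reasoning

      tiling : Tiled (allFin n)
      tiling = finish 4∣rest
        where
        finish : 4 ∣ length L.rest → Tiled (allFin n)
        finish (divides q eq) = Tiled-↭ (↭-sym whole) (Tiled-++ L.tiled (A.absorbs q (few-rest q eq) L.rest eq))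

    tiling : Tiled (allFin n)
    tiling = WithLeftover.tiling (nibble (suc (length U)) U 0ℤ (ℕ.n<1+n (length U)) initially)

  perfect : PerfectTiling D112 G
  perfect = tiled⇒perfect K K-large (WithAbsorber.tiling (absorber m (≤-reflexive absorber-size)))

pos-^ : ∀ e → (+ 2) ^ e ≡ + (2 ℕ.^ e)
pos-^ zero = refl
pos-^ (suc e) = trans (cong ((+ 2) *_) (pos-^ e)) (sym (pos-* 2 (2 ℕ.^ e)))

n<2^n : ∀ n → suc n ℕ.≤ 2 ℕ.^ n
n<2^n zero = ℕ.≤-refl
n<2^n (suc n) = ℕ.+-mono-≤ (ℕ.≤-trans (ℕ.s≤s ℕ.z≤n) (n<2^n n)) (ℕ.≤-trans (n<2^n n) (ℕ.≤-reflexive (sym (ℕ.+-identityʳ _))))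

quadratic≤2^ : ∀ C e → 144 ℕ.* C ℕ.* 3 ℕ.≤ e → C ℕ.* (suc (e ℕ.* 4) ℕ.* suc (e ℕ.* 4)) ℕ.≤ 2 ℕ.^ e
quadratic≤2^ C e h = begin
  C ℕ.* (suc (e ℕ.* 4) ℕ.* suc (e ℕ.* 4))   ≤⟨ ℕ.*-monoʳ-≤ C (ℕ.*-mono-≤ 1+4e≤ 1+4e≤) ⟩
  C ℕ.* (12 ℕ.* Q ℕ.* (12 ℕ.* Q))           ≡⟨ lem C Q ⟩
  144 ℕ.* C ℕ.* (Q ℕ.* Q)                   ≤⟨ ℕ.*-monoˡ-≤ (Q ℕ.* Q) 144C≤Q ⟩
  Q ℕ.* (Q ℕ.* Q)                           ≤⟨ ℕ.*-mono-≤ (n<2^n q) (ℕ.*-mono-≤ (n<2^n q) (n<2^n q)) ⟩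
  2 ℕ.^ q ℕ.* (2 ℕ.^ q ℕ.* 2 ℕ.^ q)         ≡⟨ cong (2 ℕ.^ q ℕ.*_) (sym (ℕ.^-distribˡ-+-* 2 q q)) ⟩
  2 ℕ.^ q ℕ.* 2 ℕ.^ (q ℕ.+ q)               ≡⟨ sym (ℕ.^-distribˡ-+-* 2 q (q ℕ.+ q)) ⟩
  2 ℕ.^ (q ℕ.+ (q ℕ.+ q))                   ≤⟨ ℕ.^-monoʳ-≤ 2 3q≤e ⟩
  2 ℕ.^ e ∎
  where
  open ℕ.≤-Reasoning
  q = e / 3
  Q = suc q
  lem : ∀ C Q → C ℕ.* (12 ℕ.* Q ℕ.* (12 ℕ.* Q)) ≡ 144 ℕ.* C ℕ.* (Q ℕ.* Q)
  lem = ℕ-solve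
  e≡ : e ≡ e % 3 ℕ.+ q ℕ.* 3
  e≡ = m≡m%n+[m/n]*n e 3
  3q≤e : q ℕ.+ (q ℕ.+ q) ℕ.≤ e
  3q≤e = subst₂ ℕ._≤_ (lem₁ q) (sym e≡) (ℕ.m≤n+m (q ℕ.* 3) (e % 3))
    where
    lem₁ : ∀ q → q ℕ.* 3 ≡ q ℕ.+ (q ℕ.+ q)
    lem₁ = ℕ-solve
  e<3Q : e ℕ.< Q ℕ.* 3
  e<3Q = subst (ℕ._< Q ℕ.* 3) (sym e≡) (ℕ.+-monoˡ-< (q ℕ.* 3) (m%n<n e 3))
  144C≤Q : 144 ℕ.* C ℕ.≤ Q
  144C≤Q = ℕ.<⇒≤ (ℕ.*-cancelʳ-< 3 (144 ℕ.* C) Q (ℕ.≤-<-trans h e<3Q))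
  1+4e≤ : suc (e ℕ.* 4) ℕ.≤ 12 ℕ.* Q
  1+4e≤ = ℕ.≤-trans (ℕ.*-monoˡ-< 4 e<3Q) (ℕ.≤-reflexive (lem₁ Q))
    where
    lem₁ : ∀ Q → Q ℕ.* 3 ℕ.* 4 ≡ 12 ℕ.* Q
    lem₁ = ℕ-solve

eventually : ∀ D → 0ℤ ≤ D → ∃ λ j₀ → ∀ j → j₀ ℕ.≤ j →
  D * (+ suc (suc j ℕ.* 4) * + suc (suc j ℕ.* 4)) ≤ (+ 2) ^ suc j
eventually (+ C) _ = 144 ℕ.* C ℕ.* 3 , λ j h → subst₂ _≤_ (lem C (suc (suc j ℕ.* 4))) (sym (pos-^ (suc j)))
  (+≤+ (quadratic≤2^ C (suc j) (ℕ.m≤n⇒m≤1+n h)))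
  where
  lem : ∀ C J → + (C ℕ.* (J ℕ.* J)) ≡ + C * (+ J * + J)
  lem C J = trans (pos-* C (J ℕ.* J)) (cong (+ C *_) (pos-* J J))

bracket : ∀ n → ∃ λ j → 2 ℕ.^ j ℕ.* 2 ℕ.^ j ℕ.≤ suc n × suc n ℕ.< 2 ℕ.^ suc j ℕ.* 2 ℕ.^ suc j
bracket zero = 0 , ℕ.≤-refl , ℕ.s≤s (ℕ.s≤s ℕ.z≤n)
bracket (suc n) with bracket n
... | j , lo , hi with suc (suc n) ℕ.<? 2 ℕ.^ suc j ℕ.* 2 ℕ.^ suc j
... | yes p = j , ℕ.m≤n⇒m≤1+n lo , p
... | no ¬p = suc j , ℕ.≮⇒≥ ¬p , ℕ.≤-<-trans hi (ℕ.*-mono-< grow grow)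
  where
  grow : 2 ℕ.^ suc j ℕ.< 2 ℕ.^ suc (suc j)
  grow = ℕ.^-monoʳ-< 2 (ℕ.s≤s (ℕ.s≤s ℕ.z≤n)) (ℕ.n<1+n (suc j))

tileable : ∀ K → + 1219 ≤ (+ 3) * K → Tileable D112
tileable K K-large = n₀ , tile-large
  where
  κ D : ℤ
  κ = K * K
  D = (+ 128) * κ * (((+ 512) * κ) * ((+ 512) * κ))
  threshold = eventually D (nat≥0 128 ⊠ sq≥0 K ⊠ (nat≥0 512 ⊠ sq≥0 K ⊠ (nat≥0 512 ⊠ sq≥0 K)))
  j₀ = proj₁ threshold
  n₀ = 2 ℕ.^ j₀ ℕ.* 2 ℕ.^ j₀
  1≤n₀ : 1 ℕ.≤ n₀
  1≤n₀ = ℕ.*-mono-≤ (ℕ.m^n>0 2 j₀) (ℕ.m^n>0 2 j₀)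
  lem : ∀ κ J → (+ 128) * κ * (((+ 512) * κ) * ((+ 512) * κ)) * (J * J) ≡ (+ 128) * κ * ((+ 512) * κ * J * ((+ 512) * κ * J))
  lem = solve-∀
  lem₁ : ∀ x → (+ 4) * (x * x) ≡ (+ 2) * x * ((+ 2) * x)
  lem₁ = solve-∀
  squares : ∀ e → + (2 ℕ.^ e ℕ.* 2 ℕ.^ e) ≡ (+ 2) ^ e * (+ 2) ^ e
  squares e = trans (pos-* (2 ℕ.^ e) (2 ℕ.^ e)) (sym (cong₂ _*_ (pos-^ e) (pos-^ e)))
  tile-large : ∀ n → n₀ ℕ.≤ n → 4 ∣ n → (G : OrientedGraph n) → SemiRegularTournament G → PerfectTiling D112 G
  tile-large zero n₀≤0 with () ← ℕ.≤-trans 1≤n₀ n₀≤0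
  tile-large (suc n) n₀≤n 4∣n G semi with bracket n
  ... | j , lo , hi = Assembly.perfect G semi 4∣n K K-large j
    (subst (+ suc n <_) (squares (suc j)) (+<+ hi))
    (subst (_≤ (+ 4) * + suc n) (trans (cong ((+ 4) *_) (squares j)) (lem₁ ((+ 2) ^ j))) (*-monoˡ-≤-nonNeg (+ 4) (+≤+ lo)))
    (subst (_≤ (+ 2) ^ suc j) (lem κ (+ suc (suc j ℕ.* 4))) (proj₂ threshold j (ℕ.≮⇒≥ j≮j₀)))
    where
    j≮j₀ : j ℕ.≮ j₀
    j≮j₀ j<j₀ = ℕ.<-irrefl refl (ℕ.<-≤-trans hi (ℕ.≤-trans (ℕ.*-mono-≤ grow grow) n₀≤n))
      where
      grow : 2 ℕ.^ suc j ℕ.≤ 2 ℕ.^ j₀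
      grow = ℕ.^-monoʳ-≤ 2 j<j₀

theorem1p13 : Tileable D112
theorem1p13 = tileable (+ 407) (≤ᵇ⇒≤ _)
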